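{- Let $n$ and $m$ be positive integers. Let $\mathbf{c}\in\mathbb{Z}[t]^n$, $A\in\mathbb{Z}[t]^{m\times n}$ and $\mathbf{b}\in\mathbb{Z}[t]^m$. For every positive integer $t$, let $R(t):=\{\mathbf{x}\in\mathbb{R}^n \mid A(t)\mathbf{x}\le \mathbf{b}(t)\}$ and $L(t):=R(t)\cap\mathbb{Z}^n$. Assume that $R(t)$ is bounded for all positive integers $t$. For all positive integers $\ell$, let $f_\ell(t)$ be the $\ell^{\text{th}}$ largest value (with multiplicity) of $\mathbf{c}^{\intercal}(t)\mathbf{x}$ for $\mathbf{x}\in L(t)$, or $-\infty$ if $|L(t)|<\ell$. Then for all positive integers $\ell$, $f_\ell$ is eventually quasi-polynomial.
   Context: Inequalities between vectors are coordinate-wise. The variables $t$ and $\ell$ range over positive integers. The $\ell^{\text{th}}$ largest value with multiplicity means the $\ell^{\text{th}}$ largest element of the multiset $\{\mathbf{c}^{\intercal}(t)\mathbf{x} : \mathbf{x}\in L(t)\}$ (one entry for each $\mathbf{x}\in L(t)$). A function $g$ is eventually quasi-polynomial if its domain is a subset of $\mathbb{Z}$ containing all sufficiently large integers and there exist a positive integer $d$ and polynomials $P_0,\ldots,P_{d-1}\in\mathbb{R}[t]$ such that for all sufficiently large $t$, $g(t)=P_{t \bmod d}(t)$. By convention the constant function $-\infty$ counts as a polynomial, so each $P_j$ is allowed to be the constant $-\infty$. -}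

module Defs where

open import Algebra.Bundles using (AbelianGroup; RawSemiring)
import Algebra.Properties.Group as GroupProperties
open import Data.Empty using (⊥-elim)
open import Data.Fin using (Fin; fromℕ<)
open import Data.Integer as ℤ using (ℤ; +_; -[1+_])
import Data.Integer.DivMod as ℤ
import Data.Integer.Properties as ℤ
open import Data.List as List using (List; []; _∷_)
open import Data.List.Membership.Propositional using (_∈_)
open import Data.List.Membership.Propositional.Properties
  using (∈-filter⁺; ∈-filter⁻; ∈-applyUpTo⁺; ∈-cartesianProductWith⁺)
import Data.List.Relation.Unary.AllPairs as AllPairs
open import Data.List.Relation.Unary.All using ([])
open import Data.List.Relation.Unary.Any using (here)
import Data.List.Sort as Sort
open import Data.List.Relation.Unary.Unique.Propositional using (Unique)
import Data.List.Relation.Unary.Unique.Propositional.Properties as Unique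
import Data.Maybe as Maybe
open import Data.Nat as ℕ using (ℕ; zero; suc)
import Data.Nat.Properties as ℕ
open import Data.Product using (Σ-syntax; ∃-syntax; _×_; _,_; proj₁; proj₂)
open import Data.Rational as ℚ using (ℚ; 0ℚ; 1ℚ; ½)
import Data.Rational.Properties as ℚ
open import Data.Rational.Literals using (fromℤ)
open import Data.Rational.Solver using (module +-*-Solver)
import Data.Rational.Unnormalised as ℚᵘ
import Data.Rational.Unnormalised.Properties as ℚᵘ
open import Data.Sum using (inj₁; inj₂)
open import Data.Vec as Vec using (Vec; []; _∷_)
import Data.Vec.Properties as Vec
open import Data.Vec.Relation.Unary.All using (All; []; _∷_)
open import Data.Vec.Relation.Binary.Pointwise.Inductive as Pointwise
  using (Pointwise; []; _∷_)
open import Function using (_⇔_; mk⇔; Equivalence)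
open import Level using (0ℓ)
import Relation.Binary.Construct.Add.Infimum.Equality as InfimumEquality
open import Relation.Binary.PropositionalEquality
  using (_≡_; refl; sym; trans; cong; cong₂; subst; subst₂)
import Relation.Binary.Construct.Flip.EqAndOrd as Flip
open import Relation.Nullary using (Dec; yes; no)
import Relation.Nullary.Decidable as Dec
open import Relation.Nullary.Construct.Add.Infimum using (_₋)
open import Relation.Unary using (Pred)

-- Real numbers, as Cauchy sequences of rationals up to the equality _≃_.

Eventually : (ℕ → Set) → Set
Eventually P = ∃[ N ] ∀ n → N ℕ.≤ n → P n

record ℝ : Set where
  constructor mkℝ
  field
    seq    : ℕ → ℚ
    cauchy : ∀ ε .{{_ : ℚ.Positive ε}} →
             ∃[ N ] ∀ k n → N ℕ.≤ k → N ℕ.≤ n → ℚ.∣ seq k ℚ.- seq n ∣ ℚ.≤ ε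

open ℝ public

infix 4 _≃_ _≤_
infixl 6 _+_
infixl 7 _*_
infix 8 -_

_≃_ : ℝ → ℝ → Set
x ≃ y = ∀ ε .{{_ : ℚ.Positive ε}} →
        Eventually λ n → ℚ.∣ seq x n ℚ.- seq y n ∣ ℚ.≤ ε

_≤_ : ℝ → ℝ → Set
x ≤ y = ∀ ε .{{_ : ℚ.Positive ε}} →
        Eventually λ n → seq x n ℚ.≤ seq y n ℚ.+ ε

fromℚ : ℚ → ℝ
fromℚ q = mkℝ (λ _ → q) λ ε → 0 , λ _ _ _ _ →
  subst (ℚ._≤ ε) (sym (cong ℚ.∣_∣ (ℚ.+-inverseʳ q))) (ℚ.<⇒≤ (ℚ.positive⁻¹ ε))

ι : ℤ → ℝ
ι z = fromℚ (fromℤ z)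

-_ : ℝ → ℝ
- x = mkℝ (λ n → ℚ.- seq x n) λ ε →
  let N , h = cauchy x ε in
  N , λ k n N≤k N≤n → subst (ℚ._≤ ε)
    (trans (sym (ℚ.∣-p∣≡∣p∣ _)) (cong ℚ.∣_∣ (ℚ.neg-distrib-+ (seq x k) (ℚ.- seq x n))))
    (h k n N≤k N≤n)

_+_ : ℝ → ℝ → ℝ
x + y = mkℝ (λ n → seq x n ℚ.+ seq y n) λ ε →
  let instance
        ½ε>0 = ℚ.pos*pos⇒pos ½ ε
      N₁ , h₁ = cauchy x (½ ℚ.* ε)
      N₂ , h₂ = cauchy y (½ ℚ.* ε)
  in N₁ ℕ.⊔ N₂ , λ k n N≤k N≤n →
    let open ℚ.≤-Reasoning
        x-x = seq x k ℚ.- seq x n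
        y-y = seq y k ℚ.- seq y n
    in begin
      ℚ.∣ (seq x k ℚ.+ seq y k) ℚ.- (seq x n ℚ.+ seq y n) ∣
        ≡⟨ cong ℚ.∣_∣ (rearrange (seq x k) (seq y k) (seq x n) (seq y n)) ⟩
      ℚ.∣ x-x ℚ.+ y-y ∣
        ≤⟨ ℚ.∣p+q∣≤∣p∣+∣q∣ x-x y-y ⟩
      ℚ.∣ x-x ∣ ℚ.+ ℚ.∣ y-y ∣
        ≤⟨ ℚ.+-mono-≤ (h₁ k n (ℕ.m⊔n≤o⇒m≤o N₁ N₂ N≤k) (ℕ.m⊔n≤o⇒m≤o N₁ N₂ N≤n))
                      (h₂ k n (ℕ.m⊔n≤o⇒n≤o N₁ N₂ N≤k) (ℕ.m⊔n≤o⇒n≤o N₁ N₂ N≤n)) ⟩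
      ½ ℚ.* ε ℚ.+ ½ ℚ.* ε
        ≡⟨ sym (ℚ.*-distribʳ-+ ε ½ ½) ⟩
      1ℚ ℚ.* ε
        ≡⟨ ℚ.*-identityˡ ε ⟩
      ε ∎
  where
  rearrange : ∀ a b c d → (a ℚ.+ b) ℚ.- (c ℚ.+ d) ≡ (a ℚ.- c) ℚ.+ (b ℚ.- d)
  rearrange = solve 4 (λ a b c d → (a :+ b) :- (c :+ d) := (a :- c) :+ (b :- d)) refl
    where open +-*-Solver

∣_∣-bounded : ∀ x → Σ[ B ∈ ℚ ] ℚ.Positive B × Eventually λ n → ℚ.∣ seq x n ∣ ℚ.≤ B
∣ x ∣-bounded =
  let N , h = cauchy x 1ℚ
      instance
        ∣x∣≥0 = ℚ.∣-∣-nonNeg (seq x N)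
  in 1ℚ ℚ.+ ℚ.∣ seq x N ∣ , ℚ.pos+nonNeg⇒pos 1ℚ ℚ.∣ seq x N ∣ , N , λ n N≤n →
    let open ℚ.≤-Reasoning in begin
      ℚ.∣ seq x n ∣
        ≡⟨ cong ℚ.∣_∣ (split (seq x n) (seq x N)) ⟩
      ℚ.∣ (seq x n ℚ.- seq x N) ℚ.+ seq x N ∣
        ≤⟨ ℚ.∣p+q∣≤∣p∣+∣q∣ (seq x n ℚ.- seq x N) (seq x N) ⟩
      ℚ.∣ seq x n ℚ.- seq x N ∣ ℚ.+ ℚ.∣ seq x N ∣
        ≤⟨ ℚ.+-monoˡ-≤ ℚ.∣ seq x N ∣ (h n N N≤n ℕ.≤-refl) ⟩
      1ℚ ℚ.+ ℚ.∣ seq x N ∣ ∎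
  where
  split : ∀ a b → a ≡ (a ℚ.- b) ℚ.+ b
  split = solve 2 (λ a b → a := (a :- b) :+ b) refl
    where open +-*-Solver

*-mono-∣∣ : ∀ {p q B C} → ℚ.∣ p ∣ ℚ.≤ B → ℚ.∣ q ∣ ℚ.≤ C → ℚ.∣ p ℚ.* q ∣ ℚ.≤ B ℚ.* C
*-mono-∣∣ {p} {q} {B} {C} p≤B q≤C =
  let instance
        ∣q∣≥0 = ℚ.∣-∣-nonNeg q
        B≥0   = ℚ.nonNegative (ℚ.≤-trans (ℚ.0≤∣p∣ p) p≤B)
      open ℚ.≤-Reasoning
  in begin
    ℚ.∣ p ℚ.* q ∣         ≡⟨ ℚ.∣p*q∣≡∣p∣*∣q∣ p q ⟩
    ℚ.∣ p ∣ ℚ.* ℚ.∣ q ∣   ≤⟨ ℚ.*-monoʳ-≤-nonNeg ℚ.∣ q ∣ p≤B ⟩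
    B ℚ.* ℚ.∣ q ∣         ≤⟨ ℚ.*-monoˡ-≤-nonNeg B q≤C ⟩
    B ℚ.* C               ∎

_*_ : ℝ → ℝ → ℝ
x * y = mkℝ (λ n → seq x n ℚ.* seq y n) λ ε →
  let B , B>0 , N₁ , h₁ = ∣ x ∣-bounded
      C , C>0 , N₂ , h₂ = ∣ y ∣-bounded
      instance
        B+C>0 = ℚ.pos+pos⇒pos B {{B>0}} C {{C>0}}
        B+C≢0 = ℚ.pos⇒nonZero (B ℚ.+ C)
        1/>0  = ℚ.1/pos⇒pos (B ℚ.+ C)
      δ = ε ℚ.* (ℚ.1/ (B ℚ.+ C))
      instance
        δ>0 = ℚ.pos*pos⇒pos ε (ℚ.1/ (B ℚ.+ C))
      N₃ , h₃ = cauchy x δ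
      N₄ , h₄ = cauchy y δ
      N₁₂ = N₁ ℕ.⊔ N₂
      N₃₄ = N₃ ℕ.⊔ N₄
  in N₁₂ ℕ.⊔ N₃₄ , λ k n N≤k N≤n →
    let open ℚ.≤-Reasoning
        N₁₂≤k = ℕ.m⊔n≤o⇒m≤o N₁₂ N₃₄ N≤k
        N₁₂≤n = ℕ.m⊔n≤o⇒m≤o N₁₂ N₃₄ N≤n
        N₃₄≤k = ℕ.m⊔n≤o⇒n≤o N₁₂ N₃₄ N≤k
        N₃₄≤n = ℕ.m⊔n≤o⇒n≤o N₁₂ N₃₄ N≤n
        x-x = seq x k ℚ.- seq x n
        y-y = seq y k ℚ.- seq y n
    in begin
      ℚ.∣ seq x k ℚ.* seq y k ℚ.- seq x n ℚ.* seq y n ∣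
        ≡⟨ cong ℚ.∣_∣ (rearrange (seq x k) (seq y k) (seq x n) (seq y n)) ⟩
      ℚ.∣ seq x k ℚ.* y-y ℚ.+ seq y n ℚ.* x-x ∣
        ≤⟨ ℚ.∣p+q∣≤∣p∣+∣q∣ (seq x k ℚ.* y-y) (seq y n ℚ.* x-x) ⟩
      ℚ.∣ seq x k ℚ.* y-y ∣ ℚ.+ ℚ.∣ seq y n ℚ.* x-x ∣
        ≤⟨ ℚ.+-mono-≤
             (*-mono-∣∣ {seq x k} {y-y} (h₁ k (ℕ.m⊔n≤o⇒m≤o N₁ N₂ N₁₂≤k))
               (h₄ k n (ℕ.m⊔n≤o⇒n≤o N₃ N₄ N₃₄≤k) (ℕ.m⊔n≤o⇒n≤o N₃ N₄ N₃₄≤n)))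
             (*-mono-∣∣ {seq y n} {x-x} (h₂ n (ℕ.m⊔n≤o⇒n≤o N₁ N₂ N₁₂≤n))
               (h₃ k n (ℕ.m⊔n≤o⇒m≤o N₃ N₄ N₃₄≤k) (ℕ.m⊔n≤o⇒m≤o N₃ N₄ N₃₄≤n))) ⟩
      B ℚ.* δ ℚ.+ C ℚ.* δ
        ≡⟨ factor B C ε (ℚ.1/ (B ℚ.+ C)) ⟩
      ε ℚ.* ((B ℚ.+ C) ℚ.* ℚ.1/ (B ℚ.+ C))
        ≡⟨ cong (ε ℚ.*_) (ℚ.*-inverseʳ (B ℚ.+ C)) ⟩
      ε ℚ.* 1ℚ
        ≡⟨ ℚ.*-identityʳ ε ⟩
      ε ∎
  where
  open +-*-Solver
  rearrange : ∀ a b c d → a ℚ.* b ℚ.- c ℚ.* d ≡ a ℚ.* (b ℚ.- d) ℚ.+ d ℚ.* (a ℚ.- c)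
  rearrange = solve 4 (λ a b c d → a :* b :- c :* d := a :* (b :- d) :+ d :* (a :- c)) refl
  factor : ∀ B C ε r → B ℚ.* (ε ℚ.* r) ℚ.+ C ℚ.* (ε ℚ.* r) ≡ ε ℚ.* ((B ℚ.+ C) ℚ.* r)
  factor = solve 4 (λ B C ε r → B :* (ε :* r) :+ C :* (ε :* r) := ε :* ((B :+ C) :* r)) refl

ℝ-rawSemiring : RawSemiring 0ℓ 0ℓ
ℝ-rawSemiring = record
  { Carrier = ℝ
  ; _≈_     = _≃_
  ; _+_     = _+_
  ; _*_     = _*_
  ; 0#      = fromℚ 0ℚ
  ; 1#      = fromℚ 1ℚ
  }

-- A polynomial is the list of its coefficients, constant term first; trailing
-- zeros are allowed.

module Over (S : RawSemiring 0ℓ 0ℓ) where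
  open RawSemiring S renaming (_+_ to _⊕_; _*_ to _⊛_)

  Polynomial : Set
  Polynomial = List Carrier

  evaluate : Polynomial → Carrier → Carrier
  evaluate p x = List.foldr (λ a r → a ⊕ x ⊛ r) 0# p

  infix 8 _∙_
  _∙_ : ∀ {n} → Vec Carrier n → Vec Carrier n → Carrier
  u ∙ v = Vec.foldr′ _⊕_ 0# (Vec.zipWith _⊛_ u v)

module Overℤ = Over ℤ.+-*-rawSemiring
module Overℝ = Over ℝ-rawSemiring

ℤ[t] ℝ[t] : Set
ℤ[t] = Overℤ.Polynomial
ℝ[t] = Overℝ.Polynomial

infix 9 _⟨_⟩ _⟪_⟫

_⟨_⟩ : ∀ {n} → Vec ℤ[t] n → ℤ → Vec ℤ n
v ⟨ t ⟩ = Vec.map (λ p → Overℤ.evaluate p t) v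

_⟪_⟫ : ∀ {m n} → Vec (Vec ℤ[t] n) m → ℤ → Vec (Vec ℤ n) m
A ⟪ t ⟫ = Vec.map _⟨ t ⟩ A

-- The real polyhedron of a system with integer data, and its integer points.

Polyhedron : ∀ {m n} → Vec (Vec ℤ n) m → Vec ℤ m → Pred (Vec ℝ n) 0ℓ
Polyhedron A b x = Pointwise _≤_ (Vec.map (λ a → Vec.map ι a Overℝ.∙ x) A) (Vec.map ι b)

IntegerPoints : ∀ {n} → Pred (Vec ℝ n) 0ℓ → Pred (Vec ℤ n) 0ℓ
IntegerPoints S x = S (Vec.map ι x)

Bounded : ∀ {n} → Pred (Vec ℝ n) 0ℓ → Set
Bounded S = ∃[ M ] ∀ x → S x → All (λ xᵢ → - M ≤ xᵢ × xᵢ ≤ M) x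

record Enumeration {X : Set} (P : Pred X 0ℓ) : Set where
  field
    elements : List X
    unique   : Unique elements
    exact    : ∀ x → x ∈ elements ⇔ P x

-- The integer points of a bounded polyhedron can be enumerated: only integer
-- inequalities on a box have to be decided.

fromℤ-+ : ∀ a b → fromℤ (a ℤ.+ b) ≡ fromℤ a ℚ.+ fromℤ b
fromℤ-+ a b = ℚ.toℚᵘ-injective
  (ℚᵘ.≃-trans (ℚᵘ.≃-reflexive (cong (λ z → ℚᵘ.mkℚᵘ z 0)
    (sym (cong₂ ℤ._+_ (ℤ.*-identityʳ a) (ℤ.*-identityʳ b)))))
    (ℚᵘ.≃-sym (ℚ.toℚᵘ-homo-+ (fromℤ a) (fromℤ b))))

fromℤ-* : ∀ a b → fromℤ (a ℤ.* b) ≡ fromℤ a ℚ.* fromℤ b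
fromℤ-* a b = ℚ.toℚᵘ-injective (ℚᵘ.≃-sym (ℚ.toℚᵘ-homo-* (fromℤ a) (fromℤ b)))

fromℤ-neg : ∀ a → fromℤ (ℤ.- a) ≡ ℚ.- fromℤ a
fromℤ-neg (+ zero)  = refl
fromℤ-neg (+ suc _) = refl
fromℤ-neg -[1+ _ ]  = refl

fromℤ-mono-≤ : ∀ {a b} → a ℤ.≤ b → fromℤ a ℚ.≤ fromℤ b
fromℤ-mono-≤ a≤b = ℚ.*≤* (ℤ.*-monoʳ-≤-nonNeg (+ 1) a≤b)

fromℤ-cancel-≤ : ∀ {a b} → fromℤ a ℚ.≤ fromℤ b → a ℤ.≤ b
fromℤ-cancel-≤ (ℚ.*≤* a≤b) = ℤ.*-cancelʳ-≤-pos _ _ (+ 1) a≤b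

fromℤ-cancel-≤½ : ∀ {a b} → fromℤ a ℚ.≤ fromℤ b ℚ.+ ½ → a ℤ.≤ b
fromℤ-cancel-≤½ {a} {b} a≤b+½ with a ℤ.≤? b
... | yes a≤b = a≤b
... | no  a≰b = ⊥-elim (ℚ.<-irrefl refl (begin-strict
  fromℤ b ℚ.+ ½          <⟨ ℚ.+-monoʳ-< (fromℤ b) ½<1 ⟩
  fromℤ b ℚ.+ 1ℚ         ≡⟨ ℚ.+-comm (fromℤ b) 1ℚ ⟩
  1ℚ ℚ.+ fromℤ b         ≡⟨ sym (fromℤ-+ (+ 1) b) ⟩
  fromℤ (ℤ.suc b)        ≤⟨ fromℤ-mono-≤ (ℤ.i<j⇒suc[i]≤j (ℤ.≰⇒> a≰b)) ⟩
  fromℤ a                ≤⟨ a≤b+½ ⟩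
  fromℤ b ℚ.+ ½          ∎))
  where
  open ℚ.≤-Reasoning
  ½<1 : ½ ℚ.< 1ℚ
  ½<1 = Dec.toWitness {a? = ½ ℚ.<? 1ℚ} _

ceiling : ∀ q → Σ[ k ∈ ℕ ] q ℚ.≤ fromℤ (+ k)
ceiling q = ℤ.∣ ℚ.numerator q ∣ , ℚ.*≤* (begin
  ↥q ℤ.* + 1              ≡⟨ ℤ.*-identityʳ ↥q ⟩
  ↥q                      ≤⟨ i≤∣i∣ ↥q ⟩
  ∣q∣                     ≡⟨ sym (ℤ.*-identityʳ ∣q∣) ⟩
  ∣q∣ ℤ.* + 1             ≤⟨ ℤ.*-monoˡ-≤-nonNeg ∣q∣ (ℤ.+≤+ (ℕ.s≤s ℕ.z≤n)) ⟩
  ∣q∣ ℤ.* ℚ.denominator q ∎)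
  where
  open ℤ.≤-Reasoning
  ↥q = ℚ.numerator q
  ∣q∣ = + ℤ.∣ ↥q ∣
  i≤∣i∣ : ∀ i → i ℤ.≤ + ℤ.∣ i ∣
  i≤∣i∣ (+ _)    = ℤ.≤-refl
  i≤∣i∣ -[1+ _ ] = ℤ.-≤+

∙-ι : ∀ {n} (u v : Vec ℤ n) k →
      seq (Vec.map ι u Overℝ.∙ Vec.map ι v) k ≡ fromℤ (u Overℤ.∙ v)
∙-ι []      []      k = refl
∙-ι (a ∷ u) (x ∷ v) k = trans
  (cong₂ ℚ._+_ (sym (fromℤ-* a x)) (∙-ι u v k))
  (sym (fromℤ-+ (a ℤ.* x) (u Overℤ.∙ v)))

ι-≤ : ∀ (u v : ℤ) {x} → (∀ k → seq x k ≡ fromℤ u) → u ℤ.≤ v ⇔ x ≤ ι v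
ι-≤ u v {x} x≡u = mk⇔ to from
  where
  open ℚ.≤-Reasoning
  to : u ℤ.≤ v → x ≤ ι v
  to u≤v ε = 0 , λ k _ → begin
    seq x k          ≡⟨ x≡u k ⟩
    fromℤ u          ≤⟨ fromℤ-mono-≤ u≤v ⟩
    fromℤ v          ≡⟨ sym (ℚ.+-identityʳ (fromℤ v)) ⟩
    fromℤ v ℚ.+ 0ℚ   ≤⟨ ℚ.+-monoʳ-≤ (fromℤ v) (ℚ.<⇒≤ (ℚ.positive⁻¹ ε)) ⟩
    fromℤ v ℚ.+ ε    ∎
  from : x ≤ ι v → u ℤ.≤ v
  from x≤v = let N , h = x≤v ½ in
    fromℤ-cancel-≤½ (subst (ℚ._≤ fromℤ v ℚ.+ ½) (x≡u N) (h N ℕ.≤-refl))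

integerPoint⇔ : ∀ {m n} (A : Vec (Vec ℤ n) m) b x →
  Pointwise ℤ._≤_ (Vec.map (Overℤ._∙ x) A) b ⇔ IntegerPoints (Polyhedron A b) x
integerPoint⇔ []      []      x = mk⇔ (λ _ → []) (λ _ → [])
integerPoint⇔ (a ∷ A) (β ∷ b) x =
  let module H = Equivalence (ι-≤ (a Overℤ.∙ x) β {Vec.map ι a Overℝ.∙ Vec.map ι x} (∙-ι a x))
      module T = Equivalence (integerPoint⇔ A b x)
  in mk⇔ (λ { (h ∷ t) → H.to h ∷ T.to t }) (λ { (h ∷ t) → H.from h ∷ T.from t })

integerPoint? : ∀ {m n} (A : Vec (Vec ℤ n) m) b x → Dec (IntegerPoints (Polyhedron A b) x)
integerPoint? A b x = Dec.map (integerPoint⇔ A b x)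
  (Pointwise.decidable ℤ._≤?_ (Vec.map (Overℤ._∙ x) A) b)

interval : ℕ → List ℤ
interval K = List.applyUpTo (λ i → + i ℤ.- + K) (suc (K ℕ.+ K))

interval-unique : ∀ K → Unique (interval K)
interval-unique K = Unique.applyUpTo⁺₁ (λ i → + i ℤ.- + K) _ λ i<j _ eq →
  ℕ.<⇒≢ i<j (ℤ.+-injective (∙-cancelʳ (ℤ.- + K) _ _ eq))
  where open GroupProperties (AbelianGroup.group ℤ.+-0-abelianGroup)

∈-interval : ∀ K {z} → ℤ.- + K ℤ.≤ z → z ℤ.≤ + K → z ∈ interval K
∈-interval K {z} -K≤z z≤K = helper (z ℤ.+ + K) refl
  (subst (ℤ._≤ z ℤ.+ + K) (ℤ.+-inverseˡ (+ K)) (ℤ.+-monoˡ-≤ (+ K) -K≤z))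
  (ℤ.+-monoˡ-≤ (+ K) z≤K)
  where
  cancel : z ℤ.+ + K ℤ.- + K ≡ z
  cancel = trans (ℤ.+-assoc z (+ K) (ℤ.- + K))
                 (trans (cong (λ w → z ℤ.+ w) (ℤ.+-inverseʳ (+ K))) (ℤ.+-identityʳ z))
  helper : ∀ w → w ≡ z ℤ.+ + K → + 0 ℤ.≤ w → w ℤ.≤ + K ℤ.+ + K → z ∈ interval K
  helper (+ i) eq _ (ℤ.+≤+ i≤2K) = subst (_∈ interval K)
    (trans (cong (ℤ._- + K) eq) cancel) (∈-applyUpTo⁺ (λ i → + i ℤ.- + K) (ℕ.s≤s i≤2K))

box : ℕ → ∀ n → List (Vec ℤ n)
box K zero    = [] ∷ []
box K (suc n) = List.cartesianProductWith _∷_ (interval K) (box K n)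

box-unique : ∀ K n → Unique (box K n)
box-unique K zero    = [] AllPairs.∷ AllPairs.[]
box-unique K (suc n) =
  Unique.cartesianProductWith⁺ _∷_ Vec.∷-injective (interval-unique K) (box-unique K n)

∈-box : ∀ K {n} (x : Vec ℤ n) →
        All (λ z → ℤ.- + K ℤ.≤ z × z ℤ.≤ + K) x → x ∈ box K n
∈-box K []      []             = here refl
∈-box K (z ∷ x) ((l , u) ∷ hs) =
  ∈-cartesianProductWith⁺ _∷_ (∈-interval K l u) (∈-box K x hs)

natBound : ∀ M → Σ[ K ∈ ℕ ] ∀ z → - M ≤ ι z × ι z ≤ M → ℤ.- + K ℤ.≤ z × z ℤ.≤ + K
natBound M =
  let B , _ , N₀ , h₀ = ∣ M ∣-bounded
      k , B≤k = ceiling B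
      below : ∀ {q z} → ℚ.∣ q ∣ ℚ.≤ B → fromℤ z ℚ.≤ q ℚ.+ ½ → z ℤ.≤ + k
      below {q} {z} ∣q∣≤B z≤q+½ = fromℤ-cancel-≤½ (ℚ.≤-trans z≤q+½
        (ℚ.+-monoˡ-≤ ½ (ℚ.≤-trans (q≤∣q∣ q) (ℚ.≤-trans ∣q∣≤B B≤k))))
  in k , λ z (-M≤z , z≤M) →
    let N₁ , h₁ = -M≤z ½
        N₂ , h₂ = z≤M ½
        n₁ = N₀ ℕ.⊔ N₁
        n₂ = N₀ ℕ.⊔ N₂
    in subst (ℤ.- + k ℤ.≤_) (ℤ.neg-involutive z) (ℤ.neg-mono-≤
         (below (h₀ n₁ (ℕ.m≤m⊔n N₀ N₁))
           (subst (ℚ._≤ seq M n₁ ℚ.+ ½) (sym (fromℤ-neg z))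
             (flip (seq M n₁) (fromℤ z) (h₁ n₁ (ℕ.m≤n⊔m N₀ N₁))))))
     , below (h₀ n₂ (ℕ.m≤m⊔n N₀ N₂)) (h₂ n₂ (ℕ.m≤n⊔m N₀ N₂))
  where
  q≤∣q∣ : ∀ q → q ℚ.≤ ℚ.∣ q ∣
  q≤∣q∣ q with ℚ.≤-total 0ℚ q
  ... | inj₁ 0≤q = ℚ.≤-reflexive (sym (ℚ.0≤p⇒∣p∣≡p 0≤q))
  ... | inj₂ q≤0 = ℚ.≤-trans q≤0 (ℚ.0≤∣p∣ q)
  flip : ∀ p q → ℚ.- p ℚ.≤ q ℚ.+ ½ → ℚ.- q ℚ.≤ p ℚ.+ ½
  flip p q h = subst₂ ℚ._≤_ (e₁ p q) (e₂ p q ½) (ℚ.+-monoˡ-≤ (p ℚ.- q) h)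
    where
    open +-*-Solver
    e₁ : ∀ p q → ℚ.- p ℚ.+ (p ℚ.- q) ≡ ℚ.- q
    e₁ = solve 2 (λ p q → (:- p) :+ (p :- q) := :- q) refl
    e₂ : ∀ p q h → q ℚ.+ h ℚ.+ (p ℚ.- q) ≡ p ℚ.+ h
    e₂ = solve 3 (λ p q h → q :+ h :+ (p :- q) := p :+ h) refl

enumerateWithin : {X : Set} {P : Pred X 0ℓ} → (∀ x → Dec (P x)) →
  (xs : List X) → Unique xs → (∀ x → P x → x ∈ xs) → Enumeration P
enumerateWithin P? xs xs-unique P⊆xs = record
  { elements = List.filter P? xs
  ; unique   = Unique.filter⁺ P? xs-unique
  ; exact    = λ x → mk⇔
      (λ x∈ → proj₂ (∈-filter⁻ P? {xs = xs} x∈))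
      (λ Px → ∈-filter⁺ P? (P⊆xs x Px) Px)
  }

enumerate : ∀ {m n} (A : Vec (Vec ℤ n) m) (b : Vec ℤ m) →
            Bounded (Polyhedron A b) → Enumeration (IntegerPoints (Polyhedron A b))
enumerate {n = n} A b (M , M-bounds) =
  let K , K-bounds = natBound M in
  enumerateWithin {P = IntegerPoints (Polyhedron A b)} (integerPoint? A b)
    (box K n) (box-unique K n)
    (λ x Px → ∈-box K x (inBox K K-bounds x (M-bounds _ Px)))
  where
  inBox : ∀ K → (∀ z → - M ≤ ι z × ι z ≤ M → ℤ.- + K ℤ.≤ z × z ℤ.≤ + K) →
          ∀ {n} (x : Vec ℤ n) → All (λ xᵢ → - M ≤ xᵢ × xᵢ ≤ M) (Vec.map ι x) →
          All (λ z → ℤ.- + K ℤ.≤ z × z ℤ.≤ + K) x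
  inBox K h []      []       = []
  inBox K h (z ∷ x) (p ∷ ps) = h z p ∷ inBox K h x ps

module Descending = Sort (Flip.decTotalOrder ℤ.≤-decTotalOrder)

-- The list is a multiset; the value is nothing (that is, -∞) if it has fewer than ℓ entries.
ℓth-largest : (ℓ : ℕ) .{{_ : ℕ.NonZero ℓ}} → List ℤ → ℤ ₋
ℓth-largest ℓ vs = List.head (List.drop (ℕ.pred ℓ) (Descending.sort vs))

R : ∀ {m n} → Vec (Vec ℤ[t] n) m → Vec ℤ[t] m → ℤ → Pred (Vec ℝ n) 0ℓ
R A b t = Polyhedron (A ⟪ t ⟫) (b ⟨ t ⟩)

L : ∀ {m n} → Vec (Vec ℤ[t] n) m → Vec ℤ[t] m → ℤ → Pred (Vec ℤ n) 0ℓ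
L A b t = IntegerPoints (R A b t)

module _ {m n : ℕ} (c : Vec ℤ[t] n) (A : Vec (Vec ℤ[t] n) m) (b : Vec ℤ[t] m)
         (bounded : ∀ t .{{_ : ℤ.Positive t}} → Bounded (R A b t)) where

  L-enumeration : ∀ t .{{_ : ℤ.Positive t}} → Enumeration (L A b t)
  L-enumeration t = enumerate (A ⟪ t ⟫) (b ⟨ t ⟩) (bounded t)

  f : (ℓ : ℕ) .{{_ : ℕ.NonZero ℓ}} (t : ℤ) .{{_ : ℤ.Positive t}} → ℤ ₋
  f ℓ t = ℓth-largest ℓ (List.map (c ⟨ t ⟩ Overℤ.∙_) (Enumeration.elements (L-enumeration t)))

open InfimumEquality _≃_ public using (_≈₋_)

ι₋ : ℤ ₋ → ℝ ₋
ι₋ = Maybe.map ι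

-- nothing stands for the constant polynomial -∞.
evaluate₋ : ℝ[t] ₋ → ℤ → ℝ ₋
evaluate₋ P t = Maybe.map (λ p → Overℝ.evaluate p (ι t)) P

residue : ℤ → (d : ℕ) .{{_ : ℕ.NonZero d}} → Fin d
residue t d = fromℕ< (ℤ.n%ℕd<d t d)

EventuallyQuasiPolynomial : (D : Pred ℤ 0ℓ) → (∀ t → D t → ℝ ₋) → Set
EventuallyQuasiPolynomial D g =
  Σ[ d ∈ ℕ ] Σ[ d≢0 ∈ ℕ.NonZero d ] Σ[ P ∈ (Fin d → ℝ[t] ₋) ] Σ[ T ∈ ℤ ]
    ∀ t → T ℤ.≤ t →
      D t × (∀ t∈D → g t t∈D ≈₋ evaluate₋ (P (residue t d {{d≢0}})) t)

{-# OPTIONS --safe #-}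

-- Boundedness of the real polyhedra bounds their integer points polynomially in
-- t: climbing along one coordinate until a constraint is tight and eliminating
-- that coordinate keeps the system bounded and only squares its coefficients.
--
-- Writing x = t x′ + y repeatedly, x is expressed by digits of size O(t).  A
-- constraint e₀ + e₁ t + e₂ t² + … ≥ 0 then unfolds into finitely many systems of
-- constraints affine in (y, t) with constant coefficients, one for each sequence
-- of carries, which are bounded as e₀ = O(t).
--
-- For constant coefficients, an optimum can be moved along the first coordinate
-- (the objective may have coefficients polynomial in t, only the sign of one of
-- them matters) until a constraint a y₀ + … is between 0 and |a|.  Splitting t and the
-- other coordinates modulo |a| turns y₀ into one of finitely many affine
-- functions of them, so induction on the number of coordinates gives an optimal
-- point that is polynomial on residue classes of t.
--
-- Being polynomial, the optimum can be removed by finitely many systems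
-- ± (xᵢ - Xᵢ(t)) ≥ 1, and one proceeds to the next largest value.

module Submission where

open import Defs hiding (_+_; _*_) renaming (-_ to -ℝ_; _≤_ to _≤ℝ_)
open import Algebra.Bundles using (CommutativeRing; CommutativeSemiring)
open import Data.Empty using (⊥-elim)
open import Data.Fin as Fin using (Fin)
import Data.Fin.Properties as Fin
open import Data.Integer
  using (ℤ; +_; -[1+_]; +≤+; -_; _+_; _-_; _*_; _≤_; _<_; ∣_∣; Positive; 0ℤ; 1ℤ)
import Data.Integer as ℤ
import Data.Integer.DivMod as ℤ
import Data.Integer.Properties as ℤ
open import Data.Integer.Tactic.RingSolver using (solve-∀)
open import Data.List as List using (List; []; _∷_)
open import Data.List.Membership.Propositional using (_∈_; lose)
open import Data.List.Membership.Propositional.Properties using (∈-∃++; ∈-map⁻)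
open import Data.List.Relation.Binary.Permutation.Propositional
  using (_↭_; ↭-trans; ↭-sym; prep; ↭⇒↭ₛ)
open import Data.List.Relation.Binary.Permutation.Propositional.Properties
  using (All-resp-↭; ∈-resp-↭; ↭-empty-inv; map⁺; shift)
import Data.List.Relation.Binary.Permutation.Setoid.Properties as Permutationₛ
open import Data.List.Relation.Binary.Pointwise using (Pointwise-≡⇒≡)
open import Data.List.Relation.Unary.AllPairs using (_∷_)
open import Data.List.Relation.Unary.Linked.Properties using (AllPairs⇒Linked; Linked⇒AllPairs)
open import Data.List.Relation.Unary.Sorted.TotalOrder.Properties using (↗↭↗⇒≋)
open import Data.List.Relation.Unary.Unique.Propositional using (Unique)
open import Data.List.Relation.Unary.All as All using (All; []; _∷_)
import Data.List.Relation.Unary.All.Properties as All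
open import Data.List.Relation.Unary.Any as Any using (Any; here; there)
import Data.List.Relation.Unary.Any.Properties as Any
open import Data.Maybe as Maybe using (Maybe; just; nothing)
open import Data.Nat as ℕ using (ℕ; zero; suc; NonZero)
import Data.Nat.DivMod as ℕ
import Data.Nat.Properties as ℕ
open import Data.Product using (Σ-syntax; ∃-syntax; _×_; _,_; proj₁; proj₂)
open import Data.Rational as ℚ using (ℚ)
open import Data.Rational.Literals using (fromℤ)
import Data.Rational.Properties as ℚ
open import Data.Rational.Solver using (module +-*-Solver)
open import Data.Sum as Sum using (_⊎_; inj₁; inj₂)
open import Data.Vec as Vec using (Vec; []; _∷_)
import Data.Vec.Properties as Vec
open import Data.Vec.Relation.Binary.Pointwise.Inductive using (Pointwise; []; _∷_)
open import Data.Vec.Relation.Unary.All as Allᵥ using ([]; _∷_)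
open import Function using (_∘_; id; _⇔_; mk⇔; Equivalence)
open import Level using (0ℓ)
import Relation.Binary.Construct.Flip.EqAndOrd as Flip
open import Relation.Binary.PropositionalEquality
  using (_≡_; _≢_; refl; sym; trans; cong; cong₂; subst; subst₂; setoid; module ≡-Reasoning)
open import Relation.Nullary using (¬_; yes; no)
open import Relation.Binary.Construct.Add.Infimum.Equality using (⊥₋≈⊥₋; [_])
open import Relation.Nullary.Construct.Add.Infimum using (_₋)

-- The hypothesis bounds the polyhedra for each `t` separately and says nothing about how the bounds
-- vary with `t`; a polynomial bound has to be read off the coefficients. It is what limits the
-- number of digits.
--
-- The digits serve the moduli: splitting modulo the slope `a` of a tight constraint produces
-- finitely many classes, and a period, only if `a` does not depend on `t`. The objective is never
-- divided by, so its coefficients may stay polynomial.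
--
-- Removing an optimum requires the optimal point, not only its value, as a polynomial in `t`.
-- Therefore maxima are taken over vectors of outputs, which carry the coordinates of the original
-- point through every substitution. Ties are harmless, since a single point is removed at a time.
--
-- A reduction need not reach every point: it must stay inside the given family and retain, for each
-- point, one that is at least as good.

-- Polynomial arithmetic, for the coefficients ℤ and later ℚ

module PolynomialArithmetic (S : CommutativeSemiring 0ℓ 0ℓ) where
  open CommutativeSemiring S
    renaming (Carrier to C; _+_ to _⊕_; _*_ to _⊛_; refl to ≈-refl; sym to ≈-sym; trans to ≈-trans)
  open Over rawSemiring using (Polynomial; evaluate)
  open import Algebra.Solver.Ring.NaturalCoefficients.Default S
    using (solve; _:+_; _:*_; _:=_)

  infixl 6 _+ₚ_
  _+ₚ_ : Polynomial → Polynomial → Polynomial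
  []      +ₚ q       = q
  (a ∷ p) +ₚ []      = a ∷ p
  (a ∷ p) +ₚ (b ∷ q) = (a ⊕ b) ∷ (p +ₚ q)

  scale : C → Polynomial → Polynomial
  scale k = List.map (k ⊛_)

  affineTimes : C → C → Polynomial → Polynomial
  affineTimes κ ν q = scale κ q +ₚ (0# ∷ scale ν q)

  infixl 9 _∘ₚ_+_t
  _∘ₚ_+_t : Polynomial → C → C → Polynomial
  []      ∘ₚ κ + ν t = []
  (a ∷ p) ∘ₚ κ + ν t = (a ∷ []) +ₚ affineTimes κ ν (p ∘ₚ κ + ν t)

  evaluate-+ₚ : ∀ p q x → evaluate (p +ₚ q) x ≈ evaluate p x ⊕ evaluate q x
  evaluate-+ₚ []      q       x = ≈-sym (+-identityˡ _)
  evaluate-+ₚ (a ∷ p) []      x = ≈-sym (+-identityʳ _)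
  evaluate-+ₚ (a ∷ p) (b ∷ q) x = ≈-trans
    (+-congˡ (*-congˡ (evaluate-+ₚ p q x)))
    (solve 5 (λ a b x u v → (a :+ b) :+ x :* (u :+ v) := (a :+ x :* u) :+ (b :+ x :* v))
      ≈-refl a b x (evaluate p x) (evaluate q x))

  evaluate-scale : ∀ k p x → evaluate (scale k p) x ≈ k ⊛ evaluate p x
  evaluate-scale k []      x = ≈-sym (zeroʳ k)
  evaluate-scale k (a ∷ p) x = ≈-trans
    (+-congˡ (*-congˡ (evaluate-scale k p x)))
    (solve 4 (λ k a x u → k :* a :+ x :* (k :* u) := k :* (a :+ x :* u))
      ≈-refl k a x (evaluate p x))

  evaluate-affineTimes : ∀ κ ν q x →
    evaluate (affineTimes κ ν q) x ≈ (κ ⊕ ν ⊛ x) ⊛ evaluate q x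
  evaluate-affineTimes κ ν q x = ≈-trans (evaluate-+ₚ (scale κ q) (0# ∷ scale ν q) x)
    (≈-trans (+-cong (evaluate-scale κ q x)
                     (≈-trans (+-identityˡ _) (*-congˡ (evaluate-scale ν q x))))
      (solve 4 (λ κ ν x u → κ :* u :+ x :* (ν :* u) := (κ :+ ν :* x) :* u)
        ≈-refl κ ν x (evaluate q x)))

  evaluate-∘ₚ : ∀ p κ ν x → evaluate (p ∘ₚ κ + ν t) x ≈ evaluate p (κ ⊕ ν ⊛ x)
  evaluate-∘ₚ []      κ ν x = ≈-refl
  evaluate-∘ₚ (a ∷ p) κ ν x = ≈-trans (evaluate-+ₚ (a ∷ []) (affineTimes κ ν (p ∘ₚ κ + ν t)) x)
    (+-cong (≈-trans (+-congˡ (zeroʳ x)) (+-identityʳ a))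
      (≈-trans (evaluate-affineTimes κ ν (p ∘ₚ κ + ν t) x) (*-congˡ (evaluate-∘ₚ p κ ν x))))

open Overℤ using (evaluate; _∙_)
open PolynomialArithmetic ℤ.+-*-commutativeSemiring

-- Integer inequalities and eventual signs of polynomials

0≤+ : ∀ {a b} → 0ℤ ≤ a → 0ℤ ≤ b → 0ℤ ≤ a + b
0≤+ = ℤ.+-mono-≤

0≤* : ∀ {a b} → 0ℤ ≤ a → 0ℤ ≤ b → 0ℤ ≤ a * b
0≤* {+ a} {+ b} _ _ = subst (0ℤ ≤_) (ℤ.pos-* a b) (+≤+ ℕ.z≤n)

0≤n : ∀ {n} → 0ℤ ≤ + n
0≤n = +≤+ ℕ.z≤n

-- Inequalities are proved by writing the difference of the two sides as a
-- nonnegative expression, up to a ring identity.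
by-difference : ∀ {a b c} → b ≡ a + c → 0ℤ ≤ c → a ≤ b
by-difference {a} {c = c} refl 0≤c =
  subst (_≤ a + c) (ℤ.+-identityʳ a) (ℤ.+-monoʳ-≤ a 0≤c)

difference : ∀ {a b} → a ≤ b → 0ℤ ≤ b - a
difference = ℤ.i≤j⇒0≤j-i

<⇒0≤ : ∀ {a b} → a < b → 0ℤ ≤ b - a - 1ℤ
<⇒0≤ {a} {b} a<b = subst (0ℤ ≤_) (lemma a b) (difference (ℤ.i<j⇒suc[i]≤j a<b))
  where
  lemma : ∀ a b → b - (1ℤ + a) ≡ b - a - 1ℤ
  lemma = solve-∀

0≰-1-n : ∀ n → ¬ 0ℤ ≤ -[1+ n ]
0≰-1-n n ()

i≤∣i∣ : ∀ i → i ≤ + ∣ i ∣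
i≤∣i∣ (+ _)    = ℤ.≤-refl
i≤∣i∣ -[1+ _ ] = ℤ.-≤+

-∣i∣≤i : ∀ i → - + ∣ i ∣ ≤ i
-∣i∣≤i i = subst₂ _≤_ (cong (λ n → - + n) (ℤ.∣-i∣≡∣i∣ i)) (ℤ.neg-involutive i)
             (ℤ.neg-mono-≤ (i≤∣i∣ (- i)))

∣i∣≤ : ∀ {i n} → - + n ≤ i → i ≤ + n → ∣ i ∣ ℕ.≤ n
∣i∣≤ {+ i}       _  (+≤+ h) = h
∣i∣≤ { -[1+ i ]} {suc n} (ℤ.-≤- h) _ = ℕ.s≤s h

-n≤i : ∀ i {n} → ∣ i ∣ ℕ.≤ n → - + n ≤ i
-n≤i i h = ℤ.≤-trans (ℤ.neg-mono-≤ (+≤+ h)) (-∣i∣≤i i)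

i≤n : ∀ i {n} → ∣ i ∣ ℕ.≤ n → i ≤ + n
i≤n i h = ℤ.≤-trans (i≤∣i∣ i) (+≤+ h)

-- The two nonzero cases keep distance 1 from zero, so that multiplication by `s` makes the value at
-- least `s` in size and it outgrows any constant term added to it.
Sign : ℤ[t] → Set
Sign p = (Eventually λ s → 1ℤ ≤ evaluate p (+ s))
       ⊎ (Eventually λ s → evaluate p (+ s) ≤ - 1ℤ)
       ⊎ (∀ s → evaluate p (+ s) ≡ 0ℤ)

-- The sign of a + t q(t) is that of q, unless q is eventually zero.
sign : ∀ p → Sign p
sign []      = inj₂ (inj₂ λ _ → refl)
sign (a ∷ p) with sign p
... | inj₁ (N , h) = inj₁ (N ℕ.⊔ suc ∣ a ∣ , λ s N≤s → by-difference
        (identity a (+ s) (evaluate p (+ s)) (+ ∣ a ∣))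
        (0≤+ (0≤+ (0≤* (0≤n {s}) (difference (h s (ℕ.m⊔n≤o⇒m≤o N _ N≤s))))
                  (difference (+≤+ (ℕ.m⊔n≤o⇒n≤o N _ N≤s))))
             (difference (-∣i∣≤i a))))
  where
  identity : ∀ a s v b → a + s * v ≡ 1ℤ + (s * (v - 1ℤ) + (s - (1ℤ + b)) + (a - - b))
  identity = solve-∀
... | inj₂ (inj₁ (N , h)) = inj₂ (inj₁ (N ℕ.⊔ suc ∣ a ∣ , λ s N≤s → by-difference
        (identity a (+ s) (evaluate p (+ s)) (+ ∣ a ∣))
        (0≤+ (0≤+ (0≤* (0≤n {s}) (difference (h s (ℕ.m⊔n≤o⇒m≤o N _ N≤s))))
                  (difference (+≤+ (ℕ.m⊔n≤o⇒n≤o N _ N≤s))))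
             (difference (i≤∣i∣ a)))))
  where
  identity : ∀ a s v b → - 1ℤ ≡ a + s * v + (s * (- 1ℤ - v) + (s - (1ℤ + b)) + (b - a))
  identity = solve-∀
... | inj₂ (inj₂ h) = constant a λ s →
        trans (cong (λ v → a + + s * v) (h s)) (trans (cong (λ v → a + v) (ℤ.*-zeroʳ (+ s))) (ℤ.+-identityʳ a))
  where
  constant : ∀ b → (∀ s → evaluate (a ∷ p) (+ s) ≡ b) → Sign (a ∷ p)
  constant (+ zero)  h = inj₂ (inj₂ h)
  constant (+ suc b) h = inj₁ (0 , λ s _ → subst (1ℤ ≤_) (sym (h s)) (+≤+ (ℕ.s≤s ℕ.z≤n)))
  constant -[1+ b ]  h = inj₂ (inj₁ (0 , λ s _ → subst (_≤ - 1ℤ) (sym (h s)) (ℤ.-≤- ℕ.z≤n)))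

nonNegative? : ∀ p → (Eventually λ s → 0ℤ ≤ evaluate p (+ s))
                   ⊎ (Eventually λ s → ¬ 0ℤ ≤ evaluate p (+ s))
nonNegative? p with sign p
... | inj₁ (N , h)        = inj₁ (N , λ s N≤s → ℤ.≤-trans (+≤+ ℕ.z≤n) (h s N≤s))
... | inj₂ (inj₁ (N , h)) = inj₂ (N , λ s N≤s 0≤p → 0≰-1-n 0 (ℤ.≤-trans 0≤p (h s N≤s)))
... | inj₂ (inj₂ h)       = inj₁ (0 , λ s _ → ℤ.≤-reflexive (sym (h s)))

compare : ∀ p q → (Eventually λ s → evaluate p (+ s) ≤ evaluate q (+ s))
                ⊎ (Eventually λ s → evaluate q (+ s) ≤ evaluate p (+ s))
compare p q = Sum.map
  (λ (N , h) → N , λ s N≤s → ℤ.0≤i-j⇒j≤i (subst (0ℤ ≤_) (q-p s) (h s N≤s)))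
  (λ (N , h) → N , λ s N≤s → ℤ.<⇒≤ (ℤ.≰⇒> λ p≤q → h s N≤s
    (subst (0ℤ ≤_) (sym (q-p s)) (difference p≤q))))
  (nonNegative? (q +ₚ scale (- 1ℤ) p))
  where
  identity : ∀ u v → v + - 1ℤ * u ≡ v - u
  identity = solve-∀
  q-p : ∀ s → evaluate (q +ₚ scale (- 1ℤ) p) (+ s) ≡ evaluate q (+ s) - evaluate p (+ s)
  q-p s = trans (evaluate-+ₚ q (scale (- 1ℤ) p) (+ s))
    (trans (cong (λ v → evaluate q (+ s) + v) (evaluate-scale (- 1ℤ) p (+ s)))
           (identity (evaluate p (+ s)) (evaluate q (+ s))))

eventually-× : ∀ {P Q : ℕ → Set} → Eventually P → Eventually Q → Eventually λ s → P s × Q s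
eventually-× (M , p) (N , q) = M ℕ.⊔ N , λ s h →
  p s (ℕ.m⊔n≤o⇒m≤o M N h) , q s (ℕ.m⊔n≤o⇒n≤o M N h)

eventually-map : ∀ {P Q : ℕ → Set} → (∀ s → P s → Q s) → Eventually P → Eventually Q
eventually-map f (N , p) = N , λ s h → f s (p s h)

-- Properties on arithmetic progressions

-- The new progression arises from `a + b s` by putting `c + e s` for `s`; as `e` is nonzero,
-- "eventually" survives the passage.
Progressive : ∀ {ℓ} → (ℕ → ℕ → Set ℓ) → Set ℓ
Progressive Φ = ∀ a b c e .{{_ : NonZero e}} → Φ a b → Φ (a ℕ.+ b ℕ.* c) (b ℕ.* e)

-- Φ a b stands for a property of the progression a + b s.
Quasi : ∀ {ℓ} → (ℕ → ℕ → Set ℓ) → Set ℓ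
Quasi Φ = Σ[ d ∈ ℕ ] NonZero d × (∀ r → Φ r d)

commonMultiple : ∀ d (g : ∀ r → r ℕ.< d → ℕ) → (∀ r r<d → NonZero (g r r<d)) →
  Σ[ m ∈ ℕ ] NonZero m × (∀ r r<d → Σ[ e ∈ ℕ ] NonZero e × m ≡ g r r<d ℕ.* e)
commonMultiple zero    g g≢0 = 1 , _ , λ _ ()
commonMultiple (suc d) g g≢0 =
  m ℕ.* g d ℕ.≤-refl , ℕ.m*n≢0 m (g d ℕ.≤-refl) {{m≢0}} {{g≢0 d ℕ.≤-refl}} , multiple
  where
  smaller = commonMultiple d (λ r r<d → g r (ℕ.m<n⇒m<1+n r<d)) (λ r r<d → g≢0 r (ℕ.m<n⇒m<1+n r<d))
  m = proj₁ smaller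
  m≢0 = proj₁ (proj₂ smaller)
  multiple : ∀ r (r<1+d : r ℕ.< suc d) →
    Σ[ e ∈ ℕ ] NonZero e × m ℕ.* g d ℕ.≤-refl ≡ g r r<1+d ℕ.* e
  multiple r r<1+d with r ℕ.≟ d
  ... | yes refl = m , m≢0 , trans (ℕ.*-comm m _)
        (cong (λ h → g d h ℕ.* m) (ℕ.≤-irrelevant ℕ.≤-refl r<1+d))
  ... | no r≢d =
    let r<d = ℕ.≤∧≢⇒< (ℕ.s≤s⁻¹ r<1+d) r≢d
        e , e≢0 , m≡ge = proj₂ (proj₂ smaller) r r<d
    in e ℕ.* g d ℕ.≤-refl , ℕ.m*n≢0 e _ {{e≢0}} {{g≢0 d ℕ.≤-refl}} ,
       trans (cong (ℕ._* g d ℕ.≤-refl) m≡ge) (trans (ℕ.*-assoc (g r _) e _)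
         (cong (λ h → g r h ℕ.* (e ℕ.* g d ℕ.≤-refl)) (ℕ.≤-irrelevant (ℕ.m<n⇒m<1+n r<d) r<1+d)))

-- The classes modulo `d` may have different periods, and all are refined to a common multiple `m`
-- of these. A start `r` beyond `d` belongs to the class `r % d`, at position `r / d` in it.
Quasi-merge : ∀ {ℓ} {Φ : ℕ → ℕ → Set ℓ} → Progressive Φ → ∀ d .{{_ : NonZero d}} →
  (∀ r → r ℕ.< d → Quasi λ a b → Φ (r ℕ.+ d ℕ.* a) (d ℕ.* b)) → Quasi Φ
Quasi-merge {Φ = Φ} progressive d h =
  let m , m≢0 , multiple = commonMultiple d (λ r r<d → proj₁ (h r r<d)) (λ r r<d → proj₁ (proj₂ (h r r<d)))
  in d ℕ.* m , ℕ.m*n≢0 d m {{it}} {{m≢0}} , λ r →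
    let r<d = ℕ.m%n<n r d
        e , e≢0 , m≡De = multiple (r ℕ.% d) r<d
        D , _ , φ = h (r ℕ.% d) r<d
    in subst₂ Φ
         (trans (cong (r ℕ.% d ℕ.+ d ℕ.* (r ℕ./ d) ℕ.+_) (ℕ.*-zeroʳ (d ℕ.* D)))
           (trans (ℕ.+-identityʳ _)
             (trans (cong (r ℕ.% d ℕ.+_) (ℕ.*-comm d _)) (sym (ℕ.m≡m%n+[m/n]*n r d)))))
         (trans (ℕ.*-assoc d D e) (cong (d ℕ.*_) (sym m≡De)))
         (progressive _ _ 0 e {{e≢0}} (φ (r ℕ./ d)))
  where
  it : NonZero d
  it = ℕ.≢-nonZero (ℕ.≢-nonZero⁻¹ d)

Quasi-map : ∀ {ℓ ℓ′} {Φ : ℕ → ℕ → Set ℓ} {Ψ : ℕ → ℕ → Set ℓ′} →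
  (∀ a b .{{_ : NonZero b}} → Φ a b → Ψ a b) → Quasi Φ → Quasi Ψ
Quasi-map f (d , d≢0 , φ) = d , d≢0 , λ r → f r d {{d≢0}} (φ r)

Quasi-zip : ∀ {Φ Ψ : ℕ → ℕ → Set} → Progressive Φ → Progressive Ψ →
  Quasi Φ → Quasi Ψ → Quasi λ a b → Φ a b × Ψ a b
Quasi-zip {Φ} {Ψ} Φ-prog Ψ-prog (d , d≢0 , φ) (e , e≢0 , ψ) =
  d ℕ.* e , ℕ.m*n≢0 d e {{d≢0}} {{e≢0}} , λ r →
    subst (λ a → Φ a (d ℕ.* e)) (start r d) (Φ-prog r d 0 e {{e≢0}} (φ r)) ,
    subst₂ Ψ (start r e) (ℕ.*-comm e d) (Ψ-prog r e 0 d {{d≢0}} (ψ r))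
  where
  start : ∀ r b → r ℕ.+ b ℕ.* 0 ≡ r
  start r b = trans (cong (r ℕ.+_) (ℕ.*-zeroʳ b)) (ℕ.+-identityʳ r)

cong-progression : ∀ {ℓ} {A : Set ℓ} (P : ℕ → A) a b c e s →
  P ((a ℕ.+ b ℕ.* c) ℕ.+ (b ℕ.* e) ℕ.* s) ≡ P (a ℕ.+ b ℕ.* (c ℕ.+ e ℕ.* s))
cong-progression P a b c e s = cong P (trans (ℕ.+-assoc a (b ℕ.* c) _)
  (cong (a ℕ.+_) (trans (cong (b ℕ.* c ℕ.+_) (ℕ.*-assoc b e s)) (sym (ℕ.*-distribˡ-+ b c (e ℕ.* s))))))

s≤a+b*s : ∀ a b .{{_ : NonZero b}} s → s ℕ.≤ a ℕ.+ b ℕ.* s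
s≤a+b*s a b s = ℕ.≤-trans (ℕ.m≤n*m s b) (ℕ.m≤n+m (b ℕ.* s) a)

+-progression : ∀ a b s → + (a ℕ.+ b ℕ.* s) ≡ + a + + b * + s
+-progression a b s = trans (ℤ.pos-+ a (b ℕ.* s)) (cong (λ v → + a + v) (ℤ.pos-* b s))

evaluate-progression : ∀ p a b s →
  evaluate (p ∘ₚ + a + + b t) (+ s) ≡ evaluate p (+ (a ℕ.+ b ℕ.* s))
evaluate-progression p a b s =
  trans (evaluate-∘ₚ p (+ a) (+ b) (+ s)) (cong (evaluate p) (sym (+-progression a b s)))

_∘ᵥ_+_t : ∀ {n} → Vec ℤ[t] n → ℤ → ℤ → Vec ℤ[t] n
v ∘ᵥ κ + ν t = Vec.map (_∘ₚ κ + ν t) v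

⟨⟩-progression : ∀ {n} (v : Vec ℤ[t] n) a b s →
  (v ∘ᵥ + a + + b t) ⟨ + s ⟩ ≡ v ⟨ + (a ℕ.+ b ℕ.* s) ⟩
⟨⟩-progression []      a b s = refl
⟨⟩-progression (p ∷ v) a b s = cong₂ _∷_ (evaluate-progression p a b s) (⟨⟩-progression v a b s)

-- Vectors are compared by their first entry.

Maximal : ∀ {k} → (Vec ℤ (suc k) → Set) → Vec ℤ (suc k) → Set
Maximal V w = V w × (∀ w′ → V w′ → Vec.head w′ ≤ Vec.head w)

-- In the application the first entry is the objective and the others are the coordinates of the
-- point, so `W` describes an optimal point together with its value.
PolynomialMaximum : ∀ {k} → (ℕ → Vec ℤ (suc k) → Set) → Set
PolynomialMaximum {k} V = (Eventually λ s → ∀ w → ¬ V s w)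
  ⊎ (Σ[ W ∈ Vec ℤ[t] (suc k) ] Eventually λ s → Maximal (V s) (W ⟨ + s ⟩))

module _ {k : ℕ} where

  private
    Family = ℕ → Vec ℤ (suc k) → Set

  MaximumOn : Family → ℕ → ℕ → Set
  MaximumOn V a b = PolynomialMaximum λ s → V (a ℕ.+ b ℕ.* s)

  record QuasiMaximum (V : Family) : Set where
    constructor quasiMaximum
    field
      onProgressions : Quasi (MaximumOn V)
  open QuasiMaximum public

  MaximumOn-progressive : ∀ V → Progressive (MaximumOn V)
  MaximumOn-progressive V a b c e (inj₁ (N , h)) = inj₁ (N , λ s N≤s w v →
    h (c ℕ.+ e ℕ.* s) (ℕ.≤-trans N≤s (s≤a+b*s c e s)) w
      (subst id (cong-progression (λ t → V t w) a b c e s) v))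
  MaximumOn-progressive V a b c e (inj₂ (W , N , h)) = inj₂ (W ∘ᵥ + c + + e t , N , λ s N≤s →
    subst (Maximal _) (sym (⟨⟩-progression W c e s))
      (subst id (sym (cong-progression (λ t → Maximal (V t) (W ⟨ + (c ℕ.+ e ℕ.* s) ⟩)) a b c e s))
        (h (c ℕ.+ e ℕ.* s) (ℕ.≤-trans N≤s (s≤a+b*s c e s)))))

  polynomial⇒quasi : ∀ {V} → PolynomialMaximum V → QuasiMaximum V
  polynomial⇒quasi {V} h = quasiMaximum (1 , _ , λ r → subst (λ a → MaximumOn V a 1) (ℕ.*-identityˡ r)
    (MaximumOn-progressive V 0 1 r 1 (subst₁ h)))
    where
    subst₁ : PolynomialMaximum V → MaximumOn V 0 1
    subst₁ (inj₁ (N , h))     = inj₁ (N , λ s N≤s → subst (λ t → ∀ w → ¬ V t w) (sym (ℕ.*-identityˡ s)) (h s N≤s))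
    subst₁ (inj₂ (W , N , h)) = inj₂ (W , N , λ s N≤s →
      subst (λ t → Maximal (V t) (W ⟨ + s ⟩)) (sym (ℕ.*-identityˡ s)) (h s N≤s))

  -- This is enough to carry a maximum of `V′` over to `V`; `complete` also carries over emptiness.
  record Dominates (V′ V : Family) (t : ℕ) : Set where
    constructor dominates
    field
      sound    : ∀ w → V′ t w → V t w
      complete : ∀ w → V t w → ∃[ w′ ] V′ t w′ × Vec.head w ≤ Vec.head w′
  open Dominates

  QuasiMaximum-dominated : ∀ {V′ V} → Eventually (Dominates V′ V) → QuasiMaximum V′ → QuasiMaximum V
  QuasiMaximum-dominated {V′} {V} (T , dom) (quasiMaximum q) = quasiMaximum (Quasi-map transfer q)
    where
    transfer : ∀ a b .{{_ : NonZero b}} → MaximumOn V′ a b → MaximumOn V a b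
    transfer a b (inj₁ (N , h)) = inj₁ (N ℕ.⊔ T , λ s h′ w v →
      let w′ , v′ , _ = complete (dom _ (ℕ.≤-trans (ℕ.m⊔n≤o⇒n≤o N T h′) (s≤a+b*s a b s))) w v
      in h s (ℕ.m⊔n≤o⇒m≤o N T h′) w′ v′)
    transfer a b (inj₂ (W , N , h)) = inj₂ (W , N ℕ.⊔ T , λ s h′ →
      let d = dom _ (ℕ.≤-trans (ℕ.m⊔n≤o⇒n≤o N T h′) (s≤a+b*s a b s))
          v , max = h s (ℕ.m⊔n≤o⇒m≤o N T h′)
      in sound d _ v , λ w v →
           let w′ , v′ , w≤w′ = complete d w v in ℤ.≤-trans w≤w′ (max w′ v′))

  QuasiMaximum-∅ : ∀ {V} → (∀ t w → ¬ V t w) → QuasiMaximum V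
  QuasiMaximum-∅ h = polynomial⇒quasi (inj₁ (0 , λ s _ → h s))

  -- On a common refinement both maxima are polynomial. By `compare` one of the two leading entries
  -- is eventually at least the other, so the same maximum wins for all large `s`.
  QuasiMaximum-∪ : ∀ {V V′} → QuasiMaximum V → QuasiMaximum V′ → QuasiMaximum λ t w → V t w ⊎ V′ t w
  QuasiMaximum-∪ {V} {V′} (quasiMaximum q) (quasiMaximum q′) =
    quasiMaximum (Quasi-map (λ a b (l , l′) → union a b l l′)
      (Quasi-zip {MaximumOn V} {MaximumOn V′} (MaximumOn-progressive V) (MaximumOn-progressive V′) q q′))
    where
    union : ∀ a b → MaximumOn V a b → MaximumOn V′ a b → MaximumOn (λ t w → V t w ⊎ V′ t w) a b
    union a b (inj₁ h) (inj₁ h′) = inj₁ (eventually-map (λ s (e , e′) w → Sum.[ e w , e′ w ])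
      (eventually-× h h′))
    union a b (inj₁ h) (inj₂ (W , h′)) = inj₂ (W , eventually-map
      (λ s (e , (v , m)) → inj₂ v , λ w → Sum.[ (λ v → ⊥-elim (e w v)) , m w ]) (eventually-× h h′))
    union a b (inj₂ (W , h)) (inj₁ h′) = inj₂ (W , eventually-map
      (λ s (e , (v , m)) → inj₁ v , λ w → Sum.[ m w , (λ v → ⊥-elim (e w v)) ]) (eventually-× h′ h))
    union a b (inj₂ (W@(p ∷ _) , h)) (inj₂ (W′@(p′ ∷ _) , h′)) with compare p p′
    ... | inj₁ p≤p′ = inj₂ (W′ , eventually-map
      (λ s (le , ((v , m) , (v′ , m′))) → inj₂ v′ , λ w → Sum.[ (λ v → ℤ.≤-trans (m w v) le) , m′ w ])
      (eventually-× p≤p′ (eventually-× h h′)))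
    ... | inj₂ p′≤p = inj₂ (W , eventually-map
      (λ s (le , ((v , m) , (v′ , m′))) → inj₁ v , λ w → Sum.[ m w , (λ v → ℤ.≤-trans (m′ w v) le) ])
      (eventually-× p′≤p (eventually-× h h′)))

  QuasiMaximum-⋃ : ∀ {X : Set} {V : X → Family} {xs} → All (λ x → QuasiMaximum (V x)) xs →
    QuasiMaximum λ t w → Any (λ x → V x t w) xs
  QuasiMaximum-⋃ []       = QuasiMaximum-∅ λ _ _ ()
  QuasiMaximum-⋃ (q ∷ qs) = QuasiMaximum-dominated
    (0 , λ t _ → dominates (λ w → Any.fromSum) (λ w v → w , Any.toSum v , ℤ.≤-refl))
    (QuasiMaximum-∪ q (QuasiMaximum-⋃ qs))

  -- Allows a different family on each class `t = r + d s`, described in terms of `s`: the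
  -- substitutions below depend on the residue of `t`.
  QuasiMaximum-residues : ∀ d .{{_ : NonZero d}} {C : ℕ → Family} → (∀ r → QuasiMaximum (C r)) →
    QuasiMaximum λ t → C (t ℕ.% d) (t ℕ./ d)
  QuasiMaximum-residues d {C} q = quasiMaximum
    (Quasi-merge {Φ = MaximumOn V} (MaximumOn-progressive V) d λ r r<d →
      Quasi-map (λ a b → transfer r r<d a b) (onProgressions (q r)))
    where
    V : Family
    V t = C (t ℕ.% d) (t ℕ./ d)
    at : ∀ r → r ℕ.< d → ∀ a b s → C r (a ℕ.+ b ℕ.* s) ≡ V ((r ℕ.+ d ℕ.* a) ℕ.+ (d ℕ.* b) ℕ.* s)
    at r r<d a b s = sym (trans (cong-progression V r d a b s) (cong₂ C
      (trans (cong (λ v → (r ℕ.+ v) ℕ.% d) (ℕ.*-comm d q′)) (trans (ℕ.[m+kn]%n≡m%n r q′ d) (ℕ.m<n⇒m%n≡m r<d)))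
      (trans (cong (ℕ._/ d) (ℕ.+-comm r (d ℕ.* q′)))
        (trans (ℕ.+-distrib-/ (d ℕ.* q′) r small)
          (trans (cong₂ ℕ._+_ (trans (cong (ℕ._/ d) (ℕ.*-comm d q′)) (ℕ.m*n/n≡m q′ d)) (ℕ.m<n⇒m/n≡0 r<d)) (ℕ.+-identityʳ q′))))))
      where
      q′ = a ℕ.+ b ℕ.* s
      small : (d ℕ.* q′) ℕ.% d ℕ.+ r ℕ.% d ℕ.< d
      small = subst (ℕ._< d) (sym (cong₂ ℕ._+_ (trans (cong (ℕ._% d) (ℕ.*-comm d q′)) (ℕ.m*n%n≡0 q′ d)) (ℕ.m<n⇒m%n≡m r<d))) r<d
    transfer : ∀ r → r ℕ.< d → ∀ a b → MaximumOn (C r) a b → MaximumOn V (r ℕ.+ d ℕ.* a) (d ℕ.* b)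
    transfer r r<d a b (inj₁ (N , h)) = inj₁ (N , λ s N≤s w v → h s N≤s w
      (subst (λ X → X w) (sym (at r r<d a b s)) v))
    transfer r r<d a b (inj₂ (W , N , h)) = inj₂ (W , N , λ s N≤s →
      subst (λ X → Maximal X (W ⟨ + s ⟩)) (at r r<d a b s) (h s N≤s))

-- Integer vectors

infixl 6 _⊕_
_⊕_ : ∀ {n} → Vec ℤ n → Vec ℤ n → Vec ℤ n
_⊕_ = Vec.zipWith _+_

infixr 7 _·_
_·_ : ∀ {n} → ℤ → Vec ℤ n → Vec ℤ n
k · x = Vec.map (k *_) x

𝟎 : ∀ {n} → Vec ℤ n
𝟎 = Vec.replicate _ 0ℤ

∙-⊕ˡ : ∀ {n} (u v x : Vec ℤ n) → (u ⊕ v) ∙ x ≡ u ∙ x + v ∙ x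
∙-⊕ˡ []      []      []      = refl
∙-⊕ˡ (a ∷ u) (b ∷ v) (z ∷ x) =
  trans (cong (λ w → (a + b) * z + w) (∙-⊕ˡ u v x)) (identity a b z (u ∙ x) (v ∙ x))
  where
  identity : ∀ a b z p q → (a + b) * z + (p + q) ≡ (a * z + p) + (b * z + q)
  identity = solve-∀

∙-·ˡ : ∀ {n} k (u x : Vec ℤ n) → (k · u) ∙ x ≡ k * u ∙ x
∙-·ˡ k []      []      = sym (ℤ.*-zeroʳ k)
∙-·ˡ k (a ∷ u) (z ∷ x) = trans (cong (λ w → k * a * z + w) (∙-·ˡ k u x)) (identity k a z (u ∙ x))
  where
  identity : ∀ k a z p → k * a * z + k * p ≡ k * (a * z + p)
  identity = solve-∀

∙-comm : ∀ {n} (u x : Vec ℤ n) → u ∙ x ≡ x ∙ u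
∙-comm []      []      = refl
∙-comm (a ∷ u) (z ∷ x) = cong₂ _+_ (ℤ.*-comm a z) (∙-comm u x)

∙-⊕ʳ : ∀ {n} (u x y : Vec ℤ n) → u ∙ (x ⊕ y) ≡ u ∙ x + u ∙ y
∙-⊕ʳ u x y = trans (∙-comm u (x ⊕ y))
  (trans (∙-⊕ˡ x y u) (cong₂ _+_ (∙-comm x u) (∙-comm y u)))

∙-·ʳ : ∀ {n} k (u x : Vec ℤ n) → u ∙ (k · x) ≡ k * u ∙ x
∙-·ʳ k u x = trans (∙-comm u (k · x)) (trans (∙-·ˡ k x u) (cong (k *_) (∙-comm x u)))

∙-affine : ∀ {n} p (u x ρ : Vec ℤ n) → u ∙ (p · x ⊕ ρ) ≡ p * u ∙ x + u ∙ ρ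
∙-affine p u x ρ = trans (∙-⊕ʳ u (p · x) ρ) (cong (_+ u ∙ ρ) (∙-·ʳ p u x))

∙-++ : ∀ {m n} (u : Vec ℤ m) {v : Vec ℤ n} x {y} → (u Vec.++ v) ∙ (x Vec.++ y) ≡ u ∙ x + v ∙ y
∙-++ []      {v} []      {y} = sym (ℤ.+-identityˡ (v ∙ y))
∙-++ (a ∷ u) {v} (z ∷ x) {y} = trans (cong (λ w → a * z + w) (∙-++ u x))
  (sym (ℤ.+-assoc (a * z) (u ∙ x) (v ∙ y)))

𝟎∙ : ∀ {n} (x : Vec ℤ n) → 𝟎 ∙ x ≡ 0ℤ
𝟎∙ []      = refl
𝟎∙ (z ∷ x) = trans (ℤ.+-identityˡ (𝟎 ∙ x)) (𝟎∙ x)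

‖_‖ : ∀ {n} → Vec ℤ n → ℕ
‖ []    ‖ = 0
‖ z ∷ x ‖ = ∣ z ∣ ℕ.+ ‖ x ‖

‖⊕‖ : ∀ {n} (x y : Vec ℤ n) → ‖ x ⊕ y ‖ ℕ.≤ ‖ x ‖ ℕ.+ ‖ y ‖
‖⊕‖ []      []      = ℕ.z≤n
‖⊕‖ (a ∷ x) (b ∷ y) = ℕ.≤-trans (ℕ.+-mono-≤ (ℤ.∣i+j∣≤∣i∣+∣j∣ a b) (‖⊕‖ x y))
  (ℕ.≤-reflexive (interchange ∣ a ∣ ∣ b ∣ ‖ x ‖ ‖ y ‖))
  where
  open import Algebra.Properties.CommutativeSemigroup ℕ.+-commutativeSemigroup using (interchange)

‖·‖ : ∀ {n} k (x : Vec ℤ n) → ‖ k · x ‖ ≡ ∣ k ∣ ℕ.* ‖ x ‖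
‖·‖ k []      = sym (ℕ.*-zeroʳ ∣ k ∣)
‖·‖ k (z ∷ x) = trans (cong₂ ℕ._+_ (ℤ.abs-* k z) (‖·‖ k x)) (sym (ℕ.*-distribˡ-+ ∣ k ∣ ∣ z ∣ ‖ x ‖))

‖++‖ : ∀ {m n} (x : Vec ℤ m) (y : Vec ℤ n) → ‖ x Vec.++ y ‖ ≡ ‖ x ‖ ℕ.+ ‖ y ‖
‖++‖ []      y = refl
‖++‖ (z ∷ x) y = trans (cong (∣ z ∣ ℕ.+_) (‖++‖ x y)) (sym (ℕ.+-assoc ∣ z ∣ ‖ x ‖ ‖ y ‖))

∣∙∣ : ∀ {n} (u x : Vec ℤ n) → ∣ u ∙ x ∣ ℕ.≤ ‖ u ‖ ℕ.* ‖ x ‖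
∣∙∣ []      []      = ℕ.z≤n
∣∙∣ (a ∷ u) (z ∷ x) = begin
  ∣ a * z + u ∙ x ∣                        ≤⟨ ℤ.∣i+j∣≤∣i∣+∣j∣ (a * z) (u ∙ x) ⟩
  ∣ a * z ∣ ℕ.+ ∣ u ∙ x ∣                  ≡⟨ cong (ℕ._+ ∣ u ∙ x ∣) (ℤ.abs-* a z) ⟩
  ∣ a ∣ ℕ.* ∣ z ∣ ℕ.+ ∣ u ∙ x ∣            ≤⟨ ℕ.+-mono-≤ (ℕ.*-monoʳ-≤ ∣ a ∣ (ℕ.m≤m+n ∣ z ∣ ‖ x ‖)) (∣∙∣ u x) ⟩
  ∣ a ∣ ℕ.* (∣ z ∣ ℕ.+ ‖ x ‖) ℕ.+ ‖ u ‖ ℕ.* ‖ x ‖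
    ≤⟨ ℕ.+-monoʳ-≤ _ (ℕ.*-monoʳ-≤ ‖ u ‖ (ℕ.m≤n+m ‖ x ‖ ∣ z ∣)) ⟩
  ∣ a ∣ ℕ.* (∣ z ∣ ℕ.+ ‖ x ‖) ℕ.+ ‖ u ‖ ℕ.* (∣ z ∣ ℕ.+ ‖ x ‖)
    ≡⟨ sym (ℕ.*-distribʳ-+ (∣ z ∣ ℕ.+ ‖ x ‖) ∣ a ∣ ‖ u ‖) ⟩
  (∣ a ∣ ℕ.+ ‖ u ‖) ℕ.* (∣ z ∣ ℕ.+ ‖ x ‖)  ∎
  where open ℕ.≤-Reasoning

‖affine‖ : ∀ {n} p (x ρ : Vec ℤ n) → p ℕ.* ‖ x ‖ ℕ.≤ ‖ + p · x ⊕ ρ ‖ ℕ.+ ‖ ρ ‖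
‖affine‖ p x ρ = begin
  p ℕ.* ‖ x ‖                              ≡⟨ sym (‖·‖ (+ p) x) ⟩
  ‖ + p · x ‖                              ≡⟨ cong ‖_‖ (undo x ρ) ⟩
  ‖ (+ p · x ⊕ ρ) ⊕ - 1ℤ · ρ ‖             ≤⟨ ‖⊕‖ (+ p · x ⊕ ρ) (- 1ℤ · ρ) ⟩
  ‖ + p · x ⊕ ρ ‖ ℕ.+ ‖ - 1ℤ · ρ ‖         ≡⟨ cong (‖ + p · x ⊕ ρ ‖ ℕ.+_) (trans (‖·‖ (- 1ℤ) ρ) (ℕ.*-identityˡ ‖ ρ ‖)) ⟩
  ‖ + p · x ⊕ ρ ‖ ℕ.+ ‖ ρ ‖                ∎
  where
  open ℕ.≤-Reasoning
  identity : ∀ a b → a ≡ a + b + - 1ℤ * b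
  identity = solve-∀
  undo : ∀ {n} (x ρ : Vec ℤ n) → + p · x ≡ (+ p · x ⊕ ρ) ⊕ - 1ℤ · ρ
  undo []      []      = refl
  undo (z ∷ x) (r ∷ ρ) = cong₂ _∷_ (identity (+ p * z) r) (undo x ρ)

-- The entries of `ρ` lie in `[0, p)`. They are recorded in the two weaker forms in which they are
-- used: membership in the symmetric `box p n`, and a bound of the norm.
divideᵥ : ∀ {n} p .{{_ : NonZero p}} (x : Vec ℤ n) →
  Σ[ q ∈ Vec ℤ n ] Σ[ ρ ∈ Vec ℤ n ] x ≡ + p · q ⊕ ρ ×
    Allᵥ.All (λ z → - + p ≤ z × z ≤ + p) ρ × ‖ ρ ‖ ℕ.≤ n ℕ.* p
divideᵥ p []      = [] , [] , refl , [] , ℕ.z≤n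
divideᵥ p (z ∷ x) =
  let q , ρ , x≡ , small , ‖ρ‖≤ = divideᵥ p x
      r<p = ℤ.n%ℕd<d z p
  in z ℤ./ℕ p ∷ q , + (z ℤ.%ℕ p) ∷ ρ ,
     cong₂ _∷_ (trans (ℤ.a≡a%ℕn+[a/ℕn]*n z p) (trans (ℤ.+-comm (+ (z ℤ.%ℕ p)) (z ℤ./ℕ p * + p))
       (cong (_+ + (z ℤ.%ℕ p)) (ℤ.*-comm (z ℤ./ℕ p) (+ p))))) x≡ ,
     (ℤ.≤-trans (ℤ.neg-mono-≤ (0≤n {p})) 0≤n , +≤+ (ℕ.<⇒≤ r<p)) ∷ small ,
     ℕ.+-mono-≤ (ℕ.<⇒≤ r<p) ‖ρ‖≤

-- The vectors ± eᵢ. They serve twice: `u ∙ x + B ≥ 0` for all of them describes a cube, and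
-- `u ∙ x - u ∙ y ≥ 1` for one of them separates `x` from `y`.
units : ∀ n → List (Vec ℤ n)
units zero    = []
units (suc n) = (1ℤ ∷ 𝟎) ∷ (- 1ℤ ∷ 𝟎) ∷ List.map (0ℤ ∷_) (units n)

head-unit : ∀ {n} k z (x : Vec ℤ n) → (k ∷ 𝟎) ∙ (z ∷ x) ≡ k * z
head-unit k z x = trans (cong (λ w → k * z + w) (𝟎∙ x)) (ℤ.+-identityʳ (k * z))

‖units‖ : ∀ n → All (λ u → ‖ u ‖ ℕ.≤ 1) (units n)
‖units‖ zero    = []
‖units‖ (suc n) = s≤1 n ∷ s≤1 n ∷ All.map⁺ (‖units‖ n)
  where
  s≤1 : ∀ n → suc ‖ 𝟎 {n} ‖ ℕ.≤ 1
  s≤1 zero    = ℕ.≤-refl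
  s≤1 (suc n) = s≤1 n

within-box : ∀ {n} B (x : Vec ℤ n) → ‖ x ‖ ℕ.≤ B → All (λ u → 0ℤ ≤ u ∙ x + + B) (units n)
within-box {n} B x ‖x‖≤B = All.map (λ {u} → bound u) (‖units‖ n)
  where
  bound : ∀ u → ‖ u ‖ ℕ.≤ 1 → 0ℤ ≤ u ∙ x + + B
  bound u ‖u‖≤1 = subst (_≤ u ∙ x + + B) (ℤ.+-inverseˡ (+ B)) (ℤ.+-monoˡ-≤ (+ B)
    (-n≤i (u ∙ x) (ℕ.≤-trans (∣∙∣ u x) (ℕ.≤-trans (ℕ.*-mono-≤ ‖u‖≤1 ‖x‖≤B) (ℕ.≤-reflexive (ℕ.*-identityˡ B))))))

norm-within-box : ∀ {n} B (x : Vec ℤ n) → All (λ u → 0ℤ ≤ u ∙ x + + B) (units n) → ‖ x ‖ ℕ.≤ n ℕ.* B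
norm-within-box B []      []          = ℕ.z≤n
norm-within-box B (z ∷ x) (h ∷ k ∷ hs) = ℕ.+-mono-≤
  (∣i∣≤ (by-difference (below z (+ B)) (subst (λ w → 0ℤ ≤ w + + B) (head-unit 1ℤ z x) h))
        (by-difference (above z (+ B)) (subst (λ w → 0ℤ ≤ w + + B) (head-unit (- 1ℤ) z x) k)))
  (norm-within-box B x (All.map (λ {u} → subst (λ w → 0ℤ ≤ w + + B) (ℤ.+-identityˡ (u ∙ x))) (All.map⁻ hs)))
  where
  below : ∀ z b → z ≡ - b + (1ℤ * z + b)
  below = solve-∀
  above : ∀ z b → b ≡ z + (- 1ℤ * z + b)
  above = solve-∀

-- Distinct integers differ by at least 1, so inequality of points becomes a finite disjunction of
-- linear constraints.
separated : ∀ {n} (x y : Vec ℤ n) → x ≢ y → Any (λ u → 0ℤ ≤ u ∙ x - u ∙ y - 1ℤ) (units n)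
separated []      []      x≢y = ⊥-elim (x≢y refl)
separated (z ∷ x) (w ∷ y) x≢y with z ℤ.≟ w
... | yes refl = there (there (Any.map⁺ (Any.map
        (λ {u} → subst (0ℤ ≤_) (sym (cong₂ (λ p q → p - q - 1ℤ) (ℤ.+-identityˡ (u ∙ x)) (ℤ.+-identityˡ (u ∙ y)))))
        (separated x y λ x≡y → x≢y (cong (z ∷_) x≡y)))))
... | no z≢w with ℤ.≤-total z w
...   | inj₁ z≤w = there (here (subst (0ℤ ≤_)
          (sym (trans (cong₂ (λ p q → p - q - 1ℤ) (head-unit (- 1ℤ) z x) (head-unit (- 1ℤ) w y)) (identity z w)))
          (<⇒0≤ (ℤ.≤∧≢⇒< z≤w z≢w))))
  where
  identity : ∀ z w → - 1ℤ * z - - 1ℤ * w - 1ℤ ≡ w - z - 1ℤ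
  identity = solve-∀
...   | inj₂ w≤z = here (subst (0ℤ ≤_)
          (sym (trans (cong₂ (λ p q → p - q - 1ℤ) (head-unit 1ℤ z x) (head-unit 1ℤ w y)) (identity z w)))
          (<⇒0≤ (ℤ.≤∧≢⇒< w≤z (z≢w ∘ sym))))
  where
  identity : ∀ z w → 1ℤ * z - 1ℤ * w - 1ℤ ≡ z - w - 1ℤ
  identity = solve-∀

-- As an equation, this lets both directions share one argument: in ring identities 1 is replaced by
-- `σ * σ`.
IsSign : ℤ → Set
IsSign σ = σ * σ ≡ 1ℤ

signOf : ∀ i → Σ[ σ ∈ ℤ ] IsSign σ × σ * i ≡ + ∣ i ∣
signOf (+ n)    = 1ℤ , refl , ℤ.*-identityˡ (+ n)
signOf -[1+ n ] = - 1ℤ , refl , ℤ.-1*i≡-i -[1+ n ]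

∣sign*∣ : ∀ σ i → IsSign σ → ∣ σ * i ∣ ≡ ∣ i ∣
∣sign*∣ σ i σ²≡1 = trans (ℤ.abs-* σ i) (trans (cong (ℕ._* ∣ i ∣) ∣σ∣≡1) (ℕ.*-identityˡ ∣ i ∣))
  where
  ∣σ∣≡1 : ∣ σ ∣ ≡ 1
  ∣σ∣≡1 = ℕ.m*n≡1⇒m≡1 ∣ σ ∣ ∣ σ ∣ (trans (sym (ℤ.abs-* σ σ)) (cong ∣_∣ σ²≡1))

-- Moving one coordinate in a direction in which the constraints are bounded
-- leads to a point with a constraint that the next step violates.
module _ {X : Set} (slope value : X → ℤ) where

  private
    at : ℤ → X → ℤ
    at z φ = slope φ * z + value φ

  -- One step changes the value of `φ` by `∣ slope φ ∣`, so a constraint violated by the next step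
  -- has a value below that. The strict inequality also forces the slope to be nonzero.
  Tight : ℤ → X → Set
  Tight z φ = 0ℤ ≤ at z φ × at z φ < + ∣ slope φ ∣

  climb : (Φ : List X) (M : ℕ) → (∀ z → All (λ φ → 0ℤ ≤ at z φ) Φ → ∣ z ∣ ℕ.≤ M) →
    ∀ σ → IsSign σ → ∀ z → All (λ φ → 0ℤ ≤ at z φ) Φ →
    ∃[ z′ ] 0ℤ ≤ σ * (z′ - z) × All (λ φ → 0ℤ ≤ at z′ φ) Φ × Any (Tight z′) Φ
  -- Feasible points have `σ z` between `- M` and `M`, and each step raises `σ z` by 1. The
  -- invariant `M + 1 ≤ σ z + fuel` makes running out of fuel absurd.
  climb Φ M bound σ σ²≡1 z feasible = go (suc (M ℕ.+ M)) z feasible enough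
    where
    0≤M-σ : ∀ z → All (λ φ → 0ℤ ≤ at z φ) Φ → 0ℤ ≤ + M - σ * z
    0≤M-σ z h = difference (i≤n (σ * z) (subst (ℕ._≤ M) (sym (∣sign*∣ σ z σ²≡1)) (bound z h)))
    enough : + M ≤ σ * z + + suc (M ℕ.+ M) - 1ℤ
    enough = by-difference
      (trans (cong (λ v → σ * z + (1ℤ + v) - 1ℤ) (ℤ.pos-+ M M)) (identity (σ * z) (+ M)))
      (difference (-n≤i (σ * z) (subst (ℕ._≤ M) (sym (∣sign*∣ σ z σ²≡1)) (bound z feasible))))
      where
      identity : ∀ s m → s + (1ℤ + (m + m)) - 1ℤ ≡ m + (s - - m)
      identity = solve-∀
    tight : ∀ z {Ψ} → All (λ φ → 0ℤ ≤ at z φ) Ψ → Any (λ φ → ¬ 0ℤ ≤ at (z + σ) φ) Ψ → Any (Tight z) Ψ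
    tight z (h ∷ hs) (there a) = there (tight z hs a)
    tight z (_∷_ {φ} h hs) (here  a) = here (h , ℤ.<-≤-trans
      (subst₂ _<_ (ℤ.+-identityˡ (at z φ)) (identity (slope φ) z σ (value φ))
        (ℤ.+-monoˡ-< (at z φ) (ℤ.neg-mono-< (ℤ.≰⇒> a))))
      (subst (- (σ * slope φ) ≤_) (cong +_ (∣sign*∣ σ (slope φ) σ²≡1))
        (subst (λ v → - (σ * slope φ) ≤ + v) (ℤ.∣-i∣≡∣i∣ (σ * slope φ)) (i≤∣i∣ (- (σ * slope φ))))))
      where
      identity : ∀ a z σ v → - (a * (z + σ) + v) + (a * z + v) ≡ - (σ * a)
      identity = solve-∀
    go : ∀ fuel z′ → All (λ φ → 0ℤ ≤ at z′ φ) Φ → + M ≤ σ * z′ + + fuel - 1ℤ →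
      ∃[ z″ ] 0ℤ ≤ σ * (z″ - z′) × All (λ φ → 0ℤ ≤ at z″ φ) Φ × Any (Tight z″) Φ
    go zero z′ h big = ⊥-elim (0≰-1-n 0 (subst (0ℤ ≤_) (identity (+ M) (σ * z′))
      (0≤+ (0≤M-σ z′ h) (difference big))))
      where
      identity : ∀ m s → m - s + (s + 0ℤ - 1ℤ - m) ≡ - 1ℤ
      identity = solve-∀
    go (suc fuel) z′ h big with All.all? (λ φ → 0ℤ ℤ.≤? at (z′ + σ) φ) Φ
    ... | no ¬h = z′ , ℤ.≤-reflexive (identity σ z′) , h , tight z′ h (All.¬All⇒Any¬ (λ φ → 0ℤ ℤ.≤? at (z′ + σ) φ) Φ ¬h)
      where
      identity : ∀ σ z → 0ℤ ≡ σ * (z - z)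
      identity = solve-∀
    ... | yes h′ =
      let z″ , later , rest = go fuel (z′ + σ) h′ (subst (+ M ≤_)
            (trans (cong (λ v → σ * z′ + (v + + fuel) - 1ℤ) (sym σ²≡1)) (move σ z′ (+ fuel))) big)
      in z″ , subst (0ℤ ≤_) (trans (cong (λ v → σ * (z″ - (z′ + σ)) + v) (sym σ²≡1)) (join σ z″ z′))
                (0≤+ later (+≤+ ℕ.z≤n)) , rest
      where
      move : ∀ σ z f → σ * z + (σ * σ + f) - 1ℤ ≡ σ * (z + σ) + f - 1ℤ
      move = solve-∀
      join : ∀ σ w z → σ * (w - (z + σ)) + σ * σ ≡ σ * (w - z)
      join = solve-∀

-- Systems with constant coefficients

record Affine (n : ℕ) : Set where
  constructor affine
  field
    linear : Vec ℤ n
    rate   : ℤ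
    offset : ℤ
open Affine

infix 9 _⟦_,_⟧
_⟦_,_⟧ : ∀ {n} → Affine n → ℤ → Vec ℤ n → ℤ
φ ⟦ t , y ⟧ = linear φ ∙ y + (rate φ * t + offset φ)

Feasible : ∀ {n} → List (Affine n) → ℤ → Vec ℤ n → Set
Feasible Φ t y = All (λ φ → 0ℤ ≤ φ ⟦ t , y ⟧) Φ

ParametricForm : ℕ → Set
ParametricForm n = Vec ℤ[t] n × ℤ[t]

infix 9 _⦅_,_⦆
_⦅_,_⦆ : ∀ {n} → ParametricForm n → ℤ → Vec ℤ n → ℤ
(a , β) ⦅ t , x ⦆ = a ⟨ t ⟩ ∙ x + evaluate β t

outputs : ∀ {n k} → Vec (ParametricForm n) k → ℤ → Vec ℤ n → Vec ℤ k
outputs os t x = Vec.map (λ o → o ⦅ t , x ⦆) os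

-- Substitutions change the variables `x` and the forms `os`, while `w` keeps its meaning.
Image : ∀ {n k} → (ℕ → Vec ℤ n → Set) → Vec (ParametricForm n) k → ℕ → Vec ℤ k → Set
Image P os t w = ∃[ x ] P t x × w ≡ outputs os (+ t) x

feasibleAt : ∀ {n} → List (Affine n) → ℕ → Vec ℤ n → Set
feasibleAt Φ t = Feasible Φ (+ t)

-- `M` may depend on `t` in any way: in `affineSystem-maximum` it only makes `climb` terminate.
BoundedAt : ∀ {n} → (ℕ → Vec ℤ n → Set) → Set
BoundedAt P = ∀ t → ∃[ M ] ∀ x → P t x → ‖ x ‖ ℕ.≤ M

⟨⟩-+ₚ : ∀ {n} (u v : Vec ℤ[t] n) t → Vec.zipWith _+ₚ_ u v ⟨ t ⟩ ≡ u ⟨ t ⟩ ⊕ v ⟨ t ⟩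
⟨⟩-+ₚ []      []      t = refl
⟨⟩-+ₚ (p ∷ u) (q ∷ v) t = cong₂ _∷_ (evaluate-+ₚ p q t) (⟨⟩-+ₚ u v t)

⟨⟩-scale : ∀ {n} k (v : Vec ℤ[t] n) t → Vec.map (scale k) v ⟨ t ⟩ ≡ k · v ⟨ t ⟩
⟨⟩-scale k []      t = refl
⟨⟩-scale k (p ∷ v) t = cong₂ _∷_ (evaluate-scale k p t) (⟨⟩-scale k v t)

⟨⟩-multiples : ∀ {n} p (u : Vec ℤ n) t → Vec.map (λ k → scale k p) u ⟨ t ⟩ ≡ evaluate p t · u
⟨⟩-multiples p []      t = refl
⟨⟩-multiples p (k ∷ u) t = cong₂ _∷_
  (trans (evaluate-scale k p t) (ℤ.*-comm k (evaluate p t))) (⟨⟩-multiples p u t)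

infix 8 _∙ₚ_
_∙ₚ_ : ∀ {n} → Vec ℤ n → Vec ℤ[t] n → ℤ[t]
[]      ∙ₚ []      = []
(k ∷ u) ∙ₚ (p ∷ v) = scale k p +ₚ u ∙ₚ v

evaluate-∙ₚ : ∀ {n} (u : Vec ℤ n) v t → evaluate (u ∙ₚ v) t ≡ u ∙ v ⟨ t ⟩
evaluate-∙ₚ []      []      t = refl
evaluate-∙ₚ (k ∷ u) (p ∷ v) t = trans (evaluate-+ₚ (scale k p) (u ∙ₚ v) t)
  (cong₂ _+_ (evaluate-scale k p t) (evaluate-∙ₚ u v t))

-- The change of variables to `s` and `x` with one coordinate fewer. As `Y` is affine with constant
-- coefficients, constraints remain so; in the outputs, products of `Y` with polynomial coefficients
-- are again polynomial in `s`.
module Substitution {n} (Y : Affine n) (p : ℕ) (ρ : Vec ℤ n) (r : ℕ) where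

  time : ℕ → ℕ
  time s = r ℕ.+ p ℕ.* s

  point : ℤ → Vec ℤ n → Vec ℤ (suc n)
  point s x = Y ⟦ s , x ⟧ ∷ (+ p · x ⊕ ρ)

  substitute : Affine (suc n) → Affine n
  substitute (affine (a ∷ u) h g) = affine
    (a · linear Y ⊕ + p · u) (a * rate Y + + p * h) (a * offset Y + (u ∙ ρ + (h * + r + g)))

  substituteₚ : ParametricForm (suc n) → ParametricForm n
  substituteₚ (o ∷ os , β) =
    let o′  = o ∘ₚ + r + + p t
        os′ = os ∘ᵥ + r + + p t
    in Vec.zipWith _+ₚ_ (Vec.map (λ k → scale k o′) (linear Y)) (Vec.map (scale (+ p)) os′) ,
       affineTimes (offset Y) (rate Y) o′ +ₚ (ρ ∙ₚ os′ +ₚ β ∘ₚ + r + + p t)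

  substitute-correct : ∀ φ s x → substitute φ ⟦ + s , x ⟧ ≡ φ ⟦ + time s , point (+ s) x ⟧
  substitute-correct (affine (a ∷ u) h g) s x = begin
    (a · linear Y ⊕ + p · u) ∙ x + ((a * rate Y + + p * h) * + s + (a * offset Y + (u ∙ ρ + (h * + r + g))))
      ≡⟨ cong (_+ _) (trans (∙-⊕ˡ (a · linear Y) (+ p · u) x) (cong₂ _+_ (∙-·ˡ a (linear Y) x) (∙-·ˡ (+ p) u x))) ⟩
    (a * linear Y ∙ x + + p * u ∙ x) + ((a * rate Y + + p * h) * + s + (a * offset Y + (u ∙ ρ + (h * + r + g))))
      ≡⟨ identity a (linear Y ∙ x) (+ p) (u ∙ x) (rate Y) h (+ s) (offset Y) (u ∙ ρ) (+ r) g ⟩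
    (a * Y ⟦ + s , x ⟧ + (+ p * u ∙ x + u ∙ ρ)) + (h * (+ r + + p * + s) + g)
      ≡⟨ cong₂ (λ v t → (a * Y ⟦ + s , x ⟧ + v) + (h * t + g)) (sym (∙-affine (+ p) u x ρ)) (sym (+-progression r p s)) ⟩
    (a * Y ⟦ + s , x ⟧ + u ∙ (+ p · x ⊕ ρ)) + (h * + time s + g)
      ∎
    where
    open ≡-Reasoning
    identity : ∀ a A p U k h s q R r g →
      (a * A + p * U) + ((a * k + p * h) * s + (a * q + (R + (h * r + g)))) ≡
      (a * (A + (k * s + q)) + (p * U + R)) + (h * (r + p * s) + g)
    identity = solve-∀

  substituteₚ-correct : ∀ o s x → substituteₚ o ⦅ + s , x ⦆ ≡ o ⦅ + time s , point (+ s) x ⦆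
  substituteₚ-correct (o ∷ os , β) s x = begin
    substituteₚ (o ∷ os , β) ⦅ + s , x ⦆
      ≡⟨ cong₂ _+_ linearPart constantPart ⟩
    (v * linear Y ∙ x + + p * vs ∙ x) + ((offset Y + rate Y * + s) * v + (ρ ∙ vs + evaluate β (+ time s)))
      ≡⟨ identity v (linear Y ∙ x) (+ p) (vs ∙ x) (offset Y) (rate Y) (+ s) (ρ ∙ vs) (evaluate β (+ time s)) ⟩
    (v * Y ⟦ + s , x ⟧ + (+ p * vs ∙ x + ρ ∙ vs)) + evaluate β (+ time s)
      ≡⟨ cong (λ z → (v * Y ⟦ + s , x ⟧ + z) + evaluate β (+ time s))
           (sym (trans (∙-affine (+ p) vs x ρ) (cong (λ z → + p * vs ∙ x + z) (∙-comm vs ρ)))) ⟩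
    (v * Y ⟦ + s , x ⟧ + vs ∙ (+ p · x ⊕ ρ)) + evaluate β (+ time s)
      ∎
    where
    open ≡-Reasoning
    o′  = o ∘ₚ + r + + p t
    os′ = os ∘ᵥ + r + + p t
    v   = evaluate o (+ time s)
    vs  = os ⟨ + time s ⟩
    linearPart : Vec.zipWith _+ₚ_ (Vec.map (λ k → scale k o′) (linear Y)) (Vec.map (scale (+ p)) os′) ⟨ + s ⟩ ∙ x
               ≡ v * linear Y ∙ x + + p * vs ∙ x
    linearPart = trans (cong (_∙ x) (trans (⟨⟩-+ₚ (Vec.map (λ k → scale k o′) (linear Y)) (Vec.map (scale (+ p)) os′) (+ s))
        (cong₂ _⊕_ (trans (⟨⟩-multiples o′ (linear Y) (+ s)) (cong (_· linear Y) (evaluate-progression o r p s)))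
                   (trans (⟨⟩-scale (+ p) os′ (+ s)) (cong (+ p ·_) (⟨⟩-progression os r p s))))))
      (trans (∙-⊕ˡ (v · linear Y) (+ p · vs) x) (cong₂ _+_ (∙-·ˡ v (linear Y) x) (∙-·ˡ (+ p) vs x)))
    constantPart : evaluate (affineTimes (offset Y) (rate Y) o′ +ₚ (ρ ∙ₚ os′ +ₚ β ∘ₚ + r + + p t)) (+ s)
                 ≡ (offset Y + rate Y * + s) * v + (ρ ∙ vs + evaluate β (+ time s))
    constantPart = trans (evaluate-+ₚ (affineTimes (offset Y) (rate Y) o′) (ρ ∙ₚ os′ +ₚ β ∘ₚ + r + + p t) (+ s))
      (cong₂ _+_ (trans (evaluate-affineTimes (offset Y) (rate Y) o′ (+ s))
                        (cong ((offset Y + rate Y * + s) *_) (evaluate-progression o r p s)))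
        (trans (evaluate-+ₚ (ρ ∙ₚ os′) (β ∘ₚ + r + + p t) (+ s))
          (cong₂ _+_ (trans (evaluate-∙ₚ ρ os′ (+ s)) (cong (ρ ∙_) (⟨⟩-progression os r p s)))
                     (evaluate-progression β r p s))))
    identity : ∀ v A p V q k s R B →
      (v * A + p * V) + ((q + k * s) * v + (R + B)) ≡ (v * (A + (k * s + q)) + (p * V + R)) + B
    identity = solve-∀

  outputs-correct : ∀ {k} (os : Vec (ParametricForm (suc n)) k) s x →
    outputs (Vec.map substituteₚ os) (+ s) x ≡ outputs os (+ time s) (point (+ s) x)
  outputs-correct []       s x = refl
  outputs-correct (o ∷ os) s x = cong₂ _∷_ (substituteₚ-correct o s x) (outputs-correct os s x)

  feasible-to : ∀ Φ s x → feasibleAt (List.map substitute Φ) s x → feasibleAt Φ (time s) (point (+ s) x)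
  feasible-to Φ s x h = All.map (λ {φ} → subst (0ℤ ≤_) (substitute-correct φ s x)) (All.map⁻ h)

  feasible-from : ∀ Φ s x → feasibleAt Φ (time s) (point (+ s) x) → feasibleAt (List.map substitute Φ) s x
  feasible-from Φ s x h = All.map⁺ (All.map (λ {φ} → subst (0ℤ ≤_) (sym (substitute-correct φ s x))) h)

  substitute-bounded : .{{_ : NonZero p}} → ∀ Φ → BoundedAt (feasibleAt Φ) → BoundedAt (feasibleAt (List.map substitute Φ))
  substitute-bounded Φ bounded s =
    let M , bound = bounded (time s)
    in M ℕ.+ ‖ ρ ‖ , λ x h → ℕ.≤-trans (ℕ.m≤n*m ‖ x ‖ p) (ℕ.≤-trans (‖affine‖ p x ρ)
         (ℕ.+-monoˡ-≤ ‖ ρ ‖ (ℕ.≤-trans (ℕ.m≤n+m _ _) (bound _ (feasible-to Φ s x h)))))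

-- Without variables every constraint is an affine function of `t`, whose sign is eventually
-- constant.
feasible? : ∀ (Φ : List (Affine 0)) →
  (Eventually λ t → feasibleAt Φ t []) ⊎ (Eventually λ t → ¬ feasibleAt Φ t [])
feasible? []      = inj₁ (0 , λ _ _ → [])
feasible? (affine [] h g ∷ Φ) with nonNegative? (g ∷ h ∷ []) | feasible? Φ
... | inj₂ ev | _ = inj₂ (eventually-map (λ { t neg (x ∷ _) → neg (subst (0ℤ ≤_) (identity h g (+ t)) x) }) ev)
  where
  identity : ∀ h g t → 0ℤ + (h * t + g) ≡ g + t * (h + t * 0ℤ)
  identity = solve-∀
... | inj₁ _  | inj₂ ev = inj₂ (eventually-map (λ { t neg (_ ∷ xs) → neg xs }) ev)
... | inj₁ ev | inj₁ evs = inj₁ (eventually-map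
        (λ t (x , xs) → subst (0ℤ ≤_) (identity h g (+ t)) x ∷ xs) (eventually-× ev evs))
  where
  identity : ∀ h g t → g + t * (h + t * 0ℤ) ≡ 0ℤ + (h * t + g)
  identity = solve-∀

outputs-[] : ∀ {k} (os : Vec (ParametricForm 0) k) t → outputs os t [] ≡ Vec.map proj₂ os ⟨ t ⟩
outputs-[] []               t = refl
outputs-[] (([] , β) ∷ os) t = cong₂ _∷_ (ℤ.+-identityˡ (evaluate β t)) (outputs-[] os t)

constantSystem-maximum : ∀ {k} Φ (os : Vec (ParametricForm 0) (suc k)) → QuasiMaximum (Image (feasibleAt Φ) os)
constantSystem-maximum Φ os with feasible? Φ
... | inj₂ ev = polynomial⇒quasi (inj₁ (eventually-map (λ { t ¬h w ([] , h , _) → ¬h h }) ev))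
... | inj₁ ev = polynomial⇒quasi (inj₂ (Vec.map proj₂ os , eventually-map
        (λ t h → ([] , h , sym (outputs-[] os (+ t))) , λ { w ([] , _ , refl) →
          ℤ.≤-reflexive (cong Vec.head (outputs-[] os (+ t))) }) ev))

private
  slopeOf : ∀ {n} → Affine (suc n) → ℤ
  slopeOf φ = Vec.head (linear φ)

  restOf : ∀ {n} → Vec ℤ n → ℤ → Affine (suc n) → ℤ
  restOf y t φ = Vec.tail (linear φ) ∙ y + (rate φ * t + offset φ)

  split : ∀ {n} (φ : Affine (suc n)) t z (y : Vec ℤ n) →
    φ ⟦ t , z ∷ y ⟧ ≡ slopeOf φ * z + restOf y t φ
  split (affine (a ∷ u) h g) t z y = ℤ.+-assoc (a * z) (u ∙ y) (h * t + g)

∈-interval∣∣ : ∀ {q n} → ∣ q ∣ ℕ.≤ n → q ∈ interval n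
∈-interval∣∣ {q} {n} h = ∈-interval n (-n≤i q h) (i≤n q h)

-- This is `∣ a ∣` for a nonzero slope `a`. The value 1 for slope zero permits dividing before the
-- constraint is known to be tight.
modulus : ∀ {n} → Affine (suc n) → ℕ
modulus φ = suc (ℕ.pred ∣ slopeOf φ ∣)

-- If φ = a y₀ + … is tight, y₀ is determined by the other coordinates and t up
-- to finitely many values of p y₀ with p = |a|; splitting these modulo p makes y₀ affine.
module Pivot {n} (φ : Affine (suc n)) (r : ℕ) (ρ : Vec ℤ n) where

  a = slopeOf φ
  u = Vec.tail (linear φ)
  h = rate φ
  g = offset φ
  p = modulus φ
  σ = proj₁ (signOf a)
  σ²≡1 = proj₁ (proj₂ (signOf a))
  σa≡∣a∣ = proj₂ (proj₂ (signOf a))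

  solution : ℤ → Affine n
  solution q = affine (- σ · u) (- σ * h) q

  residueBound : ℕ
  residueBound = p ℕ.+ ∣ u ∙ ρ + (h * + r + g) ∣

  -- If `e` is the value of `φ` and `C` the part of it contributed by the residues, then
  -- `a z + p (u ∙ x + h s) = e - C`. Multiplying by `σ` and using `σ a = p` gives `p q = σ (e - C)`
  -- for `q = z + σ (u ∙ x + h s)`, whence `∣ q ∣ ≤ p + ∣ C ∣`.
  tight⇒solution : ∀ s x z → Tight slopeOf (restOf (+ p · x ⊕ ρ) (+ (r ℕ.+ p ℕ.* s))) z φ →
    ∃[ q ] q ∈ interval residueBound × z ≡ solution q ⟦ + s , x ⟧
  tight⇒solution s x z (0≤e , e<∣a∣) = q , ∈-interval∣∣ ∣q∣≤ , z≡
    where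
    e = a * z + restOf (+ p · x ⊕ ρ) (+ (r ℕ.+ p ℕ.* s)) φ
    C = u ∙ ρ + (h * + r + g)
    q = z + σ * (u ∙ x + h * + s)
    ∣a∣≡p : ∣ a ∣ ≡ p
    ∣a∣≡p = sym (ℕ.suc-pred ∣ a ∣ {{ℕ.>-nonZero (ℤ.drop‿+<+ (ℤ.≤-<-trans 0≤e e<∣a∣))}})
    σa≡p : σ * a ≡ + p
    σa≡p = trans σa≡∣a∣ (cong +_ ∣a∣≡p)
    ∣e∣≤p : ∣ e ∣ ℕ.≤ p
    ∣e∣≤p = ∣i∣≤ (ℤ.≤-trans (ℤ.neg-mono-≤ (0≤n {p})) 0≤e) (ℤ.<⇒≤ (subst (λ v → e < + v) ∣a∣≡p e<∣a∣))
    e-C : e - C ≡ a * z + + p * (u ∙ x + h * + s)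
    e-C = trans (cong₂ (λ v w → a * z + (v + (h * w + g)) - C) (∙-affine (+ p) u x ρ) (+-progression r p s))
      (identity (a * z) (+ p) (u ∙ x) (u ∙ ρ) h (+ r) (+ s) g)
      where
      identity : ∀ A p U R h r s g →
        A + (p * U + R + (h * (r + p * s) + g)) - (R + (h * r + g)) ≡ A + p * (U + h * s)
      identity = solve-∀
    pq≡ : + p * q ≡ σ * (e - C)
    pq≡ = trans (identity₁ (+ p) z σ (u ∙ x + h * + s))
      (trans (cong (λ v → v * z + σ * (+ p * (u ∙ x + h * + s))) (sym σa≡p))
        (trans (identity₂ σ a z (+ p * (u ∙ x + h * + s))) (cong (σ *_) (sym e-C))))
      where
      identity₁ : ∀ p z σ U → p * (z + σ * U) ≡ p * z + σ * (p * U)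
      identity₁ = solve-∀
      identity₂ : ∀ σ a z V → σ * a * z + σ * V ≡ σ * (a * z + V)
      identity₂ = solve-∀
    ∣q∣≤ : ∣ q ∣ ℕ.≤ residueBound
    ∣q∣≤ = begin
      ∣ q ∣              ≤⟨ ℕ.m≤n*m ∣ q ∣ p ⟩
      p ℕ.* ∣ q ∣        ≡⟨ sym (ℤ.abs-* (+ p) q) ⟩
      ∣ + p * q ∣        ≡⟨ cong ∣_∣ pq≡ ⟩
      ∣ σ * (e - C) ∣    ≡⟨ ∣sign*∣ σ (e - C) σ²≡1 ⟩
      ∣ e - C ∣          ≤⟨ ℤ.∣i-j∣≤∣i∣+∣j∣ e C ⟩
      ∣ e ∣ ℕ.+ ∣ C ∣    ≤⟨ ℕ.+-monoˡ-≤ ∣ C ∣ ∣e∣≤p ⟩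
      residueBound       ∎
      where open ℕ.≤-Reasoning
    z≡ : z ≡ solution q ⟦ + s , x ⟧
    z≡ = trans (identity z σ (u ∙ x) h (+ s))
      (cong (_+ (- σ * h * + s + q)) (sym (∙-·ˡ (- σ) u x)))
      where
      identity : ∀ z σ U h s → z ≡ - σ * U + (- σ * h * s + (z + σ * (U + h * s)))
      identity = solve-∀

-- A branch guesses the tight constraint `φ`, the residues `ρ` and the offset `q`. Since it
-- substitutes into all of `Φ`, a wrong guess still yields only feasible points. By climbing, some
-- right guess reaches a point at least as good as any given one.
affineSystem-maximum : ∀ {n k} (Φ : List (Affine n)) (os : Vec (ParametricForm n) (suc k)) →
  BoundedAt (feasibleAt Φ) → QuasiMaximum (Image (feasibleAt Φ) os)
affineSystem-maximum {zero}      Φ os bounded = constantSystem-maximum Φ os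
affineSystem-maximum {suc n} {k} Φ os bounded = QuasiMaximum-dominated {V′ = V′} (0 , λ t _ → dominates (sound t) (complete t))
  (QuasiMaximum-⋃ (All.universal (λ φ → QuasiMaximum-residues (modulus φ) λ r →
    QuasiMaximum-⋃ (All.universal (λ ρ → QuasiMaximum-⋃ (All.universal (λ q →
      let open Substitution (Pivot.solution φ r ρ q) (modulus φ) ρ r in
      affineSystem-maximum (List.map substitute Φ) (Vec.map substituteₚ os) (substitute-bounded Φ bounded))
      (interval (Pivot.residueBound φ r ρ)))) (box (modulus φ) n))) Φ))
  where
  module S (φ : Affine (suc n)) (r : ℕ) (ρ : Vec ℤ n) (q : ℤ) = Substitution {n} (Pivot.solution φ r ρ q) (modulus φ) ρ r

  Branch : (φ : Affine (suc n)) (r s : ℕ) → Vec ℤ (suc k) → Vec ℤ n → Set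
  Branch φ r s w ρ = Any (λ q → Image (feasibleAt (List.map (S.substitute φ r ρ q) Φ)) (Vec.map (S.substituteₚ φ r ρ q) os) s w)
    (interval (Pivot.residueBound φ r ρ))

  V′ : ℕ → Vec ℤ (suc k) → Set
  V′ t w = Any (λ φ → let p = modulus φ in Any (Branch φ (t ℕ.% p) (t ℕ./ p) w) (box p n)) Φ

  time≡ : ∀ t p .{{_ : NonZero p}} → t ≡ t ℕ.% p ℕ.+ p ℕ.* (t ℕ./ p)
  time≡ t p = trans (ℕ.m≡m%n+[m/n]*n t p) (cong (t ℕ.% p ℕ.+_) (ℕ.*-comm (t ℕ./ p) p))

  sound : ∀ t w → V′ t w → Image (feasibleAt Φ) os t w
  sound t w v with Any.satisfied v
  ... | φ , v₁ with Any.satisfied v₁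
  ...   | ρ , v₂ with Any.satisfied v₂
  ...     | q , x , feasible , refl =
    let p = modulus φ
        open Substitution (Pivot.solution φ (t ℕ.% p) ρ q) p ρ (t ℕ.% p)
        s = t ℕ./ p
    in subst (λ t′ → Image (feasibleAt Φ) os t′ (outputs (Vec.map substituteₚ os) (+ s) x)) (sym (time≡ t p))
         (point (+ s) x , feasible-to Φ s x feasible , outputs-correct os s x)

  toBranch : ∀ t z y → feasibleAt Φ t (z ∷ y) → ∀ φ → Tight slopeOf (restOf y (+ t)) z φ →
    let p = modulus φ in Any (Branch φ (t ℕ.% p) (t ℕ./ p) (outputs os (+ t) (z ∷ y))) (box p n)
  toBranch t z y feasible φ tight with divideᵥ (modulus φ) y
  ... | x , ρ , refl , ρ∈ , _ =
    let p = modulus φ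
        r = t ℕ.% p
        s = t ℕ./ p
        q , q∈ , z≡ = Pivot.tight⇒solution φ r ρ s x z
          (subst (λ t′ → Tight slopeOf (restOf (+ p · x ⊕ ρ) (+ t′)) z φ) (time≡ t p) tight)
        open Substitution (Pivot.solution φ r ρ q) p ρ r
    in lose (∈-box p ρ ρ∈) (lose q∈
         (x , feasible-from Φ s x (subst₂ (feasibleAt Φ) (time≡ t p) (cong (_∷ _) z≡) feasible)
            , trans (cong₂ (λ t′ z′ → outputs os (+ t′) (z′ ∷ + p · x ⊕ ρ)) (time≡ t p) z≡)
                    (sym (outputs-correct os s x))))

  complete : ∀ t w → Image (feasibleAt Φ) os t w → ∃[ w′ ] V′ t w′ × Vec.head w ≤ Vec.head w′
  complete t w (z ∷ y , feasible , refl) =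
    let o = Vec.head os
        c = evaluate (Vec.head (proj₁ o)) (+ t)
        σ , σ²≡1 , σc≡∣c∣ = signOf c
        M , bound = bounded t
        toClimb : ∀ {z} → feasibleAt Φ t (z ∷ y) → All (λ φ → 0ℤ ≤ slopeOf φ * z + restOf y (+ t) φ) Φ
        toClimb = All.map (λ {φ} → subst (0ℤ ≤_) (split φ (+ t) _ y))
        fromClimb : ∀ {z} → All (λ φ → 0ℤ ≤ slopeOf φ * z + restOf y (+ t) φ) Φ → feasibleAt Φ t (z ∷ y)
        fromClimb = All.map (λ {φ} → subst (0ℤ ≤_) (sym (split φ (+ t) _ y)))
        z′ , better , feasible′ , tight = climb slopeOf (restOf y (+ t)) Φ M
          (λ z h → ℕ.≤-trans (ℕ.m≤m+n _ _) (bound (z ∷ y) (fromClimb h))) σ σ²≡1 z (toClimb feasible)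
    in outputs os (+ t) (z′ ∷ y) , Any.map (λ {φ} → toBranch t z′ y (fromClimb feasible′) φ) tight ,
       head-improves os t y z z′ σ σ²≡1 σc≡∣c∣ better
    where
    head-improves : ∀ (os : Vec (ParametricForm (suc n)) (suc k)) t y z z′ σ → IsSign σ →
      let c = evaluate (Vec.head (proj₁ (Vec.head os))) (+ t) in σ * c ≡ + ∣ c ∣ → 0ℤ ≤ σ * (z′ - z) →
      Vec.head (outputs os (+ t) (z ∷ y)) ≤ Vec.head (outputs os (+ t) (z′ ∷ y))
    head-improves ((c ∷ cs , β) ∷ _) t y z z′ σ σ²≡1 σc≡∣c∣ better = by-difference
      (trans (identity₁ (evaluate c (+ t)) z z′ (cs ⟨ + t ⟩ ∙ y) (evaluate β (+ t)))
        (cong (λ v → evaluate c (+ t) * z + cs ⟨ + t ⟩ ∙ y + evaluate β (+ t) + v)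
          (trans (cong (_* (evaluate c (+ t) * (z′ - z))) (sym σ²≡1)) (identity₂ σ (evaluate c (+ t)) (z′ - z)))))
      (0≤* (subst (0ℤ ≤_) (sym σc≡∣c∣) 0≤n) better)
      where
      identity₁ : ∀ c z z′ u b → c * z′ + u + b ≡ c * z + u + b + 1ℤ * (c * (z′ - z))
      identity₁ = solve-∀
      identity₂ : ∀ σ c d → σ * σ * (c * d) ≡ σ * c * (σ * d)
      identity₂ = solve-∀

-- Systems with polynomial coefficients

Satisfies : ∀ {n} → List (ParametricForm n) → ℕ → Vec ℤ n → Set
Satisfies Ψ t x = All (λ ψ → 0ℤ ≤ ψ ⦅ + t , x ⦆) Ψ

Image-dominated : ∀ {n k} {P Q : ℕ → Vec ℤ n → Set} {os : Vec (ParametricForm n) (suc k)} →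
  (∀ t x → P t x → Q t x) → (∀ t x → Q t x → P t x) →
  QuasiMaximum (Image P os) → QuasiMaximum (Image Q os)
Image-dominated P⇒Q Q⇒P = QuasiMaximum-dominated (0 , λ t _ → dominates
  (λ { w (x , p , eq) → x , P⇒Q t x p , eq })
  (λ { w (x , q , eq) → w , (x , Q⇒P t x q , eq) , ℤ.≤-refl }))

-- The rows e₀, e₁, … stand for e₀ + e₁ t + e₂ t² + …
Rows : ℕ → Set
Rows n = List (Vec ℤ n × ℤ)

evaluateRows : ∀ {n} → Rows n → ℤ → Vec ℤ n → ℤ
evaluateRows rs t y = List.foldr (λ (u , g) v → u ∙ y + g + t * v) 0ℤ rs

consColumn : ∀ {n} → ℤ[t] → Rows n → Rows (suc n)
consColumn []      rs             = List.map (λ (u , g) → 0ℤ ∷ u , g) rs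
consColumn (k ∷ p) []             = (k ∷ 𝟎 , 0ℤ) ∷ consColumn p []
consColumn (k ∷ p) ((u , g) ∷ rs) = (k ∷ u , g) ∷ consColumn p rs

toRows : ∀ {n} → Vec ℤ[t] n → ℤ[t] → Rows n
toRows []      β = List.map ([] ,_) β
toRows (p ∷ a) β = consColumn p (toRows a β)

evaluate-consColumn : ∀ {n} p rs t z (y : Vec ℤ n) →
  evaluateRows (consColumn p rs) t (z ∷ y) ≡ evaluate p t * z + evaluateRows rs t y
evaluate-consColumn []      []             t z y = refl
evaluate-consColumn []      ((u , g) ∷ rs) t z y =
  trans (cong (λ v → 0ℤ * z + u ∙ y + g + t * v) (evaluate-consColumn [] rs t z y))
    (identity z (u ∙ y) g t (evaluateRows rs t y))
  where
  identity : ∀ z U g t R → 0ℤ * z + U + g + t * (0ℤ * z + R) ≡ 0ℤ * z + (U + g + t * R)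
  identity = solve-∀
evaluate-consColumn (k ∷ p) []             t z y =
  trans (cong₂ (λ v w → v + 0ℤ + t * w) (head-unit k z y) (evaluate-consColumn p [] t z y))
    (identity k z t (evaluate p t))
  where
  identity : ∀ k z t P → k * z + 0ℤ + t * (P * z + 0ℤ) ≡ (k + t * P) * z + 0ℤ
  identity = solve-∀
evaluate-consColumn (k ∷ p) ((u , g) ∷ rs) t z y =
  trans (cong (λ w → k * z + u ∙ y + g + t * w) (evaluate-consColumn p rs t z y))
    (identity k z (u ∙ y) g t (evaluate p t) (evaluateRows rs t y))
  where
  identity : ∀ k z U g t P R →
    k * z + U + g + t * (P * z + R) ≡ (k + t * P) * z + (U + g + t * R)
  identity = solve-∀

evaluate-toRows : ∀ {n} (a : Vec ℤ[t] n) β t y → evaluateRows (toRows a β) t y ≡ (a , β) ⦅ t , y ⦆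
evaluate-toRows []      β t []      = trans (constants β) (sym (ℤ.+-identityˡ (evaluate β t)))
  where
  constants : ∀ β → evaluateRows (List.map ([] ,_) β) t [] ≡ evaluate β t
  constants []      = refl
  constants (b ∷ β) = cong₂ (λ v w → v + t * w) (ℤ.+-identityˡ b) (constants β)
evaluate-toRows (p ∷ a) β t (z ∷ y) = trans (evaluate-consColumn p (toRows a β) t z y)
  (trans (cong (λ v → evaluate p t * z + v) (evaluate-toRows a β t y))
    (sym (ℤ.+-assoc (evaluate p t * z) (a ⟨ t ⟩ ∙ y) (evaluate β t))))

module _ {n k} (os : Vec (ParametricForm n) (suc k)) where

  -- the maximum is found among the points of P in any box of size linear in t
  LinearlyBoundedMaximum : (ℕ → Vec ℤ n → Set) → Set
  LinearlyBoundedMaximum P = ∀ C K → (∀ t y → feasibleAt C t y → ‖ y ‖ ℕ.≤ K ℕ.* t) →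
    QuasiMaximum (Image (λ t y → feasibleAt C t y × P t y) os)

  -- As e₀ = O(t), the constraint e₀ + e₁ t + e₂ t² + … ≥ 0 holds if and only if
  -- q = ⌊ e₀ / t ⌋ is one of finitely many values and (e₁ + q) + e₂ t + … ≥ 0.
  carry : ∀ {P} → LinearlyBoundedMaximum P → ∀ rs q →
    LinearlyBoundedMaximum λ t y → 0ℤ ≤ evaluateRows rs (+ t) y + q × P t y
  carry {P} good [] q C K bounded = Image-dominated
    (λ { t y (h ∷ hs , p) → hs , subst (0ℤ ≤_) (constant t y) h , p })
    (λ { t y (hs , h , p) → subst (0ℤ ≤_) (sym (constant t y)) h ∷ hs , p })
    (good (affine 𝟎 0ℤ q ∷ C) K λ { t y (_ ∷ hs) → bounded t y hs })
    where
    constant : ∀ t y → 𝟎 ∙ y + (0ℤ * + t + q) ≡ 0ℤ + q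
    constant t y = trans (cong (_+ (0ℤ * + t + q)) (𝟎∙ y)) (cong (λ v → 0ℤ + v) (ℤ.+-identityˡ q))
  carry {P} good ((u , g) ∷ rs) q C K bounded =
    QuasiMaximum-dominated (1 , dominated)
      (QuasiMaximum-⋃ (All.universal
        (λ q′ → carry good rs q′ (digit q′) K λ { t y (_ ∷ _ ∷ hs) → bounded t y hs }) (interval K′)))
    where
    -- For `t ≥ 1`, the size of `u ∙ y + g + q` is at most `(‖ u ‖ K + ∣ g ∣ + ∣ q ∣) t`; the
    -- remainder of the division costs at most one more `t`.
    K′ = suc (‖ u ‖ ℕ.* K ℕ.+ (∣ g ∣ ℕ.+ ∣ q ∣))
    -- The two new constraints say `q′ t ≤ u ∙ y + g + q < (1 + q′) t`, that is, that `q′` is the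
    -- floor of the quotient; both are affine in `y` and `t`.
    digit : ℤ → List (Affine n)
    digit q′ = affine u (- q′) (g + q) ∷ affine (- 1ℤ · u) (1ℤ + q′) (- (g + q) - 1ℤ) ∷ C
    lower : ∀ U q′ t g q → U + (- q′ * t + (g + q)) ≡ (U + g + q) - q′ * t
    lower = solve-∀
    upper : ∀ U q′ t g q → - 1ℤ * U + ((1ℤ + q′) * t + (- (g + q) - 1ℤ)) ≡ (1ℤ + q′) * t - (U + g + q) - 1ℤ
    upper = solve-∀
    Now : ℕ → Vec ℤ n → Set
    Now t y = feasibleAt C t y × 0ℤ ≤ evaluateRows ((u , g) ∷ rs) (+ t) y + q × P t y
    Next : ℤ → ℕ → Vec ℤ n → Set
    Next q′ t y = feasibleAt (digit q′) t y × 0ℤ ≤ evaluateRows rs (+ t) y + q′ × P t y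
    dominated : ∀ t → 1 ℕ.≤ t → Dominates
      (λ t w → Any (λ q′ → Image (Next q′) os t w) (interval K′)) (Image Now os) t
    dominated t@(suc _) _ = dominates sound
      (λ { w (y , (hs , h , p) , eq) →
        let e = u ∙ y + g + q
            q′ = e ℤ./ℕ t
        in w , lose (∈-interval∣∣ (digit-bound y (bounded t y hs)))
             (y , (subst (0ℤ ≤_) (sym (lower (u ∙ y) q′ (+ t) g q)) (difference (ℤ.[n/ℕd]*d≤n e t))
                 ∷ subst (0ℤ ≤_) (sym (trans (cong (_+ ((1ℤ + q′) * + t + (- (g + q) - 1ℤ))) (∙-·ˡ (- 1ℤ) u y))
                     (upper (u ∙ y) q′ (+ t) g q))) (<⇒0≤ (ℤ.n<s[n/ℕd]*d e t))
                 ∷ hs , complete y h , p) , eq) , ℤ.≤-refl })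
      where
      sound : ∀ w → Any (λ q′ → Image (Next q′) os t w) (interval K′) → Image Now os t w
      sound w v with Any.satisfied v
      ... | q′ , y , (h ∷ _ ∷ hs , h′ , p) , eq =
        y , (hs , subst (0ℤ ≤_) (sound-identity (u ∙ y) q′ (+ t) g q (evaluateRows rs (+ t) y))
                    (0≤+ h (0≤* (0≤n {t}) h′)) , p) , eq
        where
        sound-identity : ∀ U q′ t g q R → U + (- q′ * t + (g + q)) + t * (R + q′) ≡ U + g + t * R + q
        sound-identity = solve-∀
      complete : ∀ y → 0ℤ ≤ evaluateRows ((u , g) ∷ rs) (+ t) y + q →
        0ℤ ≤ evaluateRows rs (+ t) y + (u ∙ y + g + q) ℤ./ℕ t
      -- Let `R` be the value of the remaining rows. If `R + q′` were at most -1, then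
      -- `u ∙ y + g + q < (1 + q′) t` would make the whole sum negative.
      complete y h = ℤ.≮⇒≥ λ neg → 0≰-1-n 0 (subst (0ℤ ≤_)
        (identity (u ∙ y) g (+ t) (evaluateRows rs (+ t) y) q ((u ∙ y + g + q) ℤ./ℕ t))
        (0≤+ (0≤+ h (<⇒0≤ (ℤ.n<s[n/ℕd]*d (u ∙ y + g + q) t))) (0≤* (0≤n {t}) (<⇒0≤ neg))))
        where
        identity : ∀ U g t R q q′ →
          U + g + t * R + q + ((1ℤ + q′) * t - (U + g + q) - 1ℤ) + t * (0ℤ - (R + q′) - 1ℤ) ≡ - 1ℤ
        identity = solve-∀
      digit-bound : ∀ y → ‖ y ‖ ℕ.≤ K ℕ.* t → ∣ (u ∙ y + g + q) ℤ./ℕ t ∣ ℕ.≤ K′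
      digit-bound y ‖y‖≤ = ℕ.*-cancelʳ-≤ ∣ q′ ∣ K′ t (begin
        ∣ q′ ∣ ℕ.* t                ≡⟨ sym (ℤ.abs-* q′ (+ t)) ⟩
        ∣ q′ * + t ∣                ≡⟨ cong ∣_∣ (trans (identity (+ r) (q′ * + t)) (cong (_- + r) (sym (ℤ.a≡a%ℕn+[a/ℕn]*n e t)))) ⟩
        ∣ e - + r ∣                 ≤⟨ ℤ.∣i-j∣≤∣i∣+∣j∣ e (+ r) ⟩
        ∣ e ∣ ℕ.+ r                 ≤⟨ ℕ.+-mono-≤ ∣e∣≤ (ℕ.<⇒≤ (ℤ.n%ℕd<d e t)) ⟩
        (‖ u ‖ ℕ.* K ℕ.+ (∣ g ∣ ℕ.+ ∣ q ∣)) ℕ.* t ℕ.+ t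
                                    ≡⟨ ℕ.+-comm _ t ⟩
        K′ ℕ.* t                    ∎)
        where
        open ℕ.≤-Reasoning
        e = u ∙ y + g + q
        q′ = e ℤ./ℕ t
        r = e ℤ.%ℕ t
        identity : ∀ r v → v ≡ r + v - r
        identity = solve-∀
        ∣e∣≤ : ∣ e ∣ ℕ.≤ (‖ u ‖ ℕ.* K ℕ.+ (∣ g ∣ ℕ.+ ∣ q ∣)) ℕ.* t
        ∣e∣≤ = begin
          ∣ u ∙ y + g + q ∣                         ≤⟨ ℤ.∣i+j∣≤∣i∣+∣j∣ (u ∙ y + g) q ⟩
          ∣ u ∙ y + g ∣ ℕ.+ ∣ q ∣                   ≤⟨ ℕ.+-monoˡ-≤ ∣ q ∣ (ℤ.∣i+j∣≤∣i∣+∣j∣ (u ∙ y) g) ⟩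
          ∣ u ∙ y ∣ ℕ.+ ∣ g ∣ ℕ.+ ∣ q ∣             ≡⟨ ℕ.+-assoc (∣ u ∙ y ∣) (∣ g ∣) (∣ q ∣) ⟩
          ∣ u ∙ y ∣ ℕ.+ (∣ g ∣ ℕ.+ ∣ q ∣)           ≤⟨ ℕ.+-mono-≤ (ℕ.≤-trans (∣∙∣ u y) (ℕ.*-monoʳ-≤ ‖ u ‖ ‖y‖≤)) (ℕ.m≤m*n (∣ g ∣ ℕ.+ ∣ q ∣) t) ⟩
          ‖ u ‖ ℕ.* (K ℕ.* t) ℕ.+ (∣ g ∣ ℕ.+ ∣ q ∣) ℕ.* t
                                                    ≡⟨ cong (ℕ._+ (∣ g ∣ ℕ.+ ∣ q ∣) ℕ.* t) (sym (ℕ.*-assoc ‖ u ‖ K t)) ⟩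
          ‖ u ‖ ℕ.* K ℕ.* t ℕ.+ (∣ g ∣ ℕ.+ ∣ q ∣) ℕ.* t
                                                    ≡⟨ sym (ℕ.*-distribʳ-+ t (‖ u ‖ ℕ.* K) _) ⟩
          (‖ u ‖ ℕ.* K ℕ.+ (∣ g ∣ ℕ.+ ∣ q ∣)) ℕ.* t ∎

  -- Each constraint starts with carry 0 and is moved digit by digit from `Ψ` into `C`, until only
  -- affine constraints are left. Quantifying over `C` in `LinearlyBoundedMaximum` leaves room for
  -- them.
  satisfying-maximum : ∀ Ψ → LinearlyBoundedMaximum (Satisfies Ψ)
  satisfying-maximum [] C K bounded = Image-dominated (λ t y h → h , []) (λ t y → proj₁)
    (affineSystem-maximum C os λ t → K ℕ.* t , bounded t)
  satisfying-maximum ((a , β) ∷ Ψ) C K bounded = Image-dominated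
    (λ { t y (c , h , hs) → c , subst (0ℤ ≤_) (rows t y) h ∷ hs })
    (λ { t y (c , h ∷ hs) → c , subst (0ℤ ≤_) (sym (rows t y)) h , hs })
    (carry (satisfying-maximum Ψ) (toRows a β) 0ℤ C K bounded)
    where
    rows : ∀ t y → evaluateRows (toRows a β) (+ t) y + 0ℤ ≡ (a , β) ⦅ + t , y ⦆
    rows t y = trans (ℤ.+-identityʳ _) (evaluate-toRows a β (+ t) y)

monomial : ℤ → ℕ → ℤ[t]
monomial k zero    = k ∷ []
monomial k (suc d) = 0ℤ ∷ monomial k d

evaluate-monomial : ∀ k d t → evaluate (monomial (+ k) d) (+ t) ≡ + (k ℕ.* t ℕ.^ d)
evaluate-monomial k zero    t = trans (cong (λ v → + k + v) (ℤ.*-zeroʳ (+ t)))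
  (trans (ℤ.+-identityʳ (+ k)) (cong +_ (sym (ℕ.*-identityʳ k))))
evaluate-monomial k (suc d) t = trans (ℤ.+-identityˡ _) (trans (cong (+ t *_) (evaluate-monomial k d t))
  (trans (sym (ℤ.pos-* t (k ℕ.* t ℕ.^ d))) (cong +_ (begin
    t ℕ.* (k ℕ.* t ℕ.^ d)    ≡⟨ sym (ℕ.*-assoc t k _) ⟩
    t ℕ.* k ℕ.* t ℕ.^ d      ≡⟨ cong (ℕ._* t ℕ.^ d) (ℕ.*-comm t k) ⟩
    k ℕ.* t ℕ.* t ℕ.^ d      ≡⟨ ℕ.*-assoc k t _ ⟩
    k ℕ.* (t ℕ.* t ℕ.^ d)    ∎))))
  where open ≡-Reasoning

constants : ∀ {n} → Vec ℤ n → Vec ℤ[t] n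
constants = Vec.map (_∷ [])

⟨⟩-constants : ∀ {n} (u : Vec ℤ n) t → constants u ⟨ t ⟩ ≡ u
⟨⟩-constants []      t = refl
⟨⟩-constants (k ∷ u) t = cong₂ _∷_
  (trans (cong (λ v → k + v) (ℤ.*-zeroʳ t)) (ℤ.+-identityʳ k)) (⟨⟩-constants u t)

-- The substitution x = t x′ + y.
splitForm : ∀ {n} → ParametricForm n → ParametricForm (n ℕ.+ n)
splitForm (a , β) = Vec.map (0ℤ ∷_) a Vec.++ a , β

splitForm-correct : ∀ {n} (o : ParametricForm n) t x′ y →
  splitForm o ⦅ t , x′ Vec.++ y ⦆ ≡ o ⦅ t , t · x′ ⊕ y ⦆
splitForm-correct (a , β) t x′ y = cong (_+ evaluate β t) (begin
  (Vec.map (0ℤ ∷_) a Vec.++ a) ⟨ t ⟩ ∙ (x′ Vec.++ y)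
    ≡⟨ cong (_∙ (x′ Vec.++ y)) (Vec.map-++ _ (Vec.map (0ℤ ∷_) a) a) ⟩
  (Vec.map (0ℤ ∷_) a ⟨ t ⟩ Vec.++ a ⟨ t ⟩) ∙ (x′ Vec.++ y)
    ≡⟨ ∙-++ (Vec.map (0ℤ ∷_) a ⟨ t ⟩) x′ ⟩
  Vec.map (0ℤ ∷_) a ⟨ t ⟩ ∙ x′ + a ⟨ t ⟩ ∙ y
    ≡⟨ cong (_+ a ⟨ t ⟩ ∙ y) (trans (cong (_∙ x′) (times-t a)) (∙-·ˡ t (a ⟨ t ⟩) x′)) ⟩
  t * a ⟨ t ⟩ ∙ x′ + a ⟨ t ⟩ ∙ y
    ≡⟨ sym (∙-affine t (a ⟨ t ⟩) x′ y) ⟩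
  a ⟨ t ⟩ ∙ (t · x′ ⊕ y)  ∎)
  where
  open ≡-Reasoning
  times-t : ∀ {n} (a : Vec ℤ[t] n) → Vec.map (0ℤ ∷_) a ⟨ t ⟩ ≡ t · a ⟨ t ⟩
  times-t []      = refl
  times-t (p ∷ a) = cong₂ _∷_ (ℤ.+-identityˡ (t * evaluate p t)) (times-t a)

-- Each substitution `x = t x′ + y` doubles the number of variables and lowers the exponent by one,
-- since `y` is at most `n t` in norm. The bound is known only from `T` on, so box constraints make
-- it part of the new system; for large `t` they exclude no representation obtained by division.
polynomiallyBounded-maximum : ∀ d {n k} Ψ (os : Vec (ParametricForm n) (suc k)) K T →
  (∀ t → T ℕ.≤ t → ∀ x → Satisfies Ψ t x → ‖ x ‖ ℕ.≤ K ℕ.* t ℕ.^ suc d) →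
  QuasiMaximum (Image (Satisfies Ψ) os)
polynomiallyBounded-maximum zero {n} Ψ os K T bounded =
  QuasiMaximum-dominated (T , λ t T≤t → dominates
    (λ { w (x , (_ , h) , eq) → x , h , eq })
    (λ { w (x , h , eq) → w , (x , (All.map⁺ (All.map (λ {u} → subst (λ v → 0ℤ ≤ u ∙ x + v) (sym (bound t)))
      (within-box (K ℕ.* t) x (subst (λ v → ‖ x ‖ ℕ.≤ K ℕ.* v) (ℕ.*-identityʳ t) (bounded t T≤t x h)))) , h) , eq) , ℤ.≤-refl }))
    (satisfying-maximum os Ψ (List.map (λ u → affine u (+ K) 0ℤ) (units n)) (n ℕ.* K)
      λ t y h → subst (‖ y ‖ ℕ.≤_) (sym (ℕ.*-assoc n K t))
        (norm-within-box (K ℕ.* t) y (All.map (λ {u} → subst (λ v → 0ℤ ≤ u ∙ y + v) (bound t)) (All.map⁻ h))))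
  where
  bound : ∀ t → + K * + t + 0ℤ ≡ + (K ℕ.* t)
  bound t = trans (ℤ.+-identityʳ _) (sym (ℤ.pos-* K t))
polynomiallyBounded-maximum (suc d) {n} Ψ os K T bounded =
  QuasiMaximum-dominated (suc T , dominated)
    (polynomiallyBounded-maximum d Ψ′ (Vec.map splitForm os) ((n ℕ.+ n) ℕ.* K′) 0 bounded′)
  where
  -- `x′` contributes `K + n`, as `t x′ = x - y`, and `y` contributes another `n`.
  K′ = K ℕ.+ n ℕ.+ n
  boxForms : List (ParametricForm (n ℕ.+ n))
  boxForms = List.map (λ u → constants u , monomial (+ K′) (suc d)) (units (n ℕ.+ n))
  Ψ′ = List.map splitForm Ψ List.++ boxForms
  boxForm≡ : ∀ u t z → (constants u , monomial (+ K′) (suc d)) ⦅ + t , z ⦆ ≡ u ∙ z + + (K′ ℕ.* t ℕ.^ suc d)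
  boxForm≡ u t z = cong₂ _+_ (cong (_∙ z) (⟨⟩-constants u (+ t))) (evaluate-monomial K′ (suc d) t)
  bounded′ : ∀ t → 0 ℕ.≤ t → ∀ z → Satisfies Ψ′ t z → ‖ z ‖ ℕ.≤ (n ℕ.+ n) ℕ.* K′ ℕ.* t ℕ.^ suc d
  bounded′ t _ z h = subst (‖ z ‖ ℕ.≤_) (sym (ℕ.*-assoc (n ℕ.+ n) K′ _))
    (norm-within-box _ z (All.map (λ {u} → subst (0ℤ ≤_) (boxForm≡ u t z))
      (All.map⁻ (All.++⁻ʳ (List.map splitForm Ψ) h))))
  outputs≡ : ∀ {k} (os : Vec (ParametricForm n) k) t x′ y →
    outputs (Vec.map splitForm os) t (x′ Vec.++ y) ≡ outputs os t (t · x′ ⊕ y)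
  outputs≡ []       t x′ y = refl
  outputs≡ (o ∷ os) t x′ y = cong₂ _∷_ (splitForm-correct o t x′ y) (outputs≡ os t x′ y)
  quotient-bound : ∀ t .{{_ : NonZero t}} (x′ y : Vec ℤ n) → ‖ + t · x′ ⊕ y ‖ ℕ.≤ K ℕ.* t ℕ.^ suc (suc d) →
    ‖ y ‖ ℕ.≤ n ℕ.* t → ‖ x′ Vec.++ y ‖ ℕ.≤ K′ ℕ.* t ℕ.^ suc d
  quotient-bound t x′ y ‖x‖≤ ‖y‖≤ = begin
    ‖ x′ Vec.++ y ‖                              ≡⟨ ‖++‖ x′ y ⟩
    ‖ x′ ‖ ℕ.+ ‖ y ‖                             ≤⟨ ℕ.+-mono-≤ ‖x′‖≤ (ℕ.≤-trans ‖y‖≤ (ℕ.*-monoʳ-≤ n t≤)) ⟩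
    (K ℕ.+ n) ℕ.* t ℕ.^ suc d ℕ.+ n ℕ.* t ℕ.^ suc d
                                                 ≡⟨ sym (ℕ.*-distribʳ-+ _ (K ℕ.+ n) n) ⟩
    K′ ℕ.* t ℕ.^ suc d                           ∎
    where
    open ℕ.≤-Reasoning
    t≤ : t ℕ.≤ t ℕ.^ suc d
    t≤ = ℕ.m≤m*n t (t ℕ.^ d) {{ℕ.m^n≢0 t d}}
    ‖x′‖≤ : ‖ x′ ‖ ℕ.≤ (K ℕ.+ n) ℕ.* t ℕ.^ suc d
    ‖x′‖≤ = ℕ.*-cancelˡ-≤ t (begin
      t ℕ.* ‖ x′ ‖                               ≤⟨ ‖affine‖ t x′ y ⟩
      ‖ + t · x′ ⊕ y ‖ ℕ.+ ‖ y ‖                 ≤⟨ ℕ.+-mono-≤ ‖x‖≤ (ℕ.≤-trans ‖y‖≤ (ℕ.*-monoʳ-≤ n (ℕ.m≤m*n t (t ℕ.^ suc d) {{ℕ.m^n≢0 t (suc d)}}))) ⟩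
      K ℕ.* (t ℕ.* t ℕ.^ suc d) ℕ.+ n ℕ.* (t ℕ.* t ℕ.^ suc d)
                                                 ≡⟨ sym (ℕ.*-distribʳ-+ _ K n) ⟩
      (K ℕ.+ n) ℕ.* (t ℕ.* t ℕ.^ suc d)          ≡⟨ sym (ℕ.*-assoc (K ℕ.+ n) t _) ⟩
      (K ℕ.+ n) ℕ.* t ℕ.* t ℕ.^ suc d            ≡⟨ cong (ℕ._* t ℕ.^ suc d) (ℕ.*-comm (K ℕ.+ n) t) ⟩
      t ℕ.* (K ℕ.+ n) ℕ.* t ℕ.^ suc d            ≡⟨ ℕ.*-assoc t (K ℕ.+ n) _ ⟩
      t ℕ.* ((K ℕ.+ n) ℕ.* t ℕ.^ suc d)          ∎)
  dominated : ∀ t → suc T ℕ.≤ t → Dominates (Image (Satisfies Ψ′) (Vec.map splitForm os)) (Image (Satisfies Ψ) os) t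
  dominated t@(suc _) T<t = dominates sound complete
    where
    sound : ∀ w → Image (Satisfies Ψ′) (Vec.map splitForm os) t w → Image (Satisfies Ψ) os t w
    sound w (z , h , refl) with Vec.splitAt n z
    ... | x′ , y , refl = + t · x′ ⊕ y ,
      All.map (λ {o} → subst (0ℤ ≤_) (splitForm-correct o (+ t) x′ y)) (All.map⁻ (All.++⁻ˡ (List.map splitForm Ψ) h)) ,
      outputs≡ os (+ t) x′ y
    complete : ∀ w → Image (Satisfies Ψ) os t w →
      ∃[ w′ ] Image (Satisfies Ψ′) (Vec.map splitForm os) t w′ × Vec.head w ≤ Vec.head w′
    complete w (x , h , refl) with divideᵥ t x
    ... | x′ , y , refl , _ , ‖y‖≤ = _ , (x′ Vec.++ y ,
      All.++⁺ (All.map⁺ (All.map (λ {o} → subst (0ℤ ≤_) (sym (splitForm-correct o (+ t) x′ y))) h))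
        (All.map⁺ (All.map (λ {u} → subst (0ℤ ≤_) (sym (boxForm≡ u t (x′ Vec.++ y))))
          (within-box _ (x′ Vec.++ y) (quotient-bound t x′ y (bounded t (ℕ.<⇒≤ T<t) _ h) ‖y‖≤)))) ,
      sym (outputs≡ os (+ t) x′ y)) , ℤ.≤-refl

-- Polynomial bounds for the integer points

-- The form is nonnegative at (x, N) when a ∙ x + β is nonnegative at x / N.
Homogeneous : ℕ → Set
Homogeneous n = Vec ℤ n × ℤ

infix 9 _⟅_,_⟆
_⟅_,_⟆ : ∀ {n} → Homogeneous n → ℤ → Vec ℤ n → ℤ
(a , β) ⟅ N , x ⟆ = a ∙ x + β * N

size : ∀ {n} → Homogeneous n → ℕ
size (a , β) = ‖ a ‖ ℕ.+ ∣ β ∣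

-- Boundedness at all rational points `x / N`, with denominators cleared. Integer points alone would
-- not support the induction: an integer point of an eliminated system lifts to a point with
-- denominator `p`.
RationallyBounded : ∀ {n} → List (Homogeneous n) → Set
RationallyBounded Φ = ∃[ M ] ∀ N .{{_ : NonZero N}} x →
  All (λ φ → 0ℤ ≤ φ ⟅ + N , x ⟆) Φ → ‖ x ‖ ℕ.≤ M ℕ.* N

-- Elimination of the first coordinate through the equation a z + u ∙ x + β N = k N.
module Elimination {n} (a : ℤ) (u : Vec ℤ n) (β k : ℤ) where

  p = ∣ a ∣
  σ = proj₁ (signOf a)
  σ²≡1 = proj₁ (proj₂ (signOf a))
  σa≡p = proj₂ (proj₂ (signOf a))

  eliminate : Homogeneous (suc n) → Homogeneous n
  eliminate (b ∷ v , γ) = + p · v ⊕ - (b * σ) · u , + p * γ + b * σ * (k - β)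

  lift : ℕ → Vec ℤ n → Vec ℤ (suc n)
  lift N x = σ * (k * + N - (u ∙ x + β * + N)) ∷ + p · x

  -- At scale `p N` the point `lift N x` solves the equation being eliminated: multiplying its first
  -- entry by `a` turns `σ` into `p`, which cancels against the tail `p x`.
  eliminate-lift : ∀ φ N x → eliminate φ ⟅ + N , x ⟆ ≡ φ ⟅ + (p ℕ.* N) , lift N x ⟆
  eliminate-lift (b ∷ v , γ) N x = begin
    (+ p · v ⊕ - (b * σ) · u) ∙ x + (+ p * γ + b * σ * (k - β)) * + N
      ≡⟨ cong (_+ _) (trans (∙-⊕ˡ (+ p · v) (- (b * σ) · u) x) (cong₂ _+_ (∙-·ˡ (+ p) v x) (∙-·ˡ (- (b * σ)) u x))) ⟩
    + p * v ∙ x + - (b * σ) * u ∙ x + (+ p * γ + b * σ * (k - β)) * + N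
      ≡⟨ identity (+ p) (v ∙ x) b σ (u ∙ x) γ k β (+ N) ⟩
    b * (σ * (k * + N - (u ∙ x + β * + N))) + + p * v ∙ x + γ * (+ p * + N)
      ≡⟨ cong₂ (λ V W → b * (σ * (k * + N - (u ∙ x + β * + N))) + V + γ * W) (sym (∙-·ʳ (+ p) v x)) (sym (ℤ.pos-* p N)) ⟩
    b * (σ * (k * + N - (u ∙ x + β * + N))) + v ∙ (+ p · x) + γ * + (p ℕ.* N)  ∎
    where
    open ≡-Reasoning
    identity : ∀ p V b σ U γ k β N →
      p * V + - (b * σ) * U + (p * γ + b * σ * (k - β)) * N ≡
      b * (σ * (k * N - (U + β * N))) + p * V + γ * (p * N)
    identity = solve-∀

  eliminate-solution : ∀ φ z x → a * z + (u ∙ x + β * 1ℤ) ≡ k →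
    eliminate φ ⟅ 1ℤ , x ⟆ ≡ + p * φ ⟅ 1ℤ , z ∷ x ⟆
  eliminate-solution (b ∷ v , γ) z x e≡k = begin
    (+ p · v ⊕ - (b * σ) · u) ∙ x + (+ p * γ + b * σ * (k - β)) * 1ℤ
      ≡⟨ cong₂ _+_ (trans (∙-⊕ˡ (+ p · v) (- (b * σ) · u) x) (cong₂ _+_ (∙-·ˡ (+ p) v x) (∙-·ˡ (- (b * σ)) u x)))
           (cong (λ k → (+ p * γ + b * σ * (k - β)) * 1ℤ) (sym e≡k)) ⟩
    + p * v ∙ x + - (b * σ) * u ∙ x + (+ p * γ + b * σ * (a * z + (u ∙ x + β * 1ℤ) - β)) * 1ℤ
      ≡⟨ identity₁ (+ p) (v ∙ x) b σ (u ∙ x) γ a z β ⟩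
    + p * v ∙ x + + p * γ + b * (σ * a) * z
      ≡⟨ cong (λ v′ → + p * v ∙ x + + p * γ + b * v′ * z) σa≡p ⟩
    + p * v ∙ x + + p * γ + b * + p * z
      ≡⟨ identity₂ (+ p) (v ∙ x) γ b z ⟩
    + p * (b * z + v ∙ x + γ * 1ℤ)  ∎
    where
    open ≡-Reasoning
    identity₁ : ∀ p V b σ U γ a z β →
      p * V + - (b * σ) * U + (p * γ + b * σ * (a * z + (U + β * 1ℤ) - β)) * 1ℤ ≡
      p * V + p * γ + b * (σ * a) * z
    identity₁ = solve-∀
    identity₂ : ∀ p V γ b z → p * V + p * γ + b * p * z ≡ p * (b * z + V + γ * 1ℤ)
    identity₂ = solve-∀

  -- The terms with factor `p` add up to at most `H²`. Those with factor `b` contribute at most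
  -- `H (‖ u ‖ + ∣ β ∣ + ∣ k ∣)`, which is at most `2 H²`.
  size-eliminate : ∀ {H} → size (a ∷ u , β) ℕ.≤ H → ∣ k ∣ ℕ.≤ H → ∀ φ → size φ ℕ.≤ H →
    size (eliminate φ) ℕ.≤ 3 ℕ.* (H ℕ.* H)
  size-eliminate {H} f≤H k≤H (b ∷ v , γ) φ≤H = begin
    ‖ + p · v ⊕ - (b * σ) · u ‖ ℕ.+ ∣ + p * γ + b * σ * (k - β) ∣
      ≤⟨ ℕ.+-mono-≤ (‖⊕‖ (+ p · v) (- (b * σ) · u)) (ℤ.∣i+j∣≤∣i∣+∣j∣ (+ p * γ) (b * σ * (k - β))) ⟩
    (‖ + p · v ‖ ℕ.+ ‖ - (b * σ) · u ‖) ℕ.+ (∣ + p * γ ∣ ℕ.+ ∣ b * σ * (k - β) ∣)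
      ≡⟨ cong₂ ℕ._+_ (cong₂ ℕ._+_ (‖·‖ (+ p) v) (trans (‖·‖ (- (b * σ)) u) (cong (ℕ._* ‖ u ‖) (trans (ℤ.∣-i∣≡∣i∣ (b * σ)) ∣bσ∣))))
                     (cong₂ ℕ._+_ (ℤ.abs-* (+ p) γ) (trans (ℤ.abs-* (b * σ) (k - β)) (cong (ℕ._* ∣ k - β ∣) ∣bσ∣))) ⟩
    (p ℕ.* ‖ v ‖ ℕ.+ ∣ b ∣ ℕ.* ‖ u ‖) ℕ.+ (p ℕ.* ∣ γ ∣ ℕ.+ ∣ b ∣ ℕ.* ∣ k - β ∣)
      ≡⟨ interchange (p ℕ.* ‖ v ‖) _ _ _ ⟩
    (p ℕ.* ‖ v ‖ ℕ.+ p ℕ.* ∣ γ ∣) ℕ.+ (∣ b ∣ ℕ.* ‖ u ‖ ℕ.+ ∣ b ∣ ℕ.* ∣ k - β ∣)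
      ≡⟨ sym (cong₂ ℕ._+_ (ℕ.*-distribˡ-+ p ‖ v ‖ (∣ γ ∣)) (ℕ.*-distribˡ-+ (∣ b ∣) ‖ u ‖ (∣ k - β ∣))) ⟩
    p ℕ.* (‖ v ‖ ℕ.+ ∣ γ ∣) ℕ.+ ∣ b ∣ ℕ.* (‖ u ‖ ℕ.+ ∣ k - β ∣)
      ≤⟨ ℕ.+-mono-≤ (ℕ.*-mono-≤ p≤H (ℕ.≤-trans (ℕ.+-monoˡ-≤ (∣ γ ∣) (ℕ.m≤n+m ‖ v ‖ (∣ b ∣))) φ≤H)) (ℕ.*-mono-≤ b≤H ‖u‖+≤) ⟩
    H ℕ.* H ℕ.+ H ℕ.* (H ℕ.+ H)
      ≡⟨ cong (H ℕ.* H ℕ.+_) (trans (ℕ.*-distribˡ-+ H H H) (cong (H ℕ.* H ℕ.+_) (sym (ℕ.+-identityʳ (H ℕ.* H))))) ⟩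
    3 ℕ.* (H ℕ.* H) ∎
    where
    open ℕ.≤-Reasoning
    open import Algebra.Properties.CommutativeSemigroup ℕ.+-commutativeSemigroup using (interchange)
    ∣bσ∣ : ∣ b * σ ∣ ≡ ∣ b ∣
    ∣bσ∣ = trans (cong ∣_∣ (ℤ.*-comm b σ)) (∣sign*∣ σ b σ²≡1)
    p≤H : p ℕ.≤ H
    p≤H = ℕ.≤-trans (ℕ.m≤m+n p ‖ u ‖) (ℕ.≤-trans (ℕ.m≤m+n _ (∣ β ∣)) f≤H)
    b≤H : ∣ b ∣ ℕ.≤ H
    b≤H = ℕ.≤-trans (ℕ.m≤m+n (∣ b ∣) ‖ v ‖) (ℕ.≤-trans (ℕ.m≤m+n _ (∣ γ ∣)) φ≤H)
    ‖u‖+≤ : ‖ u ‖ ℕ.+ ∣ k - β ∣ ℕ.≤ H ℕ.+ H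
    ‖u‖+≤ = begin
      ‖ u ‖ ℕ.+ ∣ k - β ∣              ≤⟨ ℕ.+-monoʳ-≤ ‖ u ‖ (ℤ.∣i-j∣≤∣i∣+∣j∣ k β) ⟩
      ‖ u ‖ ℕ.+ (∣ k ∣ ℕ.+ ∣ β ∣)      ≡⟨ cong (‖ u ‖ ℕ.+_) (ℕ.+-comm (∣ k ∣) (∣ β ∣)) ⟩
      ‖ u ‖ ℕ.+ (∣ β ∣ ℕ.+ ∣ k ∣)      ≡⟨ sym (ℕ.+-assoc ‖ u ‖ (∣ β ∣) (∣ k ∣)) ⟩
      ‖ u ‖ ℕ.+ ∣ β ∣ ℕ.+ ∣ k ∣        ≤⟨ ℕ.+-mono-≤ (ℕ.≤-trans (ℕ.+-monoˡ-≤ (∣ β ∣) (ℕ.m≤n+m ‖ u ‖ p)) f≤H) k≤H ⟩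
      H ℕ.+ H                          ∎

  -- Since k ≥ 0, the eliminated system describes a slice of the original one.
  eliminate-bounded : .{{_ : NonZero p}} → ∀ Φ → RationallyBounded Φ → RationallyBounded (List.map eliminate Φ)
  eliminate-bounded Φ (M , bound) = M , λ N x h → ℕ.*-cancelˡ-≤ p (begin
    p ℕ.* ‖ x ‖                  ≡⟨ sym (‖·‖ (+ p) x) ⟩
    ‖ + p · x ‖                  ≤⟨ ℕ.m≤n+m _ _ ⟩
    ‖ lift N x ‖                 ≤⟨ bound (p ℕ.* N) {{ℕ.m*n≢0 p N}} (lift N x)
                                      (All.map (λ {φ} → subst (0ℤ ≤_) (eliminate-lift φ N x)) (All.map⁻ h)) ⟩
    M ℕ.* (p ℕ.* N)              ≡⟨ x∙yz≈y∙xz M p N ⟩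
    p ℕ.* (M ℕ.* N)              ∎)
    where
    open ℕ.≤-Reasoning
    open import Algebra.Properties.CommutativeSemigroup ℕ.*-commutativeSemigroup using (x∙yz≈y∙xz)

-- Doubly exponential in the number of variables, but for a fixed number polynomial in `H`.
growth : ℕ → ℕ → ℕ
growth zero    H = H
growth (suc n) H = growth n (3 ℕ.* (H ℕ.* H))

-- After climbing in the direction that favours `c`, some constraint `f` is tight, with value `k`
-- below its slope and hence at most `H`. There the eliminated forms at the unchanged tail `x` are
-- `p` times the original ones, so feasibility passes to dimension `n`, and the bound for
-- `eliminate c` comes back because `p ≥ 1`.
objective-bound : ∀ {n} H (Φ : List (Homogeneous n)) → All (λ φ → size φ ℕ.≤ H) Φ → RationallyBounded Φ →
  ∀ c → size c ℕ.≤ H → ∀ x → All (λ φ → 0ℤ ≤ φ ⟅ 1ℤ , x ⟆) Φ → c ⟅ 1ℤ , x ⟆ ≤ + growth n H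
objective-bound {zero} H Φ _ _ ([] , γ) γ≤H [] _ = subst (_≤ + H)
  (sym (trans (ℤ.+-identityˡ (γ * 1ℤ)) (ℤ.*-identityʳ γ))) (i≤n γ γ≤H)
objective-bound {suc n} H Φ sizes (M , bound) c@(c₀ ∷ cs , γ) c≤H (z ∷ x) feasible =
  let σ , σ²≡1 , σc≡∣c∣ = signOf c₀
      z′ , better , feasible′ , tight = climb slope value Φ M
        (λ z h → ℕ.≤-trans (ℕ.m≤m+n _ ‖ x ‖) (subst (∣ z ∣ ℕ.+ ‖ x ‖ ℕ.≤_) (ℕ.*-identityʳ M) (bound 1 (z ∷ x) (from z h))))
        σ σ²≡1 z (to z feasible)
  in ℤ.≤-trans (improve σ σ²≡1 σc≡∣c∣ z′ better)
       (slice-bound z′ feasible′ (Any.lookup tight) (All.lookupAny sizes tight))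
  where
  slope value : Homogeneous (suc n) → ℤ
  slope (a , β) = Vec.head a
  value (a , β) = Vec.tail a ∙ x + β * 1ℤ
  regroup : ∀ φ z → φ ⟅ 1ℤ , z ∷ x ⟆ ≡ slope φ * z + value φ
  regroup (a ∷ u , β) z = ℤ.+-assoc (a * z) (u ∙ x) (β * 1ℤ)
  to : ∀ z → All (λ φ → 0ℤ ≤ φ ⟅ 1ℤ , z ∷ x ⟆) Φ → All (λ φ → 0ℤ ≤ slope φ * z + value φ) Φ
  to z = All.map (λ {φ} → subst (0ℤ ≤_) (regroup φ z))
  from : ∀ z → All (λ φ → 0ℤ ≤ slope φ * z + value φ) Φ → All (λ φ → 0ℤ ≤ φ ⟅ 1ℤ , z ∷ x ⟆) Φ
  from z = All.map (λ {φ} → subst (0ℤ ≤_) (sym (regroup φ z)))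
  improve : ∀ σ → IsSign σ → σ * c₀ ≡ + ∣ c₀ ∣ → ∀ z′ → 0ℤ ≤ σ * (z′ - z) → c ⟅ 1ℤ , z ∷ x ⟆ ≤ c ⟅ 1ℤ , z′ ∷ x ⟆
  improve σ σ²≡1 σc≡∣c∣ z′ better = by-difference
    (trans (identity₁ c₀ z z′ (cs ∙ x) (γ * 1ℤ)) (cong (λ v → c₀ * z + cs ∙ x + γ * 1ℤ + v)
      (trans (cong (_* (c₀ * (z′ - z))) (sym σ²≡1)) (identity₂ σ c₀ (z′ - z)))))
    (0≤* (subst (0ℤ ≤_) (sym σc≡∣c∣) 0≤n) better)
    where
    identity₁ : ∀ c z z′ u b → c * z′ + u + b ≡ c * z + u + b + 1ℤ * (c * (z′ - z))
    identity₁ = solve-∀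
    identity₂ : ∀ σ c d → σ * σ * (c * d) ≡ σ * c * (σ * d)
    identity₂ = solve-∀
  slice-bound : ∀ z′ → All (λ φ → 0ℤ ≤ slope φ * z′ + value φ) Φ → ∀ f →
    size f ℕ.≤ H × Tight slope value z′ f → c ⟅ 1ℤ , z′ ∷ x ⟆ ≤ + growth (suc n) H
  slice-bound z′ feasible′ (a ∷ u , β) (f≤H , 0≤e , e<∣a∣) = descend (c ⟅ 1ℤ , z′ ∷ x ⟆) bound′
    where
    k = a * z′ + (u ∙ x + β * 1ℤ)
    open Elimination a u β k
    instance
      p≢0 : NonZero p
      p≢0 = ℕ.>-nonZero (ℤ.drop‿+<+ (ℤ.≤-<-trans 0≤e e<∣a∣))
    k≤H : ∣ k ∣ ℕ.≤ H
    k≤H = ℕ.≤-trans (∣i∣≤ (ℤ.≤-trans (ℤ.neg-mono-≤ (0≤n {p})) 0≤e) (ℤ.<⇒≤ e<∣a∣))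
            (ℕ.≤-trans (ℕ.m≤m+n p ‖ u ‖) (ℕ.≤-trans (ℕ.m≤m+n _ (∣ β ∣)) f≤H))
    bound′ : + p * c ⟅ 1ℤ , z′ ∷ x ⟆ ≤ + growth (suc n) H
    bound′ = subst (_≤ + growth (suc n) H) (eliminate-solution c z′ x refl)
      (objective-bound (3 ℕ.* (H ℕ.* H)) (List.map eliminate Φ)
        (All.map⁺ (All.map (λ {φ} → size-eliminate f≤H k≤H φ) sizes))
        (eliminate-bounded Φ (M , bound))
        (eliminate c) (size-eliminate f≤H k≤H c c≤H) x
        (All.map⁺ (All.map (λ {φ} h → subst (0ℤ ≤_) (sym (eliminate-solution φ z′ x refl)) (0≤* (0≤n {p}) h)) (from z′ feasible′))))
    descend : ∀ v {B} → + p * v ≤ + B → v ≤ + B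
    descend -[1+ _ ] _ = ℤ.-≤+
    descend (+ v) {B} h = +≤+ (ℕ.≤-trans (ℕ.m≤n*m v p) (ℤ.drop‿+≤+ (subst (_≤ + B) (sym (ℤ.pos-* p v)) h)))

-- Each coordinate and its negative are taken as objectives. `suc H` leaves room for their size 1.
point-bound : ∀ {n} H (Φ : List (Homogeneous n)) → All (λ φ → size φ ℕ.≤ suc H) Φ → RationallyBounded Φ →
  ∀ x → All (λ φ → 0ℤ ≤ φ ⟅ 1ℤ , x ⟆) Φ → ‖ x ‖ ℕ.≤ n ℕ.* growth n (suc H)
point-bound {n} H Φ sizes bounded x feasible = norm-within-box _ x (All.map (λ {u} → bound u) (‖units‖ n))
  where
  bound : ∀ u → ‖ u ‖ ℕ.≤ 1 → 0ℤ ≤ u ∙ x + + growth n (suc H)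
  bound u ‖u‖≤1 = subst (0ℤ ≤_)
    (trans (cong (λ v → + growth n (suc H) - (v + 0ℤ * 1ℤ)) (∙-·ˡ (- 1ℤ) u x)) (identity (u ∙ x) (+ growth n (suc H))))
    (difference (objective-bound (suc H) Φ sizes bounded (- 1ℤ · u , 0ℤ) size≤ x feasible))
    where
    identity : ∀ U F → F - (- 1ℤ * U + 0ℤ * 1ℤ) ≡ U + F
    identity = solve-∀
    size≤ : ‖ - 1ℤ · u ‖ ℕ.+ 0 ℕ.≤ suc H
    size≤ = ℕ.≤-trans (ℕ.≤-reflexive (trans (ℕ.+-identityʳ _) (trans (‖·‖ (- 1ℤ) u) (ℕ.*-identityˡ ‖ u ‖))))
      (ℕ.≤-trans ‖u‖≤1 (ℕ.s≤s ℕ.z≤n))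

PolynomiallyBounded : (ℕ → ℕ) → Set
PolynomiallyBounded h = ∃[ K ] ∃[ d ] ∀ t .{{_ : NonZero t}} → h t ℕ.≤ K ℕ.* t ℕ.^ d

private
  ^-monoʳ : ∀ t .{{_ : NonZero t}} d e → t ℕ.^ d ℕ.≤ t ℕ.^ (d ℕ.+ e)
  ^-monoʳ t d e = ℕ.^-monoʳ-≤ t (ℕ.m≤m+n d e)

bounded-+ : ∀ {h k} → PolynomiallyBounded h → PolynomiallyBounded k → PolynomiallyBounded λ t → h t ℕ.+ k t
bounded-+ (K , d , h≤) (L , e , k≤) = K ℕ.+ L , d ℕ.+ e , λ t → ℕ.≤-trans
  (ℕ.+-mono-≤ (ℕ.≤-trans (h≤ t) (ℕ.*-monoʳ-≤ K (^-monoʳ t d e)))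
              (ℕ.≤-trans (k≤ t) (ℕ.*-monoʳ-≤ L (subst (λ m → t ℕ.^ e ℕ.≤ t ℕ.^ m) (ℕ.+-comm e d) (^-monoʳ t e d)))))
  (ℕ.≤-reflexive (sym (ℕ.*-distribʳ-+ (t ℕ.^ (d ℕ.+ e)) K L)))

bounded-* : ∀ {h k} → PolynomiallyBounded h → PolynomiallyBounded k → PolynomiallyBounded λ t → h t ℕ.* k t
bounded-* (K , d , h≤) (L , e , k≤) = K ℕ.* L , d ℕ.+ e , λ t → ℕ.≤-trans
  (ℕ.*-mono-≤ (h≤ t) (k≤ t))
  (ℕ.≤-reflexive (trans (interchange K (t ℕ.^ d) L (t ℕ.^ e)) (cong (K ℕ.* L ℕ.*_) (sym (ℕ.^-distribˡ-+-* t d e)))))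
  where
  open import Algebra.Properties.CommutativeSemigroup ℕ.*-commutativeSemigroup using (interchange)

bounded-constant : ∀ c → PolynomiallyBounded λ _ → c
bounded-constant c = c , 0 , λ t → ℕ.≤-reflexive (sym (ℕ.*-identityʳ c))

bounded-≤ : ∀ {h k} → (∀ t → h t ℕ.≤ k t) → PolynomiallyBounded k → PolynomiallyBounded h
bounded-≤ h≤k (K , d , k≤) = K , d , λ t → ℕ.≤-trans (h≤k t) (k≤ t)

bounded-growth : ∀ n {h} → PolynomiallyBounded h → PolynomiallyBounded λ t → growth n (h t)
bounded-growth zero    b = b
bounded-growth (suc n) b = bounded-growth n (bounded-* (bounded-constant 3) (bounded-* b b))

bounded-polynomial : ∀ p → PolynomiallyBounded λ t → ∣ evaluate p (+ t) ∣
bounded-polynomial []      = bounded-constant 0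
bounded-polynomial (a ∷ p) = bounded-≤
  (λ t → ℕ.≤-trans (ℤ.∣i+j∣≤∣i∣+∣j∣ a (+ t * evaluate p (+ t))) (ℕ.+-monoʳ-≤ (∣ a ∣) (ℕ.≤-reflexive (ℤ.abs-* (+ t) (evaluate p (+ t))))))
  (bounded-+ (bounded-constant (∣ a ∣)) (bounded-* identity (bounded-polynomial p)))
  where
  identity : PolynomiallyBounded id
  identity = 1 , 1 , λ t → ℕ.≤-reflexive (sym (trans (ℕ.*-identityˡ (t ℕ.* 1)) (ℕ.*-identityʳ t)))

bounded-⟨⟩ : ∀ {n} (a : Vec ℤ[t] n) → PolynomiallyBounded λ t → ‖ a ⟨ + t ⟩ ‖
bounded-⟨⟩ []      = bounded-constant 0
bounded-⟨⟩ (p ∷ a) = bounded-+ (bounded-polynomial p) (bounded-⟨⟩ a)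

specialise : ∀ {n} → ℕ → ParametricForm n → Homogeneous n
specialise t (a , β) = a ⟨ + t ⟩ , evaluate β (+ t)

sizes-bounded : ∀ {n} (Ψ : List (ParametricForm n)) →
  Σ[ h ∈ (ℕ → ℕ) ] PolynomiallyBounded h × (∀ t → All (λ ψ → size (specialise t ψ) ℕ.≤ h t) Ψ)
sizes-bounded [] = (λ _ → 0) , bounded-constant 0 , λ _ → []
sizes-bounded ((a , β) ∷ Ψ) =
  let h , b , sizes = sizes-bounded Ψ
  in (λ t → size (specialise t (a , β)) ℕ.+ h t) ,
     bounded-+ (bounded-+ (bounded-⟨⟩ a) (bounded-polynomial β)) b ,
     λ t → ℕ.m≤m+n _ (h t) ∷ All.map (λ s → ℕ.≤-trans s (ℕ.m≤n+m (h t) _)) (sizes t)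

solutions-bounded : ∀ {n} (Ψ : List (ParametricForm n)) →
  (∀ t .{{_ : NonZero t}} → RationallyBounded (List.map (specialise t) Ψ)) →
  ∃[ K ] ∃[ d ] ∀ t .{{_ : NonZero t}} x → Satisfies Ψ t x → ‖ x ‖ ℕ.≤ K ℕ.* t ℕ.^ d
solutions-bounded {n} Ψ bounded =
  let h , b , sizes = sizes-bounded Ψ
      K , d , bound = bounded-* (bounded-constant n) (bounded-growth n (bounded-+ (bounded-constant 1) b))
  in K , d , λ t x satisfies → ℕ.≤-trans
       (point-bound (h t) (List.map (specialise t) Ψ) (All.map⁺ (All.map ℕ.m≤n⇒m≤1+n (sizes t))) (bounded t) x
         (All.map⁺ (All.map (λ {ψ} → subst (0ℤ ≤_) (one ψ t x)) satisfies)))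
       (bound t)
  where
  one : ∀ ψ t x → ψ ⦅ + t , x ⦆ ≡ specialise t ψ ⟅ 1ℤ , x ⟆
  one (a , β) t x = cong (λ v → a ⟨ + t ⟩ ∙ x + v) (sym (ℤ.*-identityʳ (evaluate β (+ t))))

-- Rational points of the real polyhedra

module _ (N : ℕ) .{{_ : NonZero N}} where

  private
    instance
      N>0 : ℚ.Positive (fromℤ (+ N))
      N>0 = positive N
        where
        positive : ∀ n .{{_ : NonZero n}} → ℚ.Positive (fromℤ (+ n))
        positive (suc n) = _
      N≢0 : ℚ.NonZero (fromℤ (+ N))
      N≢0 = ℚ.pos⇒nonZero (fromℤ (+ N))

  1/N : ℚ
  1/N = ℚ.1/ fromℤ (+ N)

  private
    instance
      1/N>0 : ℚ.Positive 1/N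
      1/N>0 = ℚ.1/pos⇒pos (fromℤ (+ N))
      1/N≥0 : ℚ.NonNegative 1/N
      1/N≥0 = ℚ.pos⇒nonNeg 1/N
      N≥0 : ℚ.NonNegative (fromℤ (+ N))
      N≥0 = ℚ.pos⇒nonNeg (fromℤ (+ N))

  fromℤ-*N/N : ∀ z → fromℤ (z * + N) ℚ.* 1/N ≡ fromℤ z
  fromℤ-*N/N z = trans (cong (ℚ._* 1/N) (fromℤ-* z (+ N))) (trans (ℚ.*-assoc (fromℤ z) (fromℤ (+ N)) 1/N)
    (trans (cong (fromℤ z ℚ.*_) (ℚ.*-inverseʳ (fromℤ (+ N)))) (ℚ.*-identityʳ (fromℤ z))))

  fromℤ-/N*N : ∀ z → fromℤ z ℚ.* 1/N ℚ.* fromℤ (+ N) ≡ fromℤ z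
  fromℤ-/N*N z = trans (ℚ.*-assoc (fromℤ z) 1/N (fromℤ (+ N)))
    (trans (cong (fromℤ z ℚ.*_) (ℚ.*-inverseˡ (fromℤ (+ N)))) (ℚ.*-identityʳ (fromℤ z)))

  quotientPoint : ∀ {n} → Vec ℤ n → Vec ℝ n
  quotientPoint = Vec.map (λ z → fromℚ (fromℤ z ℚ.* 1/N))

  ∙-quotientPoint : ∀ {n} (a x : Vec ℤ n) i →
    seq (Vec.map ι a Overℝ.∙ quotientPoint x) i ≡ fromℤ (a ∙ x) ℚ.* 1/N
  ∙-quotientPoint []      []      i = sym (ℚ.*-zeroˡ 1/N)
  ∙-quotientPoint (k ∷ a) (z ∷ x) i = trans
    (cong₂ ℚ._+_ (trans (sym (ℚ.*-assoc (fromℤ k) (fromℤ z) 1/N)) (cong (ℚ._* 1/N) (sym (fromℤ-* k z)))) (∙-quotientPoint a x i))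
    (trans (sym (ℚ.*-distribʳ-+ 1/N (fromℤ (k * z)) (fromℤ (a ∙ x)))) (cong (ℚ._* 1/N) (sym (fromℤ-+ (k * z) (a ∙ x)))))

  -- All entries are constant sequences, so the inequality of reals is one of rationals that holds
  -- at every index.
  quotient-≤ : ∀ {n} (a x : Vec ℤ n) β → a ∙ x ≤ β * + N → (Vec.map ι a Overℝ.∙ quotientPoint x) ≤ℝ ι β
  quotient-≤ a x β h ε = 0 , λ i _ → begin
    seq (Vec.map ι a Overℝ.∙ quotientPoint x) i  ≡⟨ ∙-quotientPoint a x i ⟩
    fromℤ (a ∙ x) ℚ.* 1/N                        ≤⟨ ℚ.*-monoʳ-≤-nonNeg 1/N (fromℤ-mono-≤ h) ⟩
    fromℤ (β * + N) ℚ.* 1/N                      ≡⟨ fromℤ-*N/N β ⟩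
    fromℤ β                                      ≡⟨ sym (ℚ.+-identityʳ (fromℤ β)) ⟩
    fromℤ β ℚ.+ ℚ.0ℚ                             ≤⟨ ℚ.+-monoʳ-≤ (fromℤ β) (ℚ.<⇒≤ (ℚ.positive⁻¹ ε)) ⟩
    fromℤ β ℚ.+ ε                                ∎
    where open ℚ.≤-Reasoning

  numerator-≤ : ∀ z k {B m} → fromℤ z ℚ.* 1/N ℚ.≤ m ℚ.+ ℚ.1ℚ → ℚ.∣ m ∣ ℚ.≤ B → B ℚ.≤ fromℤ (+ k) →
    z ≤ + (suc k ℕ.* N)
  numerator-≤ z k {B} {m} z/N≤ ∣m∣≤B B≤k = fromℤ-cancel-≤ (begin
    fromℤ z                                      ≡⟨ sym (fromℤ-/N*N z) ⟩
    fromℤ z ℚ.* 1/N ℚ.* fromℤ (+ N)              ≤⟨ ℚ.*-monoʳ-≤-nonNeg (fromℤ (+ N)) (ℚ.≤-trans z/N≤ (ℚ.+-monoˡ-≤ ℚ.1ℚ (ℚ.≤-trans (p≤∣p∣ m) (ℚ.≤-trans ∣m∣≤B B≤k)))) ⟩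
    (fromℤ (+ k) ℚ.+ ℚ.1ℚ) ℚ.* fromℤ (+ N)       ≡⟨ cong (ℚ._* fromℤ (+ N)) (sym (fromℤ-+ (+ k) 1ℤ)) ⟩
    fromℤ (+ (k ℕ.+ 1)) ℚ.* fromℤ (+ N)          ≡⟨ sym (fromℤ-* (+ (k ℕ.+ 1)) (+ N)) ⟩
    fromℤ (+ (k ℕ.+ 1) * + N)                    ≡⟨ cong fromℤ (trans (sym (ℤ.pos-* (k ℕ.+ 1) N)) (cong (λ v → + (v ℕ.* N)) (ℕ.+-comm k 1))) ⟩
    fromℤ (+ (suc k ℕ.* N))                      ∎)
    where
    open ℚ.≤-Reasoning
    p≤∣p∣ : ∀ p → p ℚ.≤ ℚ.∣ p ∣
    p≤∣p∣ p with ℚ.≤-total ℚ.0ℚ p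
    ... | inj₁ 0≤p = ℚ.≤-reflexive (sym (ℚ.0≤p⇒∣p∣≡p 0≤p))
    ... | inj₂ p≤0 = ℚ.≤-trans p≤0 (ℚ.0≤∣p∣ p)

-- At tolerance 1, an index beyond both thresholds gives `∣ z ∣ / N ≤ B + 1 ≤ k + 1`. The constant
-- is independent of `N`, as `RationallyBounded` demands.
numerator-bound : ∀ M → Σ[ K ∈ ℕ ] ∀ N .{{_ : NonZero N}} z →
  -ℝ M ≤ℝ fromℚ (fromℤ z ℚ.* 1/N N) × fromℚ (fromℤ z ℚ.* 1/N N) ≤ℝ M → ∣ z ∣ ℕ.≤ K ℕ.* N
numerator-bound M =
  let B , _ , N₀ , ∣M∣≤B = ∣ M ∣-bounded
      k , B≤k = ceiling B
  in suc k , λ N z (-M≤q , q≤M) →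
    let N₁ , h₁ = -M≤q ℚ.1ℚ
        N₂ , h₂ = q≤M ℚ.1ℚ
        n₁ = N₀ ℕ.⊔ N₁
        n₂ = N₀ ℕ.⊔ N₂
    in ∣i∣≤ (subst (- + (suc k ℕ.* N) ≤_) (ℤ.neg-involutive z) (ℤ.neg-mono-≤ (numerator-≤ N (- z) k
               (subst (ℚ._≤ seq M n₁ ℚ.+ ℚ.1ℚ) (negate N z) (exchange (seq M n₁) (fromℤ z ℚ.* 1/N N) ℚ.1ℚ (h₁ n₁ (ℕ.m≤n⊔m N₀ N₁))))
               (∣M∣≤B n₁ (ℕ.m≤m⊔n N₀ N₁)) B≤k)))
            (numerator-≤ N z k (h₂ n₂ (ℕ.m≤n⊔m N₀ N₂)) (∣M∣≤B n₂ (ℕ.m≤m⊔n N₀ N₂)) B≤k)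
  where
  open +-*-Solver
  negate : ∀ N .{{_ : NonZero N}} z → ℚ.- (fromℤ z ℚ.* 1/N N) ≡ fromℤ (- z) ℚ.* 1/N N
  negate N z = trans (ℚ.neg-distribˡ-* (fromℤ z) (1/N N)) (cong (ℚ._* 1/N N) (sym (fromℤ-neg z)))
  exchange : ∀ m q e → ℚ.- m ℚ.≤ q ℚ.+ e → ℚ.- q ℚ.≤ m ℚ.+ e
  exchange m q e h = subst₂ ℚ._≤_
    (solve 2 (λ m q → (:- m) :+ (m :- q) := :- q) refl m q)
    (solve 3 (λ m q e → q :+ e :+ (m :- q) := m :+ e) refl m q e)
    (ℚ.+-monoˡ-≤ (m ℚ.- q) h)

systemForms : ∀ {m n} → Vec (Vec ℤ[t] n) m → Vec ℤ[t] m → List (ParametricForm n)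
systemForms []      []      = []
systemForms (a ∷ A) (β ∷ b) = (Vec.map (scale (- 1ℤ)) a , β) ∷ systemForms A b

negated-row : ∀ {n} (a : Vec ℤ[t] n) t x → Vec.map (scale (- 1ℤ)) a ⟨ t ⟩ ∙ x ≡ - (a ⟨ t ⟩ ∙ x)
negated-row a t x = trans (cong (_∙ x) (⟨⟩-scale (- 1ℤ) a t))
  (trans (∙-·ˡ (- 1ℤ) (a ⟨ t ⟩) x) (ℤ.-1*i≡-i (a ⟨ t ⟩ ∙ x)))

satisfies⇔L : ∀ {m n} (A : Vec (Vec ℤ[t] n) m) b t x → Satisfies (systemForms A b) t x ⇔ L A b (+ t) x
satisfies⇔L A b t x = mk⇔
  (λ h → Equivalence.to (integerPoint⇔ (A ⟪ + t ⟫) (b ⟨ + t ⟩) x) (proj₁ (rows A b) h))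
  (λ h → proj₂ (rows A b) (Equivalence.from (integerPoint⇔ (A ⟪ + t ⟫) (b ⟨ + t ⟩) x) h))
  where
  row : ∀ a β → (Vec.map (scale (- 1ℤ)) a , β) ⦅ + t , x ⦆ ≡ evaluate β (+ t) - a ⟨ + t ⟩ ∙ x
  row a β = trans (cong (_+ evaluate β (+ t)) (negated-row a (+ t) x)) (ℤ.+-comm (- (a ⟨ + t ⟩ ∙ x)) (evaluate β (+ t)))
  rows : ∀ {m} (A : Vec (Vec ℤ[t] _) m) b →
    (Satisfies (systemForms A b) t x → Pointwise _≤_ (Vec.map (_∙ x) (A ⟪ + t ⟫)) (b ⟨ + t ⟩)) ×
    (Pointwise _≤_ (Vec.map (_∙ x) (A ⟪ + t ⟫)) (b ⟨ + t ⟩) → Satisfies (systemForms A b) t x)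
  rows []      []      = (λ _ → []) , (λ _ → [])
  rows (a ∷ A) (β ∷ b) =
    (λ { (h ∷ hs) → ℤ.0≤i-j⇒j≤i (subst (0ℤ ≤_) (row a β) h) ∷ proj₁ (rows A b) hs }) ,
    (λ { (h ∷ hs) → subst (0ℤ ≤_) (sym (row a β)) (difference h) ∷ proj₂ (rows A b) hs })

polyhedron-rationallyBounded : ∀ {m n} (A : Vec (Vec ℤ[t] n) m) b t → Bounded (R A b (+ t)) →
  RationallyBounded (List.map (specialise t) (systemForms A b))
polyhedron-rationallyBounded {n = n} A b t (M , bound) =
  let K , K-bound = numerator-bound M
  in n ℕ.* K , λ N x h → subst (‖ x ‖ ℕ.≤_) (sym (ℕ.*-assoc n K N))
       (norm N K K-bound x (bound (quotientPoint N x) (inside N x A b h)))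
  where
  inside : ∀ N .{{_ : NonZero N}} x {m} (A : Vec (Vec ℤ[t] n) m) b →
    All (λ φ → 0ℤ ≤ φ ⟅ + N , x ⟆) (List.map (specialise t) (systemForms A b)) → R A b (+ t) (quotientPoint N x)
  inside N x []      []      _        = []
  inside N x (a ∷ A) (β ∷ b) (h ∷ hs) = quotient-≤ N (a ⟨ + t ⟩) x (evaluate β (+ t))
    (ℤ.0≤i-j⇒j≤i (subst (0ℤ ≤_) (trans (cong (_+ evaluate β (+ t) * + N) (negated-row a (+ t) x)) (ℤ.+-comm (- (a ⟨ + t ⟩ ∙ x)) _)) h))
    ∷ inside N x A b hs
  norm : ∀ N .{{_ : NonZero N}} K → (∀ N .{{_ : NonZero N}} z →
      -ℝ M ≤ℝ fromℚ (fromℤ z ℚ.* 1/N N) × fromℚ (fromℤ z ℚ.* 1/N N) ≤ℝ M → ∣ z ∣ ℕ.≤ K ℕ.* N) →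
    ∀ {n} (x : Vec ℤ n) → Allᵥ.All (λ ξ → -ℝ M ≤ℝ ξ × ξ ≤ℝ M) (quotientPoint N x) → ‖ x ‖ ℕ.≤ n ℕ.* (K ℕ.* N)
  norm N K K-bound []      []       = ℕ.z≤n
  norm N K K-bound (z ∷ x) (h ∷ hs) = ℕ.+-mono-≤ (K-bound N z h) (norm N K K-bound x hs)

-- The ℓth largest value

coordinates : ∀ n → Vec (ParametricForm n) n
coordinates zero    = []
coordinates (suc n) = (constants (1ℤ ∷ 𝟎) , []) ∷ Vec.map (λ (a , β) → [] ∷ a , β) (coordinates n)

outputs-coordinates : ∀ {n} t (x : Vec ℤ n) → outputs (coordinates n) t x ≡ x
outputs-coordinates t []              = refl
outputs-coordinates t (z ∷ x) = cong₂ _∷_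
  (trans (ℤ.+-identityʳ _) (trans (cong (_∙ (z ∷ x)) (⟨⟩-constants (1ℤ ∷ 𝟎) t)) (trans (head-unit 1ℤ z x) (ℤ.*-identityˡ z))))
  (trans (weaken (coordinates _)) (outputs-coordinates t x))
  where
  weaken : ∀ {k} (os : Vec (ParametricForm _) k) →
    outputs (Vec.map (λ (a , β) → [] ∷ a , β) os) t (z ∷ x) ≡ outputs os t x
  weaken []             = refl
  weaken ((a , β) ∷ os) = cong₂ _∷_ (cong (_+ evaluate β t) (ℤ.+-identityˡ (a ⟨ t ⟩ ∙ x))) (weaken os)

Solutions : ∀ {n} → List (List (ParametricForm n)) → ℕ → Vec ℤ n → Set
Solutions Ψs t x = Any (λ Ψ → Satisfies Ψ t x) Ψs

Optimum : {X : Set} → (X → ℤ) → (X → Set) → X → Set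
Optimum value Q x = Q x × (∀ y → Q y → value y ≤ value x)

-- Maximising the vectors `(c ∙ x , x)` by their first entry returns the optimal point `X` along
-- with its value `z`.
optimum-exists : ∀ {n} (c : Vec ℤ[t] n) Ψs K d T →
  (∀ t → T ℕ.≤ t → ∀ x → Solutions Ψs t x → ‖ x ‖ ℕ.≤ K ℕ.* t ℕ.^ suc d) →
  Quasi λ a b → let V t = Solutions Ψs (a ℕ.+ b ℕ.* t)
                    value t x = c ⟨ + (a ℕ.+ b ℕ.* t) ⟩ ∙ x in
    (Eventually λ s → ∀ x → ¬ V s x) ⊎
    (Σ[ X ∈ Vec ℤ[t] n ] Σ[ z ∈ ℤ[t] ] Eventually λ s →
      Optimum (value s) (V s) (X ⟨ + s ⟩) × evaluate z (+ s) ≡ value s (X ⟨ + s ⟩))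
optimum-exists {n} c Ψs K d T bounded = Quasi-map (λ a b → transfer a b) (onProgressions
  (QuasiMaximum-⋃ (All.tabulate λ {Ψ} Ψ∈ → polynomiallyBounded-maximum d Ψ os K T
    λ t T≤t x h → bounded t T≤t x (lose Ψ∈ h))))
  where
  os : Vec (ParametricForm n) (suc n)
  os = (c , []) ∷ coordinates n
  V : ℕ → Vec ℤ (suc n) → Set
  V t w = Any (λ Ψ → Image (Satisfies Ψ) os t w) Ψs
  outputs≡ : ∀ t x → outputs os (+ t) x ≡ c ⟨ + t ⟩ ∙ x ∷ x
  outputs≡ t x = cong₂ _∷_ (ℤ.+-identityʳ (c ⟨ + t ⟩ ∙ x)) (outputs-coordinates (+ t) x)
  toV : ∀ t {x} → Solutions Ψs t x → V t (c ⟨ + t ⟩ ∙ x ∷ x)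
  toV t {x} = Any.map λ h → x , h , sym (outputs≡ t x)
  fromV : ∀ t {z x} → V t (z ∷ x) → Solutions Ψs t x × z ≡ c ⟨ + t ⟩ ∙ x
  fromV t {z} {x} v = Any.map solution v , value (Any.satisfied v)
    where
    solution : ∀ {Ψ} → Image (Satisfies Ψ) os t (z ∷ x) → Satisfies Ψ t x
    solution (x′ , h , eq) with refl ← trans eq (outputs≡ t x′) = h
    value : (∃[ Ψ ] Image (Satisfies Ψ) os t (z ∷ x)) → z ≡ c ⟨ + t ⟩ ∙ x
    value (_ , x′ , h , eq) with refl ← trans eq (outputs≡ t x′) = refl
  transfer : ∀ a b .{{_ : NonZero b}} → MaximumOn V a b → _
  transfer a b (inj₁ (N , h)) = inj₁ (N , λ s N≤s x q → h s N≤s _ (toV (a ℕ.+ b ℕ.* s) q))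
  transfer a b (inj₂ (z ∷ X , N , h)) = inj₂ (X , z , N , λ s N≤s →
    let v , maximal = h s N≤s
        q , z≡ = fromV (a ℕ.+ b ℕ.* s) v
    in (q , λ y q′ → subst (_ ≤_) z≡ (maximal _ (toV (a ℕ.+ b ℕ.* s) q′))) , z≡)

-- The index ℓ is counted from 0 in order of decreasing value.
Nth : {X : Set} → (X → ℤ) → ℕ → (X → Set) → Maybe ℤ → Set
Nth value zero    Q v = ((∀ x → ¬ Q x) × v ≡ nothing) ⊎ (∃[ x ] Optimum value Q x × v ≡ just (value x))
Nth value (suc ℓ) Q v = ((∀ x → ¬ Q x) × v ≡ nothing) ⊎
  (∃[ x ] Optimum value Q x × Nth value ℓ (λ y → Q y × y ≢ x) v)

Nth-cong : ∀ {X : Set} {value : X → ℤ} ℓ {Q Q′ : X → Set} {v} → (∀ x → Q x → Q′ x) → (∀ x → Q′ x → Q x) →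
  Nth value ℓ Q v → Nth value ℓ Q′ v
Nth-cong zero    to from (inj₁ (empty , v≡)) = inj₁ ((λ x q → empty x (from x q)) , v≡)
Nth-cong zero    to from (inj₂ (x , (q , max) , v≡)) = inj₂ (x , (to x q , λ y q′ → max y (from y q′)) , v≡)
Nth-cong (suc ℓ) to from (inj₁ (empty , v≡)) = inj₁ ((λ x q → empty x (from x q)) , v≡)
Nth-cong (suc ℓ) to from (inj₂ (x , (q , max) , rest)) = inj₂ (x , (to x q , λ y q′ → max y (from y q′)) ,
  Nth-cong ℓ (λ y (q , y≢x) → to y q , y≢x) (λ y (q , y≢x) → from y q , y≢x) rest)

PolynomialValue : (ℕ → Maybe ℤ → Set) → ℕ → ℕ → Set
PolynomialValue F a b = Σ[ P ∈ Maybe ℤ[t] ] Eventually λ s →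
  F (a ℕ.+ b ℕ.* s) (Maybe.map (λ p → evaluate p (+ s)) P)

PolynomialValue-progressive : ∀ F → Progressive (PolynomialValue F)
PolynomialValue-progressive F a b c e (P , N , h) =
  Maybe.map (_∘ₚ + c + + e t) P , N , λ s N≤s → subst₂ F
    (sym (cong-progression id a b c e s)) (value P s)
    (h (c ℕ.+ e ℕ.* s) (ℕ.≤-trans N≤s (s≤a+b*s c e s)))
  where
  value : ∀ P s → Maybe.map (λ p → evaluate p (+ (c ℕ.+ e ℕ.* s))) P
                ≡ Maybe.map (λ p → evaluate p (+ s)) (Maybe.map (_∘ₚ + c + + e t) P)
  value nothing  s = refl
  value (just p) s = cong just (sym (evaluate-progression p c e s))

-- The solutions at t = r + d s different from X(s).
module Removal {n} (Ψs : List (List (ParametricForm n))) (r d : ℕ) (X : Vec ℤ[t] n) where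

  reparametrise : ParametricForm n → ParametricForm n
  reparametrise (a , β) = a ∘ᵥ + r + + d t , β ∘ₚ + r + + d t

  reparametrise-correct : ∀ ψ s x → reparametrise ψ ⦅ + s , x ⦆ ≡ ψ ⦅ + (r ℕ.+ d ℕ.* s) , x ⦆
  reparametrise-correct (a , β) s x =
    cong₂ (λ v w → v ∙ x + w) (⟨⟩-progression a r d s) (evaluate-progression β r d s)

  separating : Vec ℤ n → ParametricForm n
  separating u = constants u , scale (- 1ℤ) (u ∙ₚ X) +ₚ (- 1ℤ ∷ [])

  separating-correct : ∀ u s x → separating u ⦅ + s , x ⦆ ≡ u ∙ x - u ∙ X ⟨ + s ⟩ - 1ℤ
  separating-correct u s x = trans
    (cong₂ _+_ (cong (_∙ x) (⟨⟩-constants u (+ s)))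
      (trans (evaluate-+ₚ (scale (- 1ℤ) (u ∙ₚ X)) (- 1ℤ ∷ []) (+ s))
        (cong (_+ (- 1ℤ + + s * 0ℤ)) (trans (evaluate-scale (- 1ℤ) (u ∙ₚ X) (+ s)) (cong (- 1ℤ *_) (evaluate-∙ₚ u X (+ s)))))))
    (identity (u ∙ x) (u ∙ X ⟨ + s ⟩) (+ s))
    where
    identity : ∀ U W s → U + (- 1ℤ * W + (- 1ℤ + s * 0ℤ)) ≡ U - W - 1ℤ
    identity = solve-∀

  -- Being different from `X` is a disjunction over `units n`, so every system splits into several;
  -- this is why lists of systems are considered. A point may satisfy several of them but,
  -- `Solutions` being a predicate, counts once.
  remaining : List (List (ParametricForm n))
  remaining = List.cartesianProductWith (λ Ψ u → separating u ∷ List.map reparametrise Ψ) Ψs (units n)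

  to : ∀ s x → Solutions remaining s x → Solutions Ψs (r ℕ.+ d ℕ.* s) x × x ≢ X ⟨ + s ⟩
  to s x sol =
    let satisfies , apart = Any.cartesianProductWith⁻ (λ Ψ u → separating u ∷ List.map reparametrise Ψ)
          {P = λ Ψ → Satisfies Ψ (r ℕ.+ d ℕ.* s) x} {Q = λ u → 0ℤ ≤ u ∙ x - u ∙ X ⟨ + s ⟩ - 1ℤ}
          (λ { {Ψ} {u} (h ∷ hs) → All.map (λ {ψ} → subst (0ℤ ≤_) (reparametrise-correct ψ s x)) (All.map⁻ hs) ,
                                  subst (0ℤ ≤_) (separating-correct u s x) h }) Ψs (units n) sol
        u , h = Any.satisfied apart
    in satisfies , λ x≡X → 0≰-1-n 0 (subst (0ℤ ≤_)
         (trans (cong (λ y → u ∙ x - u ∙ y - 1ℤ) (sym x≡X)) (identity (u ∙ x))) h)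
    where
    identity : ∀ U → U - U - 1ℤ ≡ - 1ℤ
    identity = solve-∀

  from : ∀ s x → Solutions Ψs (r ℕ.+ d ℕ.* s) x × x ≢ X ⟨ + s ⟩ → Solutions remaining s x
  from s x (sol , x≢X) = Any.cartesianProductWith⁺ _
    (λ {Ψ} {u} h apart → subst (0ℤ ≤_) (sym (separating-correct u s x)) apart ∷
      All.map⁺ (All.map (λ {ψ} → subst (0ℤ ≤_) (sym (reparametrise-correct ψ s x))) h))
    sol (separated x (X ⟨ + s ⟩) x≢X)

  -- For `s ≥ 1`, which `suc T` guarantees, `r + d s ≤ (r + d) s`; the bound keeps its exponent and
  -- only the constant grows.
  remaining-bounded : ∀ {K e T} → (∀ t → T ℕ.≤ t → ∀ x → Solutions Ψs t x → ‖ x ‖ ℕ.≤ K ℕ.* t ℕ.^ suc e) → .{{_ : NonZero d}} →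
    ∀ s → suc T ℕ.≤ s → ∀ x → Solutions remaining s x → ‖ x ‖ ℕ.≤ K ℕ.* (r ℕ.+ d) ℕ.^ suc e ℕ.* s ℕ.^ suc e
  remaining-bounded {K} {e} bounded s@(suc _) T<s x sol = begin
    ‖ x ‖                                            ≤⟨ bounded _ (ℕ.≤-trans (ℕ.<⇒≤ T<s) (s≤a+b*s r d s)) x (proj₁ (to s x sol)) ⟩
    K ℕ.* (r ℕ.+ d ℕ.* s) ℕ.^ suc e                  ≤⟨ ℕ.*-monoʳ-≤ K (ℕ.^-monoˡ-≤ (suc e) time≤) ⟩
    K ℕ.* ((r ℕ.+ d) ℕ.* s) ℕ.^ suc e                ≡⟨ cong (K ℕ.*_) (^-distribʳ-* (suc e) (r ℕ.+ d) s) ⟩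
    K ℕ.* ((r ℕ.+ d) ℕ.^ suc e ℕ.* s ℕ.^ suc e)      ≡⟨ sym (ℕ.*-assoc K _ _) ⟩
    K ℕ.* (r ℕ.+ d) ℕ.^ suc e ℕ.* s ℕ.^ suc e        ∎
    where
    open ℕ.≤-Reasoning
    open import Algebra.Properties.CommutativeSemigroup ℕ.*-commutativeSemigroup using (interchange)
    time≤ : r ℕ.+ d ℕ.* s ℕ.≤ (r ℕ.+ d) ℕ.* s
    time≤ = ℕ.≤-trans (ℕ.+-monoˡ-≤ (d ℕ.* s) (ℕ.m≤m*n r s)) (ℕ.≤-reflexive (sym (ℕ.*-distribʳ-+ s r d)))
    ^-distribʳ-* : ∀ e a b → (a ℕ.* b) ℕ.^ e ≡ a ℕ.^ e ℕ.* b ℕ.^ e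
    ^-distribʳ-* zero    a b = refl
    ^-distribʳ-* (suc e) a b = trans (cong (a ℕ.* b ℕ.*_) (^-distribʳ-* e a b)) (interchange a b (a ℕ.^ e) (b ℕ.^ e))

-- The optimal point is polynomial only along each progression `r + D s`. So it is removed there,
-- with `c` and the systems rewritten in terms of `s`, and the induction on `ℓ` continues on that
-- progression. The resulting periods differ, and `Quasi-merge` reconciles them.
nth-quasiPolynomial : ∀ {n} ℓ (c : Vec ℤ[t] n) Ψs K d T →
  (∀ t → T ℕ.≤ t → ∀ x → Solutions Ψs t x → ‖ x ‖ ℕ.≤ K ℕ.* t ℕ.^ suc d) →
  Quasi (PolynomialValue λ t → Nth (c ⟨ + t ⟩ ∙_) ℓ (Solutions Ψs t))
nth-quasiPolynomial zero c Ψs K d T bounded = Quasi-map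
  (λ { a b (inj₁ (N , h)) → nothing , N , λ s N≤s → inj₁ (h s N≤s , refl)
     ; a b (inj₂ (X , z , N , h)) → just z , N , λ s N≤s →
         let optimum , z≡ = h s N≤s in inj₂ (X ⟨ + s ⟩ , optimum , cong just z≡) })
  (optimum-exists c Ψs K d T bounded)
nth-quasiPolynomial (suc ℓ) c Ψs K d T bounded with optimum-exists c Ψs K d T bounded
... | D , D≢0 , optimal = Quasi-merge (PolynomialValue-progressive F) D {{D≢0}} λ r _ → along r (optimal r)
  where
  F : ℕ → Maybe ℤ → Set
  F t = Nth (c ⟨ + t ⟩ ∙_) (suc ℓ) (Solutions Ψs t)
  along : ∀ r → _ → Quasi λ a b → PolynomialValue F (r ℕ.+ D ℕ.* a) (D ℕ.* b)
  along r (inj₁ (N , h)) = 1 , _ , λ a → nothing , N , λ s N≤s →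
    subst (λ t → F t nothing) (sym (cong-progression id r D a 1 s))
      (inj₁ (h (a ℕ.+ 1 ℕ.* s) (ℕ.≤-trans N≤s (s≤a+b*s a 1 s)) , refl))
  along r (inj₂ (X , _ , N , h)) = Quasi-map next
    (nth-quasiPolynomial ℓ (c ∘ᵥ + r + + D t) remaining (K ℕ.* (r ℕ.+ D) ℕ.^ suc d) d (suc T)
      (remaining-bounded {K} {d} bounded {{D≢0}}))
    where
    open Removal Ψs r D X
    next : ∀ a b .{{_ : NonZero b}} →
      PolynomialValue (λ t → Nth ((c ∘ᵥ + r + + D t) ⟨ + t ⟩ ∙_) ℓ (Solutions remaining t)) a b →
      PolynomialValue F (r ℕ.+ D ℕ.* a) (D ℕ.* b)
    next a b (P , N′ , h′) = P , N ℕ.⊔ N′ , λ s N≤s →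
      let s′ = a ℕ.+ b ℕ.* s
          v = Maybe.map (λ p → evaluate p (+ s)) P
          optimum , _ = h s′ (ℕ.≤-trans (ℕ.m⊔n≤o⇒m≤o N N′ N≤s) (s≤a+b*s a b s))
      in subst (λ t → F t v) (sym (cong-progression id r D a b s))
           (inj₂ (X ⟨ + s′ ⟩ , optimum , Nth-cong ℓ (to s′) (from s′)
             (subst (λ c → Nth (c ∙_) ℓ (Solutions remaining s′) v) (⟨⟩-progression c r D s′)
               (h′ s (ℕ.m⊔n≤o⇒n≤o N N′ N≤s)))))

-- Sorted lists of values

extract : ∀ {X : Set} {x : X} {xs} → x ∈ xs → ∃[ ys ] xs ↭ x ∷ ys
extract {x = x} x∈xs with ∈-∃++ x∈xs
... | ys , zs , refl = ys List.++ zs , shift x ys zs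

-- Both sides are descending permutations of `xs`, and such a list is unique.
sort-maximum : ∀ {xs ys z} → xs ↭ z ∷ ys → All (_≤ z) ys → Descending.sort xs ≡ z ∷ Descending.sort ys
sort-maximum {xs} {ys} {z} xs↭ ys≤z = Pointwise-≡⇒≡ (↗↭↗⇒≋ (Flip.totalOrder ℤ.≤-totalOrder)
  (Descending.sort-↗ xs)
  (AllPairs⇒Linked (All-resp-↭ (↭-sym (Descending.sort-↭ ys)) ys≤z ∷
    Linked⇒AllPairs (λ x≥y y≥z → ℤ.≤-trans y≥z x≥y) (Descending.sort-↗ ys)))
  (↭⇒↭ₛ (↭-trans (Descending.sort-↭ xs) (↭-trans xs↭ (prep z (↭-sym (Descending.sort-↭ ys)))))))

module _ {X : Set} (value : X → ℤ) where

  private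
    Lists : List X → (X → Set) → Set
    Lists xs Q = ∀ x → x ∈ xs ⇔ Q x

    sorted : List X → List ℤ
    sorted xs = Descending.sort (List.map value xs)

  sorted-∅ : ∀ {xs Q} → Lists xs Q → (∀ x → ¬ Q x) → sorted xs ≡ []
  sorted-∅ {[]}     _  _     = ↭-empty-inv (Descending.sort-↭ [])
  sorted-∅ {x ∷ xs} xs⇔Q empty = ⊥-elim (empty x (Equivalence.to (xs⇔Q x) (here refl)))

  -- Under ties the optimum `x` need not be the point whose value the sort puts first, but that
  -- value is the same. Other points with this value stay in `ys`, which accounts for multiplicity.
  sorted-optimum : ∀ {xs Q x} → Unique xs → Lists xs Q → Optimum value Q x →
    ∃[ ys ] Unique ys × Lists ys (λ y → Q y × y ≢ x) × sorted xs ≡ value x ∷ sorted ys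
  sorted-optimum {xs} {Q} {x} unique xs⇔Q (q , max)
    with extract (Equivalence.from (xs⇔Q x) q)
  ... | ys , xs↭ with Permutationₛ.Unique-resp-↭ (setoid X) (↭⇒↭ₛ xs↭) unique
  ...   | x∉ys ∷ unique′ = ys , unique′ , lists ,
            sort-maximum (map⁺ value xs↭) (All.tabulate λ z∈ →
              let y , y∈ys , z≡ = ∈-map⁻ value z∈
              in subst (_≤ value x) (sym z≡) (max y (proj₁ (Equivalence.to (lists y) y∈ys))))
    where
    tail∈ : ∀ {y} → y ≢ x → y ∈ x ∷ ys → y ∈ ys
    tail∈ y≢x (here y≡x)   = ⊥-elim (y≢x y≡x)
    tail∈ y≢x (there y∈ys) = y∈ys
    lists : Lists ys (λ y → Q y × y ≢ x)
    lists y = mk⇔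
      (λ y∈ys → Equivalence.to (xs⇔Q y) (∈-resp-↭ (↭-sym xs↭) (there y∈ys)) ,
                λ y≡x → All.lookup x∉ys y∈ys (sym y≡x))
      (λ (qy , y≢x) → tail∈ y≢x (∈-resp-↭ xs↭ (Equivalence.from (xs⇔Q y) qy)))

  nth-sorted : ∀ ℓ {xs Q v} → Unique xs → Lists xs Q → Nth value ℓ Q v →
    List.head (List.drop ℓ (sorted xs)) ≡ v
  nth-sorted zero    unique xs⇔Q (inj₁ (empty , v≡)) =
    trans (cong List.head (sorted-∅ xs⇔Q empty)) (sym v≡)
  nth-sorted (suc ℓ) unique xs⇔Q (inj₁ (empty , v≡)) =
    trans (cong (List.head ∘ List.drop (suc ℓ)) (sorted-∅ xs⇔Q empty)) (sym v≡)
  nth-sorted zero    unique xs⇔Q (inj₂ (x , optimum , v≡)) =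
    let _ , _ , _ , eq = sorted-optimum unique xs⇔Q optimum in trans (cong List.head eq) (sym v≡)
  nth-sorted (suc ℓ) unique xs⇔Q (inj₂ (x , optimum , rest)) =
    let ys , unique′ , lists , eq = sorted-optimum unique xs⇔Q optimum
    in trans (cong (List.head ∘ List.drop (suc ℓ)) eq) (nth-sorted ℓ unique′ lists rest)

-- From progressions to real quasi-polynomials

open CommutativeRing ℚ.+-*-commutativeRing using () renaming (commutativeSemiring to ℚ-commutativeSemiring)
module ℚ[t] = PolynomialArithmetic ℚ-commutativeSemiring
module Overℚ = Over (CommutativeSemiring.rawSemiring ℚ-commutativeSemiring)

evaluate-fromℤ : ∀ p s → Overℚ.evaluate (List.map fromℤ p) (fromℤ s) ≡ fromℤ (evaluate p s)
evaluate-fromℤ []      s = refl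
evaluate-fromℤ (a ∷ p) s = trans
  (cong (fromℤ a ℚ.+_) (trans (cong (fromℤ s ℚ.*_) (evaluate-fromℤ p s)) (sym (fromℤ-* s (evaluate p s)))))
  (sym (fromℤ-+ a (s * evaluate p s)))

evaluate-fromℚ : ∀ q t i → seq (Overℝ.evaluate (List.map fromℚ q) (ι t)) i ≡ Overℚ.evaluate q (fromℤ t)
evaluate-fromℚ []      t i = refl
evaluate-fromℚ (a ∷ q) t i = cong (λ v → a ℚ.+ fromℤ t ℚ.* v) (evaluate-fromℚ q t i)

-- p((t - r) / d)
unprogress : ℤ[t] → ℕ → (d : ℕ) .{{_ : NonZero d}} → ℝ[t]
unprogress p r d = List.map fromℚ (List.map fromℤ p ℚ[t].∘ₚ (ℚ.- (fromℤ (+ r) ℚ.* 1/N d)) + 1/N d t)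

-- Solving `τ = r + s d` for `s` needs rational coefficients only, and these are constant sequences,
-- so the two sides agree at every index.
unprogress-correct : ∀ p r d .{{_ : NonZero d}} s τ → + τ ≡ + r + + s * + d →
  ι (evaluate p (+ s)) ≃ Overℝ.evaluate (unprogress p r d) (ι (+ τ))
unprogress-correct p r d s τ τ≡ ε = 0 , λ i _ → ℚ.≤-trans (ℚ.≤-reflexive (begin
  ℚ.∣ fromℤ v ℚ.- seq (Overℝ.evaluate (unprogress p r d) (ι (+ τ))) i ∣  ≡⟨ cong (λ w → ℚ.∣ fromℤ v ℚ.- w ∣) (value i) ⟩
  ℚ.∣ fromℤ v ℚ.- fromℤ v ∣                                              ≡⟨ cong ℚ.∣_∣ (ℚ.+-inverseʳ (fromℤ v)) ⟩
  ℚ.0ℚ                                                                   ∎)) (ℚ.<⇒≤ (ℚ.positive⁻¹ ε))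
  where
  open ≡-Reasoning
  v = evaluate p (+ s)
  ν = 1/N d
  κ = ℚ.- (fromℤ (+ r) ℚ.* ν)
  time : κ ℚ.+ ν ℚ.* fromℤ (+ τ) ≡ fromℤ (+ s)
  time = begin
    κ ℚ.+ ν ℚ.* fromℤ (+ τ)
      ≡⟨ cong (λ w → κ ℚ.+ ν ℚ.* w) (trans (cong fromℤ τ≡) (fromℤ-+ (+ r) (+ s * + d))) ⟩
    κ ℚ.+ ν ℚ.* (fromℤ (+ r) ℚ.+ fromℤ (+ s * + d))
      ≡⟨ solve 3 (λ r ν w → (:- (r :* ν)) :+ ν :* (r :+ w) := w :* ν) refl (fromℤ (+ r)) ν (fromℤ (+ s * + d)) ⟩
    fromℤ (+ s * + d) ℚ.* ν
      ≡⟨ fromℤ-*N/N d (+ s) ⟩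
    fromℤ (+ s)  ∎
    where open +-*-Solver
  value : ∀ i → seq (Overℝ.evaluate (unprogress p r d) (ι (+ τ))) i ≡ fromℤ v
  value i = begin
    seq (Overℝ.evaluate (unprogress p r d) (ι (+ τ))) i
      ≡⟨ evaluate-fromℚ (List.map fromℤ p ℚ[t].∘ₚ κ + ν t) (+ τ) i ⟩
    Overℚ.evaluate (List.map fromℤ p ℚ[t].∘ₚ κ + ν t) (fromℤ (+ τ))
      ≡⟨ ℚ[t].evaluate-∘ₚ (List.map fromℤ p) κ ν (fromℤ (+ τ)) ⟩
    Overℚ.evaluate (List.map fromℤ p) (κ ℚ.+ ν ℚ.* fromℤ (+ τ))
      ≡⟨ cong (Overℚ.evaluate (List.map fromℤ p)) time ⟩
    Overℚ.evaluate (List.map fromℤ p) (fromℤ (+ s))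
      ≡⟨ evaluate-fromℤ p (+ s) ⟩
    fromℤ v  ∎

bound-below : (N : ℕ → ℕ) → ∀ d → Σ[ T ∈ ℕ ] ∀ r → r ℕ.< d → N r ℕ.≤ T
bound-below N zero    = 0 , λ _ ()
bound-below N (suc d) =
  let T , bound = bound-below N d
  in N d ℕ.⊔ T , λ r r<1+d → Sum.[ (λ r<d → ℕ.≤-trans (bound r r<d) (ℕ.m≤n⊔m (N d) T)) ,
       (λ r≡d → subst (λ r → N r ℕ.≤ N d ℕ.⊔ T) (sym r≡d) (ℕ.m≤m⊔n (N d) T)) ] (ℕ.m<1+n⇒m<n∨m≡n r<1+d)

eventuallyQuasiPolynomial : ∀ {F : ℕ → Maybe ℤ → Set} (g : ∀ t → Positive t → ℤ ₋) →
  (∀ t t>0 {v} → F t v → g (+ t) t>0 ≡ v) → Quasi (PolynomialValue F) →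
  EventuallyQuasiPolynomial Positive λ t t>0 → ι₋ (g t t>0)
-- `t > S d` gives `t / d ≥ S`, beyond the thresholds of all residues; `suc` keeps `t` positive even
-- for `S = 0`.
eventuallyQuasiPolynomial {F} g g-value (d , d≢0 , values) = d , d≢0 , Q , + suc (S ℕ.* d) , at
  where
  instance
    nonZero : NonZero d
    nonZero = d≢0
  P : ℕ → Maybe ℤ[t]
  P r = proj₁ (values r)
  Q : Fin d → ℝ[t] ₋
  Q i = Maybe.map (λ p → unprogress p (Fin.toℕ i) d) (P (Fin.toℕ i))
  S = proj₁ (bound-below (λ r → proj₁ (proj₂ (values r))) d)
  S-bound = proj₂ (bound-below (λ r → proj₁ (proj₂ (values r))) d)
  agree : ∀ P r s τ → + τ ≡ + r + + s * + d →
    ι₋ (Maybe.map (λ p → evaluate p (+ s)) P) ≈₋ evaluate₋ (Maybe.map (λ p → unprogress p r d) P) (+ τ)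
  agree nothing  r s τ τ≡ = ⊥₋≈⊥₋
  agree (just p) r s τ τ≡ = [ unprogress-correct p r d s τ τ≡ ]
  at : ∀ t → + suc (S ℕ.* d) ≤ t →
    Positive t × (∀ t>0 → ι₋ (g t t>0) ≈₋ evaluate₋ (Q (residue t d)) t)
  at (+ τ) (+≤+ T≤τ) = ℤ.positive (ℤ.+<+ (ℕ.≤-trans (ℕ.s≤s ℕ.z≤n) T≤τ)) , λ t>0 →
    subst (λ v → ι₋ v ≈₋ evaluate₋ (Q (residue (+ τ) d)) (+ τ))
      (sym (g-value τ t>0 (subst (λ t → F t (Maybe.map (λ p → evaluate p (+ s)) (P r))) (sym τ≡ℕ)
        (proj₂ (proj₂ (values r)) s (ℕ.≤-trans (S-bound r r<d) S≤s)))))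
      (subst (λ i → ι₋ (Maybe.map (λ p → evaluate p (+ s)) (P r)) ≈₋ evaluate₋ (Maybe.map (λ p → unprogress p i d) (P i)) (+ τ))
        (sym (Fin.toℕ-fromℕ< (ℤ.n%ℕd<d (+ τ) d)))
        (agree (P r) r s τ (ℤ.a≡a%ℕn+[a/ℕn]*n (+ τ) d)))
    where
    r = τ ℕ.% d
    s = τ ℕ./ d
    r<d : r ℕ.< d
    r<d = ℕ.m%n<n τ d
    τ≡ℕ : τ ≡ r ℕ.+ d ℕ.* s
    τ≡ℕ = trans (ℕ.m≡m%n+[m/n]*n τ d) (cong (r ℕ.+_) (ℕ.*-comm s d))
    S≤s : S ℕ.≤ s
    S≤s = subst (ℕ._≤ s) (ℕ.m*n/n≡m S d) (ℕ./-monoˡ-≤ d (ℕ.<⇒≤ T≤τ))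

theorem1p3 : ∀ (n m : ℕ) .{{_ : NonZero n}} .{{_ : NonZero m}}
    (c : Vec ℤ[t] n) (A : Vec (Vec ℤ[t] n) m) (b : Vec ℤ[t] m)
    (bounded : ∀ (t : ℤ) .{{_ : Positive t}} → Bounded (R A b t))
    (ℓ : ℕ) .{{_ : NonZero ℓ}} →
    EventuallyQuasiPolynomial Positive
    (λ t t>0 → ι₋ (f c A b bounded ℓ t {{t>0}}))
theorem1p3 n m c A b bounded ℓ = eventuallyQuasiPolynomial
  (λ t t>0 → f c A b bounded ℓ t {{t>0}}) value (nth-quasiPolynomial (ℕ.pred ℓ) c (Ψ ∷ []) K d 1 norm≤)
  where
  Ψ = systemForms A b
  bound = solutions-bounded Ψ λ { t@(suc _) → polyhedron-rationallyBounded A b t (bounded (+ t)) }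
  K = proj₁ bound
  d = proj₁ (proj₂ bound)
  single : ∀ t x → Solutions (Ψ ∷ []) t x → Satisfies Ψ t x
  single t x (here h) = h
  -- The exponent is raised by one because `polynomiallyBounded-maximum` starts from a linear bound;
  -- for `t ≥ 1` this only weakens the estimate.
  norm≤ : ∀ t → 1 ℕ.≤ t → ∀ x → Solutions (Ψ ∷ []) t x → ‖ x ‖ ℕ.≤ K ℕ.* t ℕ.^ suc d
  norm≤ t@(suc _) _ x h = ℕ.≤-trans (proj₂ (proj₂ bound) t x (single t x h))
    (ℕ.*-monoʳ-≤ K (ℕ.^-monoʳ-≤ t (ℕ.n≤1+n d)))
  value : ∀ t t>0 {v} → Nth (c ⟨ + t ⟩ ∙_) (ℕ.pred ℓ) (Solutions (Ψ ∷ []) t) v →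
    f c A b bounded ℓ (+ t) {{t>0}} ≡ v
  value t t>0 = nth-sorted (c ⟨ + t ⟩ ∙_) (ℕ.pred ℓ) (Enumeration.unique E) λ x → mk⇔
    (λ x∈ → here (Equivalence.from (satisfies⇔L A b t x) (Equivalence.to (Enumeration.exact E x) x∈)))
    (λ h → Equivalence.from (Enumeration.exact E x) (Equivalence.to (satisfies⇔L A b t x) (single t x h)))
    where
    E = L-enumeration c A b bounded (+ t) {{t>0}}
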